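{- Let $n=2p_1p_2\cdots p_\ell$ be square free, where $p_1,\dots,p_\ell$ are $\ell\ge1$ distinct odd primes. Then $$\Psi^w_{\mathbb{Z}_n}(x)=\frac{1}{\phi(n)}\sum_{(d_1,\dots,d_\ell)}\left(\prod_{i=1}^{\ell}\phi\!\left(\frac{p_i-1}{d_i}\right)\right)\left[(-1)^{\ell}x+\sum_{\substack{R\subseteq\{1,\dots,\ell\}\\ |R|\le\ell-1}}(-1)^{|R|}\Big((1+x)F_R(d_1,\dots,d_\ell)^2-F_R(d_1,\dots,d_\ell)\Big)\right],$$ where $d_i$ runs over all positive divisors of $p_i-1$ for each $i$.
   Context: $\phi$ is Euler's totient function. Fix divisors $d_i\mid p_i-1$. For a nonempty set $T\subseteq\{1,\dots,\ell\}$ define the integer $\alpha_T$ as follows: if $T=\{i\}$, $\alpha_T=\frac{p_i-1}{\gcd(d_i,\frac{p_i-1}{2})}$; if $|T|\ge2$, let $L_T=\mathrm{lcm}\{\frac{p_i-1}{d_i}: i\in T\}$ and set $\alpha_T=L_T$ if $d_i\mid\frac{p_i-1}{2}$ for all $i\in T$ and there is an integer $c$ with $cd_i\equiv\frac{p_i-1}{2}\pmod{p_i-1}$ for all $i\in T$, and $\alpha_T=2L_T$ otherwise. Put $f_T=\left(1+x^{\alpha_T}\right)^{\prod_{i\in T}(p_i-1)/\alpha_T}$, and for $R\subseteq\{1,\dots,\ell\}$ put $F_R(d_1,\dots,d_\ell)=\prod_{\emptyset\neq T\subseteq\{1,\dots,\ell\}\setminus R}f_T$. For the cyclic group $\mathbb{Z}_n$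 and a generating set $\Omega$ with $\Omega=-\Omega$, $0\notin\Omega$, the Cayley graph $C(\mathbb{Z}_n,\Omega)$ has vertex set $\mathbb{Z}_n$ and edges $\{g,h\}$ with $h-g\in\Omega$, with $\mathbb{Z}_n$ acting by translation. A graph isomorphism $f$ between two such Cayley graphs is a weak equivalence if there is a group automorphism $\alpha$ of $\mathbb{Z}_n$ with $f(g+u)=\alpha(g)+f(u)$ for all $g,u$. $a^w_k(\mathbb{Z}_n)$ is the number of weak equivalence classes of Cayley graphs $C(\mathbb{Z}_n,\Omega)$ with $|\Omega|=k$ and $\Psi^w_{\mathbb{Z}_n}(x)=\sum_{k=1}^{n-1}a^w_k(\mathbb{Z}_n)x^k$. -}

module Defs where

open import Data.Bool.Base using (Bool; true; false; if_then_else_; _∧_; _∨_; not)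
open import Data.Nat.Base as ℕ using (ℕ; zero; suc; _+_; _*_; _∸_; _≤_; _<_; _≡ᵇ_; _%_; _/_)
open import Data.Nat.DivMod using (_mod_)
import Data.Bool.Properties as B
open import Data.Nat.Properties using (_≟_; _≤?_)
open import Data.Nat.Divisibility using (_∣_; _∣?_)
open import Data.Nat.GCD using (gcd)
open import Data.Nat.LCM using (lcm)
open import Data.Fin.Base as Fin using (Fin; toℕ)
open import Data.Fin.Subset using (Subset; _∈_; _∉_; ∣_∣; inside; outside)
open import Data.Vec.Base using (Vec; []; _∷_; lookup)
open import Data.List.Base as List using (List; []; _∷_; map; filter; concatMap; upTo; foldr; length; allFin)
open import Data.Bool.ListAction using (any; all)
open import Data.List.Relation.Unary.All using (All)
open import Data.List.Relation.Unary.Any using (Any)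
open import Data.List.Relation.Unary.AllPairs using (AllPairs)
open import Data.Integer.Base as ℤ using (ℤ; +_; -_)
open import Data.Product using (Σ; ∃; ∃-syntax; _×_; _,_)
open import Data.Sum using (_⊎_)
open import Relation.Binary.PropositionalEquality using (_≡_)
open import Relation.Nullary using (¬_)
open import Relation.Nullary.Decidable using (⌊_⌋)
open import Function.Definitions using (Bijective)
open import Function.Bundles using (_⇔_)

φ : ℕ → ℕ
φ m = length (filter (λ j → gcd j m ≟ 1) (map suc (upTo m)))

infixl 6 _⊕_ _⊖_

_⊕_ : ∀ {n} → Fin n → Fin n → Fin n
_⊕_ {suc m} a b = (toℕ a + toℕ b) mod suc m

⊝_ : ∀ {n} → Fin n → Fin n
⊝_ {suc m} a = (suc m ∸ toℕ a) mod suc m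

_⊖_ : ∀ {n} → Fin n → Fin n → Fin n
a ⊖ b = a ⊕ (⊝ b)

IsZero : ∀ {n} → Fin n → Set
IsZero x = toℕ x ≡ 0

data Gen {n : ℕ} (Ω : Subset n) : Fin n → Set where
  gen-zero : ∀ x → IsZero x → Gen Ω x
  gen-mem  : ∀ x → x ∈ Ω → Gen Ω x
  gen-neg  : ∀ x → Gen Ω x → Gen Ω (⊝ x)
  gen-add  : ∀ x y → Gen Ω x → Gen Ω y → Gen Ω (x ⊕ y)

Generates : ∀ {n} → Subset n → Set
Generates Ω = ∀ x → Gen Ω x

ConnectionSet : ∀ {n} → Subset n → Set
ConnectionSet Ω =
  Generates Ω × (∀ x → x ∈ Ω → (⊝ x) ∈ Ω) × (∀ x → IsZero x → x ∉ Ω)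

Adj : ∀ {n} → Subset n → Fin n → Fin n → Set
Adj Ω g h = (h ⊖ g) ∈ Ω

IsGraphIso : ∀ {n} → Subset n → Subset n → (Fin n → Fin n) → Set
IsGraphIso Ω Ω' f = Bijective _≡_ _≡_ f × (∀ g h → Adj Ω g h ⇔ Adj Ω' (f g) (f h))

IsGroupAut : ∀ {n} → (Fin n → Fin n) → Set
IsGroupAut α = Bijective _≡_ _≡_ α × (∀ a b → α (a ⊕ b) ≡ α a ⊕ α b)

WeaklyEquivalent : ∀ {n} → Subset n → Subset n → Set
WeaklyEquivalent {n} Ω Ω' =
  Σ (Fin n → Fin n) λ f → IsGraphIso Ω Ω' f ×
  Σ (Fin n → Fin n) λ α → IsGroupAut α × (∀ g u → f (g ⊕ u) ≡ α g ⊕ f u)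

ClassCount : (n k m : ℕ) → Set
ClassCount n k m =
  Σ (List (Subset n)) λ reps →
    length reps ≡ m ×
    All (λ Ω → ConnectionSet Ω × ∣ Ω ∣ ≡ k) reps ×
    AllPairs (λ A B → ¬ WeaklyEquivalent A B) reps ×
    (∀ Ω → ConnectionSet Ω → ∣ Ω ∣ ≡ k → Any (WeaklyEquivalent Ω) reps)

-- m is the coefficient of x^k in Ψ^w_{ℤ_n}(x) = Σ_{k=1}^{n-1} a^w_k x^k
PsiCoeff : (n k m : ℕ) → Set
PsiCoeff n k m =
  (1 ≤ k × k < n × ClassCount n k m) ⊎ ((k ≡ 0 ⊎ n ≤ k) × m ≡ 0)

-- Polynomials with integer coefficients as coefficient lists
-- (lowest degree first)

Poly : Set
Poly = List ℤ

padd : Poly → Poly → Poly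
padd [] q = q
padd (a ∷ p) [] = a ∷ p
padd (a ∷ p) (b ∷ q) = (a ℤ.+ b) ∷ padd p q

pscale : ℤ → Poly → Poly
pscale c = map (c ℤ.*_)

pmul : Poly → Poly → Poly
pmul [] q = []
pmul (a ∷ p) q = padd (pscale a q) (+ 0 ∷ pmul p q)

pneg : Poly → Poly
pneg = pscale (- (+ 1))

psub : Poly → Poly → Poly
psub p q = padd p (pneg q)

pone : Poly
pone = + 1 ∷ []

xpow : ℕ → Poly
xpow zero = pone
xpow (suc a) = + 0 ∷ xpow a

ppow : Poly → ℕ → Poly
ppow p zero = pone
ppow p (suc e) = pmul p (ppow p e)

psum : List Poly → Poly
psum = foldr padd []

pprod : List Poly → Poly
pprod = foldr pmul pone

coeff : ℕ → Poly → ℤ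
coeff k [] = + 0
coeff zero (a ∷ p) = a
coeff (suc k) (a ∷ p) = coeff k p

-- truncated division; only ever applied with a nonzero divisor below
div : ℕ → ℕ → ℕ
div m zero = 0
div m (suc d) = m / suc d

congMod : ℕ → ℕ → ℕ → Bool
congMod a b zero = a ≡ᵇ b
congMod a b (suc m) = (a % suc m) ≡ᵇ (b % suc m)

prodF : (ℓ : ℕ) → (Fin ℓ → ℕ) → ℕ
prodF ℓ f = foldr _*_ 1 (map f (allFin ℓ))

sgn : ℕ → ℤ
sgn zero = + 1
sgn (suc k) = - sgn k

divisors : ℕ → List ℕ
divisors m = filter (λ d → d ∣? m) (map suc (upTo m))

tuples : (ℓ : ℕ) → (Fin ℓ → List ℕ) → List (Fin ℓ → ℕ)
tuples zero L = (λ ()) ∷ []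
tuples (suc ℓ) L =
  concatMap (λ a → map (λ t → cons a t) (tuples ℓ (λ i → L (Fin.suc i)))) (L Fin.zero)
  where
  cons : ℕ → (Fin ℓ → ℕ) → Fin (suc ℓ) → ℕ
  cons a t Fin.zero = a
  cons a t (Fin.suc i) = t i

allSubsets : (ℓ : ℕ) → List (Subset ℓ)
allSubsets zero = [] ∷ []
allSubsets (suc ℓ) = concatMap (λ s → (outside ∷ s) ∷ (inside ∷ s) ∷ []) (allSubsets ℓ)

elems : ∀ {ℓ} → Subset ℓ → List (Fin ℓ)
elems {ℓ} T = filter (λ i → lookup T i B.≟ true) (allFin ℓ)

disjoint : ∀ {ℓ} → Subset ℓ → Subset ℓ → Bool
disjoint {ℓ} T R = all (λ i → not (lookup T i ∧ lookup R i)) (allFin ℓ)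

module _ {ℓ : ℕ} (p d : Fin ℓ → ℕ) where

  m′ : Fin ℓ → ℕ
  m′ i = p i ∸ 1

  h′ : Fin ℓ → ℕ
  h′ i = div (m′ i) 2

  prodT : Subset ℓ → ℕ
  prodT T = foldr _*_ 1 (map m′ (elems T))

  LT : Subset ℓ → ℕ
  LT T = foldr lcm 1 (map (λ i → div (m′ i) (d i)) (elems T))

  allDivHalf : Subset ℓ → Bool
  allDivHalf T = all (λ i → ⌊ d i ∣? h′ i ⌋) (elems T)

  -- ∃ c with c d_i ≡ (p_i-1)/2 (mod p_i - 1) for all i ∈ T.
  -- It suffices to search 0 ≤ c < ∏_{i∈T}(p_i-1), since every modulus
  -- p_i - 1 divides this product.
  commonSol : Subset ℓ → Bool
  commonSol T =
    any (λ c → all (λ i → congMod (c * d i) (h′ i) (m′ i)) (elems T))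
        (upTo (prodT T))

  alpha : Subset ℓ → ℕ
  alpha T with elems T
  ... | i ∷ [] = div (m′ i) (gcd (d i) (h′ i))
  ... | _ = if allDivHalf T ∧ commonSol T then LT T else 2 * LT T

  fT : Subset ℓ → Poly
  fT T = ppow (padd pone (xpow (alpha T))) (div (prodT T) (alpha T))

  FR : Subset ℓ → Poly
  FR R = pprod (map fT (filter (λ T → (1 ≤? ∣ T ∣) Relation.Nullary.Decidable.×-dec (disjoint T R B.≟ true)) (allSubsets ℓ)))

  bracket : Poly
  bracket =
    padd (pscale (sgn ℓ) (xpow 1))
      (psum (map (λ R → pscale (sgn ∣ R ∣)
                   (psub (pmul (padd pone (xpow 1)) (pmul (FR R) (FR R))) (FR R)))
                 (filter (λ R → ∣ R ∣ ≤? ℓ ∸ 1) (allSubsets ℓ))))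

-- Σ_{(d_1..d_ℓ), d_i ∣ p_i - 1} (∏ φ((p_i-1)/d_i)) · bracket
-- (this is φ(n) times the right-hand side of the theorem)
RHSnum : (ℓ : ℕ) → (Fin ℓ → ℕ) → Poly
RHSnum ℓ p =
  psum (map (λ d → pscale (+ prodF ℓ (λ i → φ (div (p i ∸ 1) (d i)))) (bracket p d))
            (tuples ℓ (λ i → divisors (p i ∸ 1))))

{-# OPTIONS --safe #-}
-- Translating f(0) to 0 turns a weak equivalence into multiplication by a unit, so a^w_k counts the
-- orbits of the units u of ℤ_n on connection sets of size k, and Burnside's lemma expresses φ(n) a^w_k
-- as the sum over u of the number of connection sets of size k fixed by u.
--
-- A set Ω = -Ω generates ℤ_n iff no prime factor of n divides all its elements. Möbius inversion over
-- sets of prime factors therefore reduces to counting the unions of orbits of ⟨u, -1⟩ among the nonzero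
-- elements divisible by a given set of primes. Sort these elements by the set T of odd p_i not dividing
-- them and by parity. Each sort has ∏_{i∈T} (p_i - 1) elements, in orbits whose size is the order of the
-- group generated by u and -1 modulo ∏_{i∈T} p_i. If u has index d_i modulo p_i, that size is α_T: u^c is
-- -1 modulo p_i exactly when c d_i ≡ (p_i - 1)/2 modulo p_i - 1. Each sort thus contributes the factor
-- f_T, and inclusion or exclusion of the prime 2 gives the terms F_R and (1 + x) F_R².
--
-- So the number of fixed sets depends only on the indices d_i, and by the Chinese remainder theorem
-- ∏ φ((p_i - 1)/d_i) units have the indices d_1, …, d_ℓ.
module Submission where

open import Defs
open import Algebra.Bundles using (CommutativeMonoid)
open import Data.Bool.Base using (Bool; true; false; if_then_else_; _∧_; _∨_; not; T)
import Data.Bool.Properties as B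
open import Data.Bool.ListAction using (any; all)
open import Data.Empty using (⊥)
open import Data.Unit.Base using (tt)
open import Data.Nat.Base as ℕ using (ℕ; zero; suc; _+_; _*_; _∸_; _≤_; _<_; _%_; _/_; z≤n; s≤s; NonZero)
import Data.Nat.Properties as ℕ
open import Data.Nat.DivMod using (_mod_)
import Data.Nat.DivMod as DM
open import Data.Nat.Divisibility using (_∣_; _∣?_; divides)
import Data.Nat.Divisibility as Dv
open import Data.Nat.GCD using (gcd)
import Data.Nat.GCD as G
open import Data.Nat.LCM using (lcm)
import Data.Nat.LCM as L
open import Data.Nat.Coprimality using (Coprime)
import Data.Nat.Coprimality as C
open import Data.Nat.Primality using (Prime; euclidsLemma)
import Data.Nat.Primality as Pr
open import Data.Fin.Base as Fin using (Fin; toℕ)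
import Data.Fin.Properties as F
open import Data.Fin.Subset using (Subset; inside; outside; ∣_∣) renaming (_∈_ to _∈ₛ_)
import Data.Fin.Subset.Properties as FS
open import Data.Vec.Base as Vec using (Vec; []; _∷_; lookup; tabulate)
import Data.Vec.Properties as V
open import Data.List.Base as List using (List; []; _∷_; _++_; map; filter; concatMap; upTo; foldr; length; allFin; deduplicate)
import Data.List.Properties as LP
open import Data.List.Membership.Propositional using (_∈_; find)
open import Data.List.Membership.Propositional.Properties
open import Data.List.Relation.Unary.All as All using (All; []; _∷_)
import Data.List.Relation.Unary.All.Properties as AllP
open import Data.List.Relation.Unary.Any as Any using (Any; here; there; any?)
import Data.List.Relation.Unary.Any.Properties as AnyP
open import Data.List.Relation.Unary.AllPairs using (AllPairs; []; _∷_)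
open import Data.List.Relation.Unary.Unique.Propositional using (Unique)
import Data.List.Relation.Unary.Unique.Propositional.Properties as U
open import Data.List.Relation.Binary.Permutation.Propositional using (_↭_; ↭-sym; ↭-trans; ↭-refl; ↭-reflexive; prep; swap)
import Data.List.Relation.Binary.Permutation.Propositional as Perm
import Data.List.Relation.Binary.Permutation.Propositional.Properties as P
open import Data.Integer.Base as ℤ using (ℤ; +_; -_) renaming (_+_ to _+ℤ_; _*_ to _*ℤ_; _-_ to _-ℤ_; _^_ to _^ℤ_)
import Data.Integer.Properties as ℤ
open import Data.Integer.Tactic.RingSolver using (solve-∀)
open import Data.Product using (∃; ∃-syntax; _×_; _,_; proj₁; proj₂)
open import Data.Sum using (_⊎_; inj₁; inj₂)
open import Function.Base using (_∘_; id)
open import Function.Bundles using (_⇔_; mk⇔; module Equivalence)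
open import Function.Definitions using (Injective; Bijective)
open import Relation.Binary.PropositionalEquality using (_≡_; _≢_; refl; sym; trans; cong; cong₂; subst; subst₂; module ≡-Reasoning)
open import Relation.Nullary using (¬_; Dec; yes; no; does; contradiction)
open import Relation.Nullary.Decidable using (⌊_⌋; _×-dec_; ¬?; map′; dec-true; dec-false; _→-dec_; isYes≗does)
import Data.Integer.Divisibility.Signed as SD
import Data.Integer.DivMod as ID
import Data.List.Relation.Unary.AllPairs as AllPairs
import Data.List.Relation.Unary.AllPairs.Properties as AllPairsP


-- Permutations of lists, sums and products over lists, Iverson brackets

-- The identity is multiplied by φ(n) and proved coefficientwise over the integers, so nothing is
-- ever divided by φ(n). No primitive root is chosen. The index of u modulo p_i is (p_i - 1) divided
-- by the order of u, and the residues of each index are counted by squeezing: a root bound for x^e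
-- - 1 gives at most φ((p_i - 1)/d) of them, while the counts and these bounds both add up to p_i -
-- 1. The prime 2 is carried as one more prime factor. Modulo 2 both u and -1 are 1, so parity does
-- not affect the size of an orbit, and each nonempty set T of odd primes contributes f_T twice,
-- once for each parity. The empty T with odd parity belongs to the single residue n/2, whence 1 +
-- x; with even parity it belongs to 0, which no connection set contains. Imposing divisibility by 2
-- therefore leaves F_R in place of (1 + x) F_R², with the opposite sign in the inversion; this is
-- the difference inside the bracket.

subset⇒↭ : ∀ {A : Set} {xs ys : List A} → Unique xs → (∀ {x} → x ∈ xs → x ∈ ys) →
  ∃ λ zs → ys ↭ xs ++ zs
subset⇒↭ {xs = []} {ys} _ _ = ys , ↭-refl
subset⇒↭ {xs = x ∷ xs} {ys} (x∉ ∷ u) s with ∈-∃++ (s (here refl))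
... | as , bs , refl with subset⇒↭ {xs = xs} {ys = as ++ bs} u s′
  where
  s′ : ∀ {y} → y ∈ xs → y ∈ as ++ bs
  s′ y∈ with P.∈-resp-↭ (P.shift x as bs) (s (there y∈))
  ... | here refl = contradiction refl (All.lookup x∉ y∈)
  ... | there q = q
... | zs , p = zs , ↭-trans (P.shift x as bs) (prep x p)

unique-length-≤ : ∀ {A : Set} {xs ys : List A} → Unique xs → (∀ {x} → x ∈ xs → x ∈ ys) →
  length xs ≤ length ys
unique-length-≤ {xs = xs} u s with subset⇒↭ u s
... | zs , p = subst (length xs ≤_) (trans (sym (LP.length-++ xs)) (sym (P.↭-length p))) (ℕ.m≤m+n _ _)

-- The pigeonhole principle. It lets an injective map between lists of equal length count as a
-- permutation with no inverse map constructed.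
length-≤⇒↭ : ∀ {A : Set} {xs ys : List A} → Unique xs → (∀ {x} → x ∈ xs → x ∈ ys) →
  length ys ≤ length xs → xs ↭ ys
length-≤⇒↭ {xs = xs} {ys} u s l with subset⇒↭ u s
... | [] , p = ↭-sym (↭-trans p (↭-reflexive (LP.++-identityʳ xs)))
... | z ∷ zs , p = contradiction l (ℕ.<⇒≱ (subst (length xs <_)
  (trans (sym (LP.length-++ xs)) (sym (P.↭-length p))) (ℕ.m<m+n (length xs) (s≤s z≤n))))

unique⇒↭ : ∀ {A : Set} {xs ys : List A} → Unique xs → Unique ys →
  (∀ {x} → x ∈ xs → x ∈ ys) → (∀ {x} → x ∈ ys → x ∈ xs) → xs ↭ ys
unique⇒↭ u v s t = length-≤⇒↭ u s (unique-length-≤ v t)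

unique-map : ∀ {A B : Set} (f : A → B) {xs : List A} →
  (∀ {x y} → x ∈ xs → y ∈ xs → f x ≡ f y → x ≡ y) → Unique xs → Unique (map f xs)
unique-map f inj [] = []
unique-map f inj (a ∷ u) =
  AllP.map⁺ (All.tabulate λ y∈ e → All.lookup a y∈ (inj (here refl) (there y∈) e))
  ∷ unique-map f (λ x∈ y∈ → inj (there x∈) (there y∈)) u

-- Generic over setoids because three monoids use it: the integers under addition and under
-- multiplication, and the polynomials, whose equality is coefficientwise.
module BigOp {c ℓ} (M : CommutativeMonoid c ℓ) where
  open CommutativeMonoid M renaming (refl to ≈-refl; sym to ≈-sym; trans to ≈-trans; reflexive to ≈-reflexive)
  open import Relation.Binary.Reasoning.Setoid setoid

  big : ∀ {A : Set} → List A → (A → Carrier) → Carrier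
  big [] f = ε
  big (x ∷ xs) f = f x ∙ big xs f

  big-cong : ∀ {A : Set} (xs : List A) {f g : A → Carrier} →
    (∀ {x} → x ∈ xs → f x ≈ g x) → big xs f ≈ big xs g
  big-cong [] e = ≈-refl
  big-cong (x ∷ xs) e = ∙-cong (e (here refl)) (big-cong xs (e ∘ there))

  big-ε : ∀ {A : Set} (xs : List A) {f : A → Carrier} → (∀ {x} → x ∈ xs → f x ≈ ε) → big xs f ≈ ε
  big-ε [] e = ≈-refl
  big-ε (x ∷ xs) e = ≈-trans (∙-cong (e (here refl)) (big-ε xs (e ∘ there))) (identityˡ ε)

  big-++ : ∀ {A : Set} (xs ys : List A) (f : A → Carrier) → big (xs ++ ys) f ≈ big xs f ∙ big ys f
  big-++ [] ys f = ≈-sym (identityˡ _)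
  big-++ (x ∷ xs) ys f = ≈-trans (∙-congˡ (big-++ xs ys f)) (≈-sym (assoc _ _ _))

  big-map : ∀ {A B : Set} (h : A → B) (xs : List A) (f : B → Carrier) → big (map h xs) f ≈ big xs (f ∘ h)
  big-map h [] f = ≈-refl
  big-map h (x ∷ xs) f = ∙-congˡ (big-map h xs f)

  big-concatMap : ∀ {A B : Set} (h : A → List B) (xs : List A) (f : B → Carrier) →
    big (concatMap h xs) f ≈ big xs (λ x → big (h x) f)
  big-concatMap h [] f = ≈-refl
  big-concatMap h (x ∷ xs) f = ≈-trans (big-++ (h x) (concatMap h xs) f) (∙-congˡ (big-concatMap h xs f))

  interchange : ∀ a b d e → (a ∙ b) ∙ (d ∙ e) ≈ (a ∙ d) ∙ (b ∙ e)
  interchange a b d e = begin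
    (a ∙ b) ∙ (d ∙ e) ≈⟨ assoc a b (d ∙ e) ⟩
    a ∙ (b ∙ (d ∙ e)) ≈⟨ ∙-congˡ (≈-trans (≈-sym (assoc b d e)) (≈-trans (∙-congʳ (comm b d)) (assoc d b e))) ⟩
    a ∙ (d ∙ (b ∙ e)) ≈⟨ ≈-sym (assoc a d (b ∙ e)) ⟩
    (a ∙ d) ∙ (b ∙ e) ∎

  big-∙ : ∀ {A : Set} (xs : List A) (f g : A → Carrier) → big xs (λ x → f x ∙ g x) ≈ big xs f ∙ big xs g
  big-∙ [] f g = ≈-sym (identityˡ ε)
  big-∙ (x ∷ xs) f g = ≈-trans (∙-congˡ (big-∙ xs f g)) (interchange _ _ _ _)

  big-swap : ∀ {A B : Set} (xs : List A) (ys : List B) (f : A → B → Carrier) →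
    big xs (λ x → big ys (f x)) ≈ big ys (λ y → big xs (λ x → f x y))
  big-swap [] ys f = ≈-sym (big-ε ys (λ _ → ≈-refl))
  big-swap (x ∷ xs) ys f = ≈-trans (∙-congˡ (big-swap xs ys f)) (≈-sym (big-∙ ys (f x) _))

  big-↭ : ∀ {A : Set} {xs ys : List A} (f : A → Carrier) → xs ↭ ys → big xs f ≈ big ys f
  big-↭ f Perm.refl = ≈-refl
  big-↭ f (prep x p) = ∙-congˡ (big-↭ f p)
  big-↭ f (swap x y p) = ≈-trans (≈-sym (assoc _ _ _)) (≈-trans (∙-cong (comm _ _) (big-↭ f p)) (assoc _ _ _))
  big-↭ f (Perm.trans p q) = ≈-trans (big-↭ f p) (big-↭ f q)

  big-filter : ∀ {A : Set} {P : A → Set} (P? : ∀ x → Dec (P x)) (xs : List A) (f : A → Carrier) →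
    big (filter P? xs) f ≈ big xs (λ x → if does (P? x) then f x else ε)
  big-filter P? [] f = ≈-refl
  big-filter P? (x ∷ xs) f with does (P? x)
  ... | true = ∙-congˡ (big-filter P? xs f)
  ... | false = ≈-trans (big-filter P? xs f) (≈-sym (identityˡ _))

  big-single : ∀ {A : Set} {xs : List A} {f : A → Carrier} {t} → Unique xs → t ∈ xs →
    (∀ {x} → x ∈ xs → x ≢ t → f x ≈ ε) → big xs f ≈ f t
  big-single {xs = x ∷ xs} (a ∷ u) (here refl) e =
    ≈-trans (∙-congˡ (big-ε xs (λ y∈ → e (there y∈) (λ q → All.lookup a y∈ (sym q))))) (identityʳ _)
  big-single {xs = x ∷ xs} (a ∷ u) (there t∈) e =
    ≈-trans (∙-cong (e (here refl) (λ q → All.lookup a t∈ q)) (big-single u t∈ (e ∘ there))) (identityˡ _)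

  -- The term `f x` is spread over `ts`, where only the entry `c x` contributes; exchanging the two
  -- operations then groups the terms by fibre.
  big-fibres : ∀ {A B : Set} (_≟B_ : (x y : B) → Dec (x ≡ y)) (c : A → B) (xs : List A) (ts : List B)
    (f : A → Carrier) → Unique ts → (∀ {x} → x ∈ xs → c x ∈ ts) →
    big xs f ≈ big ts (λ t → big (filter (λ x → c x ≟B t) xs) f)
  big-fibres _≟B_ c xs ts f u h = begin
    big xs f ≈⟨ big-cong xs (λ {x} x∈ → ≈-sym (fib x x∈)) ⟩
    big xs (λ x → big ts (λ t → if does (c x ≟B t) then f x else ε)) ≈⟨ big-swap xs ts _ ⟩
    big ts (λ t → big xs (λ x → if does (c x ≟B t) then f x else ε))
      ≈⟨ big-cong ts (λ {t} _ → ≈-sym (big-filter (λ x → c x ≟B t) xs f)) ⟩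
    big ts (λ t → big (filter (λ x → c x ≟B t) xs) f) ∎
    where
    fib : ∀ x → x ∈ xs → big ts (λ t → if does (c x ≟B t) then f x else ε) ≈ f x
    fib x x∈ = ≈-trans (big-single u (h x∈) (λ {t} _ t≢ → off t (t≢ ∘ sym))) on
      where
      off : ∀ t → c x ≢ t → (if does (c x ≟B t) then f x else ε) ≈ ε
      off t n with c x ≟B t
      ... | yes p = contradiction p n
      ... | no _ = ≈-refl
      on : (if does (c x ≟B c x) then f x else ε) ≈ f x
      on with c x ≟B c x
      ... | yes p = ≈-refl
      ... | no q = contradiction refl q

open BigOp ℤ.+-0-commutativeMonoid using ()
  renaming (big to ∑; big-cong to ∑-cong; big-ε to ∑-0; big-++ to ∑-++; big-map to ∑-map;
    big-concatMap to ∑-concatMap; big-∙ to ∑-+; big-swap to ∑-swap; big-↭ to ∑-↭;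
    big-filter to ∑-filter; big-single to ∑-single; big-fibres to ∑-fibres)
open BigOp ℤ.*-1-commutativeMonoid using ()
  renaming (big to ∏; big-cong to ∏-cong; big-ε to ∏-1; big-map to ∏-map; big-∙ to ∏-*; big-↭ to ∏-↭;
    big-filter to ∏-filter)

⟪_⟫ : {P : Set} → Dec P → ℤ
⟪ P? ⟫ = if does P? then + 1 else + 0

⟪⟫-cong : {P Q : Set} (P? : Dec P) (Q? : Dec Q) → (P → Q) → (Q → P) → ⟪ P? ⟫ ≡ ⟪ Q? ⟫
⟪⟫-cong (yes p) (yes q) f g = refl
⟪⟫-cong (yes p) (no q) f g = contradiction (f p) q
⟪⟫-cong (no p) (yes q) f g = contradiction (g q) p
⟪⟫-cong (no p) (no q) f g = refl

⟪⟫-yes : {P : Set} (P? : Dec P) → P → ⟪ P? ⟫ ≡ + 1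
⟪⟫-yes (yes _) p = refl
⟪⟫-yes (no q) p = contradiction p q

⟪⟫-no : {P : Set} (P? : Dec P) → ¬ P → ⟪ P? ⟫ ≡ + 0
⟪⟫-no (yes p) q = contradiction p q
⟪⟫-no (no q) p = refl

⟪⟫-× : {P Q : Set} (P? : Dec P) (Q? : Dec Q) → ⟪ P? ×-dec Q? ⟫ ≡ ⟪ P? ⟫ *ℤ ⟪ Q? ⟫
⟪⟫-× (yes p) (yes q) = refl
⟪⟫-× (yes p) (no q) = refl
⟪⟫-× (no p) (yes q) = refl
⟪⟫-× (no p) (no q) = refl

-- For rewriting a factor by an equation that is available only where the bracket in front of it
-- does not vanish.
⟪⟫-*-cong : {P : Set} (P? : Dec P) {a b : ℤ} → (P → a ≡ b) → ⟪ P? ⟫ *ℤ a ≡ ⟪ P? ⟫ *ℤ b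
⟪⟫-*-cong (yes p) e = cong (+ 1 *ℤ_) (e p)
⟪⟫-*-cong (no p) e = refl

∑-length : ∀ {A : Set} (xs : List A) → ∑ xs (λ _ → + 1) ≡ + length xs
∑-length [] = refl
∑-length (x ∷ xs) = cong (+ 1 +ℤ_) (∑-length xs)

∑-⟪⟫-filter : ∀ {A : Set} {P : A → Set} (P? : ∀ x → Dec (P x)) (xs : List A) (f : A → ℤ) →
  ∑ (filter P? xs) f ≡ ∑ xs (λ x → ⟪ P? x ⟫ *ℤ f x)
∑-⟪⟫-filter P? xs f = trans (∑-filter P? xs f) (∑-cong xs (λ {x} _ → h x))
  where
  h : ∀ x → (if does (P? x) then f x else + 0) ≡ ⟪ P? x ⟫ *ℤ f x
  h x with does (P? x)
  ... | true = sym (ℤ.*-identityˡ _)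
  ... | false = refl

∑-⟪⟫ : ∀ {A : Set} {P : A → Set} (P? : ∀ x → Dec (P x)) (xs : List A) →
  ∑ xs (λ x → ⟪ P? x ⟫) ≡ + length (filter P? xs)
∑-⟪⟫ P? xs = begin
  ∑ xs (λ x → ⟪ P? x ⟫) ≡⟨ ∑-cong xs (λ _ → sym (ℤ.*-identityʳ _)) ⟩
  ∑ xs (λ x → ⟪ P? x ⟫ *ℤ + 1) ≡⟨ sym (∑-⟪⟫-filter P? xs _) ⟩
  ∑ (filter P? xs) (λ _ → + 1) ≡⟨ ∑-length (filter P? xs) ⟩
  + length (filter P? xs) ∎
  where open ≡-Reasoning

∑-*ˡ : ∀ {A : Set} (c : ℤ) (xs : List A) (f : A → ℤ) → ∑ xs (λ x → c *ℤ f x) ≡ c *ℤ ∑ xs f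
∑-*ˡ c [] f = sym (ℤ.*-zeroʳ c)
∑-*ˡ c (x ∷ xs) f = trans (cong (c *ℤ f x +ℤ_) (∑-*ˡ c xs f)) (sym (ℤ.*-distribˡ-+ c _ _))

∑-*ʳ : ∀ {A : Set} (xs : List A) (f : A → ℤ) (c : ℤ) → ∑ xs (λ x → f x *ℤ c) ≡ ∑ xs f *ℤ c
∑-*ʳ xs f c = trans (∑-cong xs (λ {x} _ → ℤ.*-comm (f x) c)) (trans (∑-*ˡ c xs f) (ℤ.*-comm c _))

∑-const : ∀ {A : Set} (xs : List A) (c : ℤ) → ∑ xs (λ _ → c) ≡ + length xs *ℤ c
∑-const xs c = trans (trans (∑-cong xs (λ _ → sym (ℤ.*-identityˡ c))) (∑-*ʳ xs _ c)) (cong (_*ℤ c) (∑-length xs))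

allFin-suc : ∀ n → allFin (suc n) ≡ Fin.zero ∷ map Fin.suc (allFin n)
allFin-suc n = cong (Fin.zero ∷_) (sym (LP.map-tabulate id Fin.suc))

∏-allFin : ∀ {n} (f : Fin (suc n) → ℤ) → ∏ (allFin (suc n)) f ≡ f Fin.zero *ℤ ∏ (allFin n) (f ∘ Fin.suc)
∏-allFin {n} f = trans (cong (λ xs → ∏ xs f) (allFin-suc n)) (cong (f Fin.zero *ℤ_) (∏-map Fin.suc (allFin n) f))

∏-foldr : ∀ {A : Set} (f : A → ℕ) (xs : List A) → + foldr _*_ 1 (map f xs) ≡ ∏ xs (λ x → + f x)
∏-foldr f [] = refl
∏-foldr f (x ∷ xs) = trans (ℤ.pos-* (f x) _) (cong (+ f x *ℤ_) (∏-foldr f xs))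

allSubsets-complete : ∀ {l} (s : Subset l) → s ∈ allSubsets l
allSubsets-complete [] = here refl
allSubsets-complete {suc l} (b ∷ s) = ∈-concatMap⁺ _ {xs = allSubsets l} (Any.map (λ { refl → go b }) (allSubsets-complete s))
  where
  go : ∀ b → (b ∷ s) ∈ ((outside ∷ s) ∷ (inside ∷ s) ∷ [])
  go false = here refl
  go true = there (here refl)

allSubsets-unique : ∀ l → Unique (allSubsets l)
allSubsets-unique zero = [] ∷ []
allSubsets-unique (suc l) = go (allSubsets-unique l)
  where
  ext : Subset l → List (Subset (suc l))
  ext s = (outside ∷ s) ∷ (inside ∷ s) ∷ []
  tail∈ : ∀ {xs : List (Subset l)} {s : Subset (suc l)} → s ∈ concatMap ext xs → Vec.tail s ∈ xs
  tail∈ {xs} s∈ = Any.map (λ { (here refl) → refl ; (there (here refl)) → refl }) (∈-concatMap⁻ ext {xs = xs} s∈)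
  go : ∀ {xs : List (Subset l)} → Unique xs → Unique (concatMap ext xs)
  go [] = []
  go (a ∷ u) = ((λ ()) ∷ All.tabulate (λ t∈ e → All.lookup a (tail∈ t∈) (cong Vec.tail e)))
             ∷ All.tabulate (λ t∈ e → All.lookup a (tail∈ t∈) (cong Vec.tail e)) ∷ go u

-- Polynomials

-- Coefficient lists may carry trailing zeros, so polynomials are compared coefficientwise.
infix 4 _≈ₚ_
record _≈ₚ_ (p q : Poly) : Set where
  constructor mk
  field at : ∀ k → coeff k p ≡ coeff k q
open _≈ₚ_

≈ₚ-refl : ∀ {p} → p ≈ₚ p
≈ₚ-refl = mk λ k → refl

≈ₚ-sym : ∀ {p q} → p ≈ₚ q → q ≈ₚ p
≈ₚ-sym e = mk λ k → sym (at e k)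

≈ₚ-trans : ∀ {p q r} → p ≈ₚ q → q ≈ₚ r → p ≈ₚ r
≈ₚ-trans e f = mk λ k → trans (at e k) (at f k)

≈ₚ-reflexive : ∀ {p q} → p ≡ q → p ≈ₚ q
≈ₚ-reflexive refl = ≈ₚ-refl

coeff-padd : ∀ k p q → coeff k (padd p q) ≡ coeff k p +ℤ coeff k q
coeff-padd k [] q = sym (ℤ.+-identityˡ _)
coeff-padd k (a ∷ p) [] = sym (ℤ.+-identityʳ _)
coeff-padd zero (a ∷ p) (b ∷ q) = refl
coeff-padd (suc k) (a ∷ p) (b ∷ q) = coeff-padd k p q

coeff-pscale : ∀ k c p → coeff k (pscale c p) ≡ c *ℤ coeff k p
coeff-pscale k c [] = sym (ℤ.*-zeroʳ c)
coeff-pscale zero c (a ∷ p) = refl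
coeff-pscale (suc k) c (a ∷ p) = coeff-pscale k c p

coeff-psum : ∀ {A : Set} k (f : A → Poly) (xs : List A) → coeff k (psum (map f xs)) ≡ ∑ xs (λ x → coeff k (f x))
coeff-psum k f [] = refl
coeff-psum k f (x ∷ xs) = trans (coeff-padd k (f x) _) (cong (coeff k (f x) +ℤ_) (coeff-psum k f xs))

coeff-psub : ∀ k p q → coeff k (psub p q) ≡ coeff k p -ℤ coeff k q
coeff-psub k p q = trans (coeff-padd k p (pneg q))
  (cong (coeff k p +ℤ_) (trans (coeff-pscale k (- (+ 1)) q) (ℤ.-1*i≡-i (coeff k q))))

padd-cong : ∀ {p p′ q q′} → p ≈ₚ p′ → q ≈ₚ q′ → padd p q ≈ₚ padd p′ q′
padd-cong {p} {p′} {q} {q′} e f = mk λ k →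
  trans (coeff-padd k p q) (trans (cong₂ _+ℤ_ (at e k) (at f k)) (sym (coeff-padd k p′ q′)))

pscale-cong : ∀ c {q q′} → q ≈ₚ q′ → pscale c q ≈ₚ pscale c q′
pscale-cong c {q} {q′} f = mk λ k →
  trans (coeff-pscale k c q) (trans (cong (c *ℤ_) (at f k)) (sym (coeff-pscale k c q′)))

shift-cong : ∀ {a b p q} → a ≡ b → p ≈ₚ q → (a ∷ p) ≈ₚ (b ∷ q)
shift-cong e f = mk λ { zero → e ; (suc k) → at f k }

pmul-congʳ : ∀ p {q q′} → q ≈ₚ q′ → pmul p q ≈ₚ pmul p q′
pmul-congʳ [] e = ≈ₚ-refl
pmul-congʳ (a ∷ p) e = padd-cong (pscale-cong a e) (shift-cong refl (pmul-congʳ p e))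

pmul-[] : ∀ p → pmul p [] ≈ₚ []
pmul-[] [] = ≈ₚ-refl
pmul-[] (a ∷ p) = mk λ { zero → refl ; (suc k) → at (pmul-[] p) k }

-- `pmul` recurses on its left factor; this is the matching recursion on the right factor, and it
-- makes commutativity an induction.
pmul-∷ : ∀ p b q → pmul p (b ∷ q) ≈ₚ padd (pscale b p) (+ 0 ∷ pmul p q)
pmul-∷ [] b q = mk λ { zero → refl ; (suc k) → refl }
pmul-∷ (a ∷ p) b q = mk go
  where
  open ≡-Reasoning
  swap-left : ∀ x y z → x +ℤ (y +ℤ z) ≡ y +ℤ (x +ℤ z)
  swap-left = solve-∀
  go : ∀ k → coeff k (pmul (a ∷ p) (b ∷ q)) ≡ coeff k (padd (pscale b (a ∷ p)) (+ 0 ∷ pmul (a ∷ p) q))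
  go zero = cong (_+ℤ + 0) (ℤ.*-comm a b)
  go (suc k) = begin
    coeff k (padd (pscale a q) (pmul p (b ∷ q))) ≡⟨ coeff-padd k (pscale a q) (pmul p (b ∷ q)) ⟩
    coeff k (pscale a q) +ℤ coeff k (pmul p (b ∷ q))
      ≡⟨ cong (coeff k (pscale a q) +ℤ_) (trans (at (pmul-∷ p b q) k) (coeff-padd k (pscale b p) (+ 0 ∷ pmul p q))) ⟩
    coeff k (pscale a q) +ℤ (coeff k (pscale b p) +ℤ coeff k (+ 0 ∷ pmul p q)) ≡⟨ swap-left (coeff k (pscale a q)) (coeff k (pscale b p)) (coeff k (+ 0 ∷ pmul p q)) ⟩
    coeff k (pscale b p) +ℤ (coeff k (pscale a q) +ℤ coeff k (+ 0 ∷ pmul p q))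
      ≡⟨ cong (coeff k (pscale b p) +ℤ_) (sym (coeff-padd k (pscale a q) (+ 0 ∷ pmul p q))) ⟩
    coeff k (pscale b p) +ℤ coeff k (padd (pscale a q) (+ 0 ∷ pmul p q)) ≡⟨ sym (coeff-padd k (pscale b p) _) ⟩
    coeff k (padd (pscale b p) (padd (pscale a q) (+ 0 ∷ pmul p q))) ∎

pmul-comm : ∀ p q → pmul p q ≈ₚ pmul q p
pmul-comm [] q = ≈ₚ-sym (pmul-[] q)
pmul-comm (a ∷ p) q = ≈ₚ-trans (padd-cong (≈ₚ-refl {pscale a q}) (shift-cong refl (pmul-comm p q))) (≈ₚ-sym (pmul-∷ q a p))

-- Equal polynomials may be lists of different lengths, which stands in the way of a simultaneous
-- induction on the left factors; commutativity moves them to the right.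
pmul-cong : ∀ {p p′ q q′} → p ≈ₚ p′ → q ≈ₚ q′ → pmul p q ≈ₚ pmul p′ q′
pmul-cong {p} {p′} {q} {q′} e f =
  ≈ₚ-trans (pmul-congʳ p f) (≈ₚ-trans (pmul-comm p q′) (≈ₚ-trans (pmul-congʳ q′ e) (pmul-comm q′ p′)))

pmul-distribʳ : ∀ r p q → pmul (padd p q) r ≈ₚ padd (pmul p r) (pmul q r)
pmul-distribʳ r [] q = ≈ₚ-refl
pmul-distribʳ r (a ∷ p) [] = mk λ k →
  sym (trans (coeff-padd k (pmul (a ∷ p) r) []) (ℤ.+-identityʳ _))
pmul-distribʳ r (a ∷ p) (b ∷ q) = mk λ k → begin
  coeff k (padd (pscale (a +ℤ b) r) (+ 0 ∷ pmul (padd p q) r))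
    ≡⟨ coeff-padd k (pscale (a +ℤ b) r) _ ⟩
  coeff k (pscale (a +ℤ b) r) +ℤ coeff k (+ 0 ∷ pmul (padd p q) r)
    ≡⟨ cong₂ _+ℤ_ (trans (coeff-pscale k (a +ℤ b) r) (ℤ.*-distribʳ-+ (coeff k r) a b)) (low k) ⟩
  (a *ℤ coeff k r +ℤ b *ℤ coeff k r) +ℤ (coeff k (+ 0 ∷ pmul p r) +ℤ coeff k (+ 0 ∷ pmul q r))
    ≡⟨ inter (a *ℤ coeff k r) (b *ℤ coeff k r) (coeff k (+ 0 ∷ pmul p r)) (coeff k (+ 0 ∷ pmul q r)) ⟩
  (a *ℤ coeff k r +ℤ coeff k (+ 0 ∷ pmul p r)) +ℤ (b *ℤ coeff k r +ℤ coeff k (+ 0 ∷ pmul q r))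
    ≡⟨ sym (cong₂ _+ℤ_ (trans (coeff-padd k (pscale a r) _) (cong (_+ℤ _) (coeff-pscale k a r)))
                       (trans (coeff-padd k (pscale b r) _) (cong (_+ℤ _) (coeff-pscale k b r)))) ⟩
  coeff k (pmul (a ∷ p) r) +ℤ coeff k (pmul (b ∷ q) r) ≡⟨ sym (coeff-padd k (pmul (a ∷ p) r) _) ⟩
  coeff k (padd (pmul (a ∷ p) r) (pmul (b ∷ q) r)) ∎
  where
  open ≡-Reasoning
  inter : ∀ x y z w → (x +ℤ y) +ℤ (z +ℤ w) ≡ (x +ℤ z) +ℤ (y +ℤ w)
  inter = solve-∀
  low : ∀ k → coeff k (+ 0 ∷ pmul (padd p q) r) ≡ coeff k (+ 0 ∷ pmul p r) +ℤ coeff k (+ 0 ∷ pmul q r)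
  low zero = refl
  low (suc k) = trans (at (pmul-distribʳ r p q) k) (coeff-padd k (pmul p r) (pmul q r))

pmul-pscale : ∀ c p q → pmul (pscale c p) q ≈ₚ pscale c (pmul p q)
pmul-pscale c [] q = ≈ₚ-refl
pmul-pscale c (a ∷ p) q = mk λ k → begin
  coeff k (padd (pscale (c *ℤ a) q) (+ 0 ∷ pmul (pscale c p) q)) ≡⟨ coeff-padd k (pscale (c *ℤ a) q) _ ⟩
  coeff k (pscale (c *ℤ a) q) +ℤ coeff k (+ 0 ∷ pmul (pscale c p) q)
    ≡⟨ cong₂ _+ℤ_ (trans (coeff-pscale k (c *ℤ a) q)
         (trans (ℤ.*-assoc c a _) (cong (c *ℤ_) (sym (coeff-pscale k a q))))) (low k) ⟩
  c *ℤ coeff k (pscale a q) +ℤ c *ℤ coeff k (+ 0 ∷ pmul p q) ≡⟨ sym (ℤ.*-distribˡ-+ c _ _) ⟩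
  c *ℤ (coeff k (pscale a q) +ℤ coeff k (+ 0 ∷ pmul p q)) ≡⟨ cong (c *ℤ_) (sym (coeff-padd k (pscale a q) _)) ⟩
  c *ℤ coeff k (pmul (a ∷ p) q) ≡⟨ sym (coeff-pscale k c (pmul (a ∷ p) q)) ⟩
  coeff k (pscale c (pmul (a ∷ p) q)) ∎
  where
  open ≡-Reasoning
  low : ∀ k → coeff k (+ 0 ∷ pmul (pscale c p) q) ≡ c *ℤ coeff k (+ 0 ∷ pmul p q)
  low zero = sym (ℤ.*-zeroʳ c)
  low (suc k) = trans (at (pmul-pscale c p q) k) (coeff-pscale k c (pmul p q))

pmul-shift : ∀ p q → pmul (+ 0 ∷ p) q ≈ₚ (+ 0 ∷ pmul p q)
pmul-shift p q = mk λ k → trans (coeff-padd k (pscale (+ 0) q) (+ 0 ∷ pmul p q))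
  (trans (cong (_+ℤ coeff k (+ 0 ∷ pmul p q)) (coeff-pscale k (+ 0) q)) (ℤ.+-identityˡ _))

pmul-assoc : ∀ p q r → pmul (pmul p q) r ≈ₚ pmul p (pmul q r)
pmul-assoc [] q r = ≈ₚ-refl
pmul-assoc (a ∷ p) q r = ≈ₚ-trans (pmul-distribʳ r (pscale a q) (+ 0 ∷ pmul p q))
  (padd-cong (pmul-pscale a q r) (≈ₚ-trans (pmul-shift (pmul p q) r) (shift-cong refl (pmul-assoc p q r))))

pmul-identityˡ : ∀ p → pmul pone p ≈ₚ p
pmul-identityˡ p = mk λ where
  zero → trans (coeff-padd zero (pscale (+ 1) p) _) (trans (ℤ.+-identityʳ _) (trans (coeff-pscale zero (+ 1) p) (ℤ.*-identityˡ _)))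
  (suc k) → trans (coeff-padd (suc k) (pscale (+ 1) p) _) (trans (ℤ.+-identityʳ _) (trans (coeff-pscale (suc k) (+ 1) p) (ℤ.*-identityˡ _)))

pmul-identityʳ : ∀ p → pmul p pone ≈ₚ p
pmul-identityʳ p = ≈ₚ-trans (pmul-comm p pone) (pmul-identityˡ p)

pmul-commutativeMonoid : CommutativeMonoid _ _
pmul-commutativeMonoid = record
  { Carrier = Poly ; _≈_ = _≈ₚ_ ; _∙_ = pmul ; ε = pone
  ; isCommutativeMonoid = record
    { isMonoid = record
      { isSemigroup = record
        { isMagma = record
          { isEquivalence = record { refl = ≈ₚ-refl ; sym = ≈ₚ-sym ; trans = ≈ₚ-trans }
          ; ∙-cong = pmul-cong }
        ; assoc = pmul-assoc }
      ; identity = pmul-identityˡ , pmul-identityʳ }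
    ; comm = pmul-comm } }

open BigOp pmul-commutativeMonoid using ()
  renaming (big to ∏ₚ; big-cong to ∏ₚ-cong; big-++ to ∏ₚ-++; big-map to ∏ₚ-map;
    big-fibres to ∏ₚ-fibres; big-↭ to ∏ₚ-↭)

pprod-∏ₚ : ∀ {A : Set} (f : A → Poly) (xs : List A) → pprod (map f xs) ≡ ∏ₚ xs f
pprod-∏ₚ f [] = refl
pprod-∏ₚ f (x ∷ xs) = cong (pmul (f x)) (pprod-∏ₚ f xs)

ppow-length : ∀ {A : Set} (p : Poly) (xs : List A) → ∏ₚ xs (λ _ → p) ≡ ppow p (length xs)
ppow-length p [] = refl
ppow-length p (x ∷ xs) = cong (pmul p) (ppow-length p xs)

coeff-xpow : ∀ k j → coeff k (xpow j) ≡ ⟪ j ℕ.≟ k ⟫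
coeff-xpow zero zero = refl
coeff-xpow (suc k) zero = refl
coeff-xpow zero (suc j) = refl
coeff-xpow (suc k) (suc j) = trans (coeff-xpow k j) (⟪⟫-cong (j ℕ.≟ k) (suc j ℕ.≟ suc k) (cong suc) ℕ.suc-injective)

pmul-xpow : ∀ a b → pmul (xpow a) (xpow b) ≈ₚ xpow (a + b)
pmul-xpow zero b = pmul-identityˡ (xpow b)
pmul-xpow (suc a) b = ≈ₚ-trans (pmul-shift (xpow a) (xpow b)) (shift-cong refl (pmul-xpow a b))

-- Congruences and units

infix 4 _≅_[_]
-- The quotient is stored, so that closure under the ring operations becomes a ring identity.
-- Integers are compared instead of naturals because -1 acts throughout.
record _≅_[_] (x y : ℤ) (m : ℕ) : Set where
  constructor by
  field
    quot : ℤ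
    diff : x -ℤ y ≡ quot *ℤ + m

module _ {m : ℕ} where

  ≅-reflexive : ∀ {x y} → x ≡ y → x ≅ y [ m ]
  ≅-reflexive {x} refl = by (+ 0) (ℤ.+-inverseʳ x)

  ≅-refl : ∀ {x} → x ≅ x [ m ]
  ≅-refl = ≅-reflexive refl

  ≅-sym : ∀ {x y} → x ≅ y [ m ] → y ≅ x [ m ]
  ≅-sym {x} {y} (by k e) = by (- k) (trans (flip x y) (trans (cong -_ e) (ℤ.neg-distribˡ-* k (+ m))))
    where
    flip : ∀ x y → y -ℤ x ≡ - (x -ℤ y)
    flip = solve-∀

  ≅-trans : ∀ {x y z} → x ≅ y [ m ] → y ≅ z [ m ] → x ≅ z [ m ]
  ≅-trans {x} {y} {z} (by k e) (by j f) =
    by (k +ℤ j) (trans (tele x y z) (trans (cong₂ _+ℤ_ e f) (sym (ℤ.*-distribʳ-+ (+ m) k j))))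
    where
    tele : ∀ x y z → x -ℤ z ≡ (x -ℤ y) +ℤ (y -ℤ z)
    tele = solve-∀

  ≅-+ : ∀ {x y z w} → x ≅ y [ m ] → z ≅ w [ m ] → x +ℤ z ≅ y +ℤ w [ m ]
  ≅-+ {x} {y} {z} {w} (by k e) (by j f) =
    by (k +ℤ j) (trans (inter x y z w) (trans (cong₂ _+ℤ_ e f) (sym (ℤ.*-distribʳ-+ (+ m) k j))))
    where
    inter : ∀ x y z w → (x +ℤ z) -ℤ (y +ℤ w) ≡ (x -ℤ y) +ℤ (z -ℤ w)
    inter = solve-∀

  ≅-* : ∀ {x y z w} → x ≅ y [ m ] → z ≅ w [ m ] → x *ℤ z ≅ y *ℤ w [ m ]
  ≅-* {x} {y} {z} {w} (by k e) (by j f) =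
    by (x *ℤ j +ℤ w *ℤ k) (trans (expand x y z w) (trans (cong₂ (λ a b → x *ℤ a +ℤ w *ℤ b) f e) (collect x w k j (+ m))))
    where
    expand : ∀ x y z w → x *ℤ z -ℤ y *ℤ w ≡ x *ℤ (z -ℤ w) +ℤ w *ℤ (x -ℤ y)
    expand = solve-∀
    collect : ∀ x w k j m → x *ℤ (j *ℤ m) +ℤ w *ℤ (k *ℤ m) ≡ (x *ℤ j +ℤ w *ℤ k) *ℤ m
    collect = solve-∀

  ≅-*ˡ : ∀ x {z w} → z ≅ w [ m ] → x *ℤ z ≅ x *ℤ w [ m ]
  ≅-*ˡ x e = ≅-* (≅-refl {x}) e

  ≅-*ʳ : ∀ {x y} z → x ≅ y [ m ] → x *ℤ z ≅ y *ℤ z [ m ]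
  ≅-*ʳ z e = ≅-* e (≅-refl {z})

  ≅-neg : ∀ {x y} → x ≅ y [ m ] → - x ≅ - y [ m ]
  ≅-neg {x} {y} (by k e) = by (- k) (trans (dist x y) (trans (cong -_ e) (ℤ.neg-distribˡ-* k (+ m))))
    where
    dist : ∀ x y → - x -ℤ - y ≡ - (x -ℤ y)
    dist = solve-∀

  ≅-^ : ∀ {x y} k → x ≅ y [ m ] → x ^ℤ k ≅ y ^ℤ k [ m ]
  ≅-^ zero e = ≅-refl
  ≅-^ (suc k) e = ≅-* e (≅-^ k e)

  ≅-0 : ∀ {x} → x ≅ + 0 [ m ] → m ∣ ℤ.∣ x ∣
  ≅-0 {x} (by k e) = divides ℤ.∣ k ∣ (trans (cong ℤ.∣_∣ (trans (sym (ℤ.+-identityʳ x)) e)) (ℤ.abs-* k (+ m)))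

  0-≅ : ∀ {x} → m ∣ ℤ.∣ x ∣ → x ≅ + 0 [ m ]
  0-≅ {x} d with SD.∣ᵤ⇒∣ {+ m} {x} d
  ... | SD.divides k e = by k (trans (ℤ.+-identityʳ x) e)

  0-≅ℕ : ∀ {a} → m ∣ a → + a ≅ + 0 [ m ]
  0-≅ℕ = 0-≅

  ≅⇒-0 : ∀ {x y} → x ≅ y [ m ] → x -ℤ y ≅ + 0 [ m ]
  ≅⇒-0 (by k e) = by k (trans (ℤ.+-identityʳ _) e)

  -0⇒≅ : ∀ {x y} → x -ℤ y ≅ + 0 [ m ] → x ≅ y [ m ]
  -0⇒≅ (by k e) = by k (trans (sym (ℤ.+-identityʳ _)) e)

infix 4 _≅?_[_]
_≅?_[_] : ∀ x y m → Dec (x ≅ y [ m ])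
x ≅? y [ m ] = map′ (λ d → -0⇒≅ (0-≅ d)) (λ e → ≅-0 (≅⇒-0 e)) (m ∣? ℤ.∣ x -ℤ y ∣)

≅-weaken : ∀ {m n x y} → m ∣ n → x ≅ y [ n ] → x ≅ y [ m ]
≅-weaken d e = -0⇒≅ (0-≅ (Dv.∣-trans d (≅-0 (≅⇒-0 e))))

≅-prime : ∀ {p} x y → Prime p → x *ℤ y ≅ + 0 [ p ] → x ≅ + 0 [ p ] ⊎ y ≅ + 0 [ p ]
≅-prime {p} x y pr e with euclidsLemma ℤ.∣ x ∣ ℤ.∣ y ∣ pr (subst (p ∣_) (ℤ.abs-* x y) (≅-0 e))
... | inj₁ d = inj₁ (0-≅ d)
... | inj₂ d = inj₂ (0-≅ d)

coprime-∣ : ∀ {m n a} → Coprime m n → m ∣ a → n ∣ a → m * n ∣ a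
coprime-∣ {m} {n} c (divides k refl) n∣ with C.coprime-divisor {n} {m} {k} (C.sym c) (subst (n ∣_) (ℕ.*-comm k m) n∣)
... | d = subst (m * n ∣_) (ℕ.*-comm m k) (Dv.*-monoʳ-∣ m d)

≅-coprime : ∀ {m n x y} → Coprime m n → x ≅ y [ m ] → x ≅ y [ n ] → x ≅ y [ m * n ]
≅-coprime c e f = -0⇒≅ (0-≅ (coprime-∣ c (≅-0 (≅⇒-0 e)) (≅-0 (≅⇒-0 f))))

small-multiple : ∀ {m c} → c < m → m ∣ c → c ≡ 0
small-multiple {c = zero} _ _ = refl
small-multiple {c = suc c} c< d = contradiction (Dv.∣⇒≤ d) (ℕ.<⇒≱ c<)

≅-∸ : ∀ {m a b} → b ≤ a → + a ≅ + b [ m ] → m ∣ a ∸ b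
≅-∸ {m} {a} {b} b≤a e = subst (m ∣_) (cong ℤ.∣_∣ (trans (ℤ.m-n≡m⊖n a b) (ℤ.⊖-≥ b≤a))) (≅-0 (≅⇒-0 e))

≅-small : ∀ {m a b} → a < m → b < m → + a ≅ + b [ m ] → a ≡ b
≅-small {m} {a} {b} a< b< e with ℕ.≤-total a b
... | inj₁ a≤b = ℕ.≤-antisym a≤b (ℕ.m∸n≡0⇒m≤n (small-multiple (ℕ.<-≤-trans (s≤s (ℕ.m∸n≤m b a)) b<) (≅-∸ a≤b (≅-sym e))))
... | inj₂ b≤a = ℕ.≤-antisym (ℕ.m∸n≡0⇒m≤n (small-multiple (ℕ.<-≤-trans (s≤s (ℕ.m∸n≤m a b)) a<) (≅-∸ b≤a e))) b≤a

≅-% : ∀ a m .{{_ : NonZero m}} → + (a % m) ≅ + a [ m ]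
≅-% a m = ≅-sym (by (+ (a / m)) (begin
  + a -ℤ + (a % m) ≡⟨ cong (λ z → + z -ℤ + (a % m)) (DM.m≡m%n+[m/n]*n a m) ⟩
  + (a % m + a / m * m) -ℤ + (a % m) ≡⟨ cong (_-ℤ + (a % m)) (trans (ℤ.pos-+ (a % m) _) (cong (+ (a % m) +ℤ_) (ℤ.pos-* (a / m) m))) ⟩
  (+ (a % m) +ℤ + (a / m) *ℤ + m) -ℤ + (a % m) ≡⟨ cancel (+ (a % m)) (+ (a / m) *ℤ + m) ⟩
  + (a / m) *ℤ + m ∎))
  where
  open ≡-Reasoning
  cancel : ∀ x y → (x +ℤ y) -ℤ x ≡ y
  cancel = solve-∀

record Invertible (u : ℤ) (n : ℕ) : Set where
  constructor _,_
  field
    inverse : ℤ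
    isInverse : u *ℤ inverse ≅ + 1 [ n ]

coprime⇒invertible : ∀ u n → gcd u n ≡ 1 → Invertible (+ u) n
coprime⇒invertible u n g with C.coprime-Bézout (C.gcd≡1⇒coprime {u} {n} g)
... | G.Bézout.+- x y eq = + x , by (+ y) (begin
  + u *ℤ + x -ℤ + 1 ≡⟨ cong (_-ℤ + 1) (trans (ℤ.*-comm (+ u) (+ x)) (trans (sym (ℤ.pos-* x u)) (cong +_ (sym eq)))) ⟩
  + (1 + y * n) -ℤ + 1 ≡⟨ cong (_-ℤ + 1) (trans (ℤ.pos-+ 1 (y * n)) (cong (+ 1 +ℤ_) (ℤ.pos-* y n))) ⟩
  (+ 1 +ℤ + y *ℤ + n) -ℤ + 1 ≡⟨ cancel (+ y *ℤ + n) ⟩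
  + y *ℤ + n ∎)
  where
  open ≡-Reasoning
  cancel : ∀ y → (+ 1 +ℤ y) -ℤ + 1 ≡ y
  cancel = solve-∀
... | G.Bézout.-+ x y eq = - + x , by (- + y) (begin
  + u *ℤ - + x -ℤ + 1 ≡⟨ swp (+ u) (+ x) ⟩
  - (+ 1 +ℤ + x *ℤ + u) ≡⟨ cong (λ z → - (+ 1 +ℤ z)) (sym (ℤ.pos-* x u)) ⟩
  - (+ (1 + x * u)) ≡⟨ cong (λ z → - + z) eq ⟩
  - (+ (y * n)) ≡⟨ cong -_ (ℤ.pos-* y n) ⟩
  - (+ y *ℤ + n) ≡⟨ ℤ.neg-distribˡ-* (+ y) (+ n) ⟩
  - + y *ℤ + n ∎)
  where
  open ≡-Reasoning
  swp : ∀ u x → u *ℤ - x -ℤ + 1 ≡ - (+ 1 +ℤ x *ℤ u)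
  swp = solve-∀

invertible⇒coprime : ∀ u n → Invertible (+ u) n → gcd u n ≡ 1
invertible⇒coprime u n (v , e) = Dv.∣1⇒≡1 (≅-0 {gcd u n} {+ 1}
  (≅-trans (≅-sym (≅-weaken (G.gcd[m,n]∣n u n) e)) (≅-*ʳ v (0-≅ {x = + u} (G.gcd[m,n]∣m u n)))))

invertible-* : ∀ {u v n} → Invertible u n → Invertible v n → Invertible (u *ℤ v) n
invertible-* {u} {v} (u′ , e) (v′ , f) = u′ *ℤ v′ , ≅-trans (≅-reflexive (inter u v u′ v′)) (≅-* e f)
  where
  inter : ∀ u v u′ v′ → (u *ℤ v) *ℤ (u′ *ℤ v′) ≡ (u *ℤ u′) *ℤ (v *ℤ v′)
  inter = solve-∀

invertible-≅ : ∀ {u v n} → u ≅ v [ n ] → Invertible u n → Invertible v n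
invertible-≅ e (u′ , f) = u′ , ≅-trans (≅-*ʳ u′ (≅-sym e)) f

invertible-cancel : ∀ {u n x y} → Invertible u n → u *ℤ x ≅ u *ℤ y [ n ] → x ≅ y [ n ]
invertible-cancel {u} {n} {x} {y} (v , e) f = ≅-trans (≅-sym (undo x)) (≅-trans (≅-*ˡ v f) (undo y))
  where
  assoc : ∀ v u z → v *ℤ (u *ℤ z) ≡ (u *ℤ v) *ℤ z
  assoc = solve-∀
  undo : ∀ z → v *ℤ (u *ℤ z) ≅ z [ n ]
  undo z = ≅-trans (≅-reflexive (assoc v u z)) (≅-trans (≅-*ʳ z e) (≅-reflexive (ℤ.*-identityˡ z)))

abstract
  rem : (n : ℕ) .{{_ : NonZero n}} → ℤ → ℕ
  rem n z = z ID.%ℕ n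

  rem-< : ∀ n .{{_ : NonZero n}} z → rem n z < n
  rem-< n z = ID.n%ℕd<d z n

  rem-≅ : ∀ n .{{_ : NonZero n}} z → + rem n z ≅ z [ n ]
  rem-≅ n z = ≅-sym (by (z ID./ℕ n) (trans (cong (_-ℤ + rem n z) (ID.a≡a%ℕn+[a/ℕn]*n z n)) (cancel (+ rem n z) ((z ID./ℕ n) *ℤ + n))))
    where
    cancel : ∀ x y → (x +ℤ y) -ℤ x ≡ y
    cancel = solve-∀

  -- Representatives are taken from 0, ..., n - 1 to agree with remainders, whereas `φ` counts in 1,
  -- ..., n; `φ-units` reconciles the two.
  units : ℕ → List ℕ
  units n = filter (λ j → gcd j n ℕ.≟ 1) (upTo n)

  units-def : ∀ n → units n ≡ filter (λ j → gcd j n ℕ.≟ 1) (upTo n)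
  units-def n = refl

  units-unique : ∀ n → Unique (units n)
  units-unique n = U.filter⁺ (λ j → gcd j n ℕ.≟ 1) (U.upTo⁺ n)

  ∈-units⁺ : ∀ {n j} → j < n → Invertible (+ j) n → j ∈ units n
  ∈-units⁺ {n} {j} j< i = ∈-filter⁺ (λ j → gcd j n ℕ.≟ 1) (∈-upTo⁺ j<) (invertible⇒coprime j n i)

  ∈-units⁻ : ∀ {n j} → j ∈ units n → j < n × Invertible (+ j) n
  ∈-units⁻ {n} {j} j∈ with ∈-filter⁻ (λ j → gcd j n ℕ.≟ 1) {xs = upTo n} j∈
  ... | a , g = ∈-upTo⁻ a , coprime⇒invertible j n g

-- Multiplication by an invertible v is injective on the units and maps them to units, so by the
-- pigeonhole principle it permutes them.
units-translate : ∀ n .{{_ : NonZero n}} v → Invertible v n → map (λ j → rem n (v *ℤ + j)) (units n) ↭ units n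
units-translate n v i = length-≤⇒↭ (unique-map _ inj (units-unique n)) sub
  (ℕ.≤-reflexive (sym (LP.length-map _ (units n))))
  where
  inj : ∀ {x y} → x ∈ units n → y ∈ units n → rem n (v *ℤ + x) ≡ rem n (v *ℤ + y) → x ≡ y
  inj {x} {y} x∈ y∈ e = ≅-small (proj₁ (∈-units⁻ x∈)) (proj₁ (∈-units⁻ y∈)) (invertible-cancel i
    (≅-trans (≅-sym (rem-≅ n (v *ℤ + x))) (≅-trans (≅-reflexive (cong +_ e)) (rem-≅ n (v *ℤ + y)))))
  sub : ∀ {x} → x ∈ map (λ j → rem n (v *ℤ + j)) (units n) → x ∈ units n
  sub x∈ with ∈-map⁻ _ x∈
  ... | j , j∈ , refl = ∈-units⁺ (rem-< n (v *ℤ + j))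
    (invertible-≅ (≅-sym (rem-≅ n (v *ℤ + j))) (invertible-* i (proj₂ (∈-units⁻ j∈))))

-- The action of the integers on residue classes and on their subsets

⟦_⟧ : ∀ {n} → Fin n → ℤ
⟦ x ⟧ = + toℕ x

abstract
  res : ∀ {m} → ℤ → Fin (suc m)
  res {m} z = Fin.fromℕ< (rem-< (suc m) z)

  res-≅ : ∀ {m} z → ⟦ res {m} z ⟧ ≅ z [ suc m ]
  res-≅ {m} z = ≅-trans (≅-reflexive (cong +_ (F.toℕ-fromℕ< (rem-< (suc m) z)))) (rem-≅ (suc m) z)

⟦⟧-injective : ∀ {n} {x y : Fin n} → ⟦ x ⟧ ≅ ⟦ y ⟧ [ n ] → x ≡ y
⟦⟧-injective {n} {x} {y} e = F.toℕ-injective (≅-small (F.toℕ<n x) (F.toℕ<n y) e)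

res-cong : ∀ {m z w} → z ≅ w [ suc m ] → res {m} z ≡ res w
res-cong {m} {z} {w} e = ⟦⟧-injective (≅-trans (res-≅ z) (≅-trans e (≅-sym (res-≅ w))))

⟦mod⟧ : ∀ {m} a → ⟦ a mod suc m ⟧ ≅ + a [ suc m ]
⟦mod⟧ {m} a = ≅-trans (≅-reflexive (cong +_ (F.toℕ-fromℕ< (DM.m%n<n a (suc m))))) (≅-% a (suc m))

⟦⊕⟧ : ∀ {m} (a b : Fin (suc m)) → ⟦ a ⊕ b ⟧ ≅ ⟦ a ⟧ +ℤ ⟦ b ⟧ [ suc m ]
⟦⊕⟧ a b = ≅-trans (⟦mod⟧ (toℕ a + toℕ b)) (≅-reflexive (ℤ.pos-+ (toℕ a) (toℕ b)))

⟦⊝⟧ : ∀ {m} (a : Fin (suc m)) → ⟦ ⊝ a ⟧ ≅ - ⟦ a ⟧ [ suc m ]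
⟦⊝⟧ {m} a = ≅-trans (⟦mod⟧ (suc m ∸ toℕ a)) (by (+ 1) (begin
  + (suc m ∸ toℕ a) -ℤ - ⟦ a ⟧ ≡⟨ cong (+ (suc m ∸ toℕ a) +ℤ_) (ℤ.neg-involutive ⟦ a ⟧) ⟩
  + (suc m ∸ toℕ a + toℕ a) ≡⟨ cong +_ (ℕ.m∸n+n≡m (ℕ.<⇒≤ (F.toℕ<n a))) ⟩
  + suc m ≡⟨ sym (ℤ.*-identityˡ (+ suc m)) ⟩
  + 1 *ℤ + suc m ∎))
  where open ≡-Reasoning

⟦⊖⟧ : ∀ {m} (a b : Fin (suc m)) → ⟦ a ⊖ b ⟧ ≅ ⟦ a ⟧ -ℤ ⟦ b ⟧ [ suc m ]
⟦⊖⟧ a b = ≅-trans (⟦⊕⟧ a (⊝ b)) (≅-+ (≅-refl {x = ⟦ a ⟧}) (⟦⊝⟧ b))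

infixr 7 _•_
_•_ : ∀ {m} → ℤ → Fin (suc m) → Fin (suc m)
u • x = res (u *ℤ ⟦ x ⟧)

⟦•⟧ : ∀ {m} u (x : Fin (suc m)) → ⟦ u • x ⟧ ≅ u *ℤ ⟦ x ⟧ [ suc m ]
⟦•⟧ u x = res-≅ (u *ℤ ⟦ x ⟧)

•-cong : ∀ {m u v} (x : Fin (suc m)) → u ≅ v [ suc m ] → u • x ≡ v • x
•-cong x e = res-cong (≅-*ʳ ⟦ x ⟧ e)

•-• : ∀ {m} u v (x : Fin (suc m)) → u • v • x ≡ (u *ℤ v) • x
•-• u v x = res-cong (≅-trans (≅-*ˡ u (⟦•⟧ v x)) (≅-reflexive (sym (ℤ.*-assoc u v ⟦ x ⟧))))

1-• : ∀ {m} (x : Fin (suc m)) → + 1 • x ≡ x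
1-• x = ⟦⟧-injective (≅-trans (⟦•⟧ (+ 1) x) (≅-reflexive (ℤ.*-identityˡ ⟦ x ⟧)))

•-assoc-≅ : ∀ {m} u v (x y : Fin (suc m)) → u *ℤ v ≅ + 1 [ suc m ] → x ≡ v • y → y ≡ u • x
•-assoc-≅ u v x y e refl = sym (trans (•-• u v y) (trans (•-cong y e) (1-• y)))

neg-• : ∀ {m} (x : Fin (suc m)) → - (+ 1) • x ≡ ⊝ x
neg-• x = ⟦⟧-injective (≅-trans (⟦•⟧ (- (+ 1)) x) (≅-trans (≅-reflexive (ℤ.-1*i≡-i ⟦ x ⟧)) (≅-sym (⟦⊝⟧ x))))

abstract
  -- The preimage of Ω under multiplication by u. Membership in a preimage is a single lookup and
  -- requires no inverse of u, unlike membership in an image.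
  pull : ∀ {m} → ℤ → Subset (suc m) → Subset (suc m)
  pull u Ω = tabulate (λ x → lookup Ω (u • x))

  lookup-pull : ∀ {m} u (Ω : Subset (suc m)) x → lookup (pull u Ω) x ≡ lookup Ω (u • x)
  lookup-pull u Ω x = V.lookup∘tabulate (λ x → lookup Ω (u • x)) x

lookup-ext : ∀ {A : Set} {n} {xs ys : Vec A n} → (∀ i → lookup xs i ≡ lookup ys i) → xs ≡ ys
lookup-ext {xs = xs} {ys} e = trans (sym (V.tabulate∘lookup xs)) (trans (V.tabulate-cong e) (V.tabulate∘lookup ys))

pull-cong : ∀ {m u v} (Ω : Subset (suc m)) → u ≅ v [ suc m ] → pull u Ω ≡ pull v Ω
pull-cong {u = u} {v} Ω e = lookup-ext λ x →
  trans (lookup-pull u Ω x) (trans (cong (lookup Ω) (•-cong x e)) (sym (lookup-pull v Ω x)))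

pull-pull : ∀ {m} u v (Ω : Subset (suc m)) → pull u (pull v Ω) ≡ pull (v *ℤ u) Ω
pull-pull u v Ω = lookup-ext λ x → trans (lookup-pull u (pull v Ω) x)
  (trans (lookup-pull v Ω (u • x)) (trans (cong (lookup Ω) (•-• v u x)) (sym (lookup-pull (v *ℤ u) Ω x))))

pull-1 : ∀ {m} (Ω : Subset (suc m)) → pull (+ 1) Ω ≡ Ω
pull-1 Ω = lookup-ext λ x → trans (lookup-pull (+ 1) Ω x) (cong (lookup Ω) (1-• x))

pull-inverse : ∀ {m u v} {Ω Ω′ : Subset (suc m)} → u *ℤ v ≅ + 1 [ suc m ] → pull u Ω ≡ Ω′ → pull v Ω′ ≡ Ω
pull-inverse {u = u} {v} {Ω} e refl = trans (pull-pull v u Ω) (trans (pull-cong Ω e) (pull-1 Ω))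

∈ₛ⇒lookup : ∀ {n} {Ω : Subset n} {x} → x ∈ₛ Ω → lookup Ω x ≡ true
∈ₛ⇒lookup = V.[]=⇒lookup

lookup⇒∈ₛ : ∀ {n} {Ω : Subset n} {x} → lookup Ω x ≡ true → x ∈ₛ Ω
lookup⇒∈ₛ {Ω = Ω} {x} = V.lookup⇒[]= x Ω

count : ∀ {n} (xs : List (Fin n)) → Subset n → ℤ
count xs Ω = ∑ xs (λ x → ⟪ lookup Ω x B.≟ true ⟫)

∣∣-count : ∀ {n} (Ω : Subset n) → + ∣ Ω ∣ ≡ count (allFin n) Ω
∣∣-count [] = refl
∣∣-count {suc n} (b ∷ Ω) = sym (trans (cong (λ xs → ∑ xs (λ x → ⟪ lookup (b ∷ Ω) x B.≟ true ⟫)) (allFin-suc n))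
  (trans (cong (⟪ b B.≟ true ⟫ +ℤ_) (∑-map Fin.suc (allFin n) _)) (trans (cong (⟪ b B.≟ true ⟫ +ℤ_) (sym (∣∣-count Ω))) (lem b))))
  where
  lem : ∀ b → ⟪ b B.≟ true ⟫ +ℤ + ∣ Ω ∣ ≡ + ∣ b ∷ Ω ∣
  lem true = refl
  lem false = ℤ.+-identityˡ _

∣pull∣ : ∀ {m u} (Ω : Subset (suc m)) → Invertible u (suc m) → ∣ pull u Ω ∣ ≡ ∣ Ω ∣
∣pull∣ {m} {u} Ω i = ℤ.+-injective (begin
  + ∣ pull u Ω ∣ ≡⟨ ∣∣-count (pull u Ω) ⟩
  ∑ (allFin (suc m)) (λ x → ⟪ lookup (pull u Ω) x B.≟ true ⟫)
    ≡⟨ ∑-cong (allFin (suc m)) (λ {x} _ → cong (λ b → ⟪ b B.≟ true ⟫) (lookup-pull u Ω x)) ⟩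
  ∑ (allFin (suc m)) (λ x → ⟪ lookup Ω (u • x) B.≟ true ⟫) ≡⟨ sym (∑-map (u •_) (allFin (suc m)) χ) ⟩
  ∑ (map (u •_) (allFin (suc m))) (λ x → ⟪ lookup Ω x B.≟ true ⟫)
    ≡⟨ ∑-↭ χ (length-≤⇒↭ (U.map⁺ inj (U.allFin⁺ (suc m))) (λ {x} _ → ∈-allFin x)
         (ℕ.≤-reflexive (sym (LP.length-map (u •_) (allFin (suc m)))))) ⟩
  count (allFin (suc m)) Ω ≡⟨ sym (∣∣-count Ω) ⟩
  + ∣ Ω ∣ ∎)
  where
  open ≡-Reasoning
  χ : Fin (suc m) → ℤ
  χ x = ⟪ lookup Ω x B.≟ true ⟫
  inj : ∀ {x y : Fin (suc m)} → u • x ≡ u • y → x ≡ y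
  inj {x} {y} e = ⟦⟧-injective (invertible-cancel {u} i
    (≅-trans (≅-sym (⟦•⟧ u x)) (≅-trans (≅-reflexive (cong ⟦_⟧ e)) (⟦•⟧ u y))))

-- Weak equivalence and orbit counting

deduplicate-≁ : ∀ {A : Set} {R : A → A → Set} (R? : ∀ x y → Dec (R x y)) (xs : List A) →
  AllPairs (λ x y → ¬ R x y) (deduplicate R? xs)
deduplicate-≁ R? [] = []
deduplicate-≁ R? (x ∷ xs) = AllP.all-filter (¬? ∘ R? x) (deduplicate R? xs)
  ∷ AllPairsP.filter⁺ (¬? ∘ R? x) (deduplicate-≁ R? xs)

deduplicate-⊆ : ∀ {A : Set} {R : A → A → Set} (R? : ∀ x y → Dec (R x y)) (xs : List A) {x} →
  x ∈ deduplicate R? xs → x ∈ xs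
deduplicate-⊆ R? xs = AnyP.deduplicate⁻ R?

AllPairs-≡ : ∀ {A : Set} {R : A → A → Set} → (∀ {x y} → R x y → R y x) → {xs : List A} →
  AllPairs (λ x y → ¬ R x y) xs → ∀ {x y} → x ∈ xs → y ∈ xs → R x y → x ≡ y
AllPairs-≡ s (a ∷ p) (here refl) (here refl) r = refl
AllPairs-≡ s (a ∷ p) (here refl) (there y∈) r = contradiction r (All.lookup a y∈)
AllPairs-≡ s (a ∷ p) (there x∈) (here refl) r = contradiction (s r) (All.lookup a x∈)
AllPairs-≡ s (a ∷ p) (there x∈) (there y∈) r = AllPairs-≡ s p x∈ y∈ r

AllPairs-unique : ∀ {A : Set} {R : A → A → Set} → (∀ {x} → R x x) → {xs : List A} →
  AllPairs (λ x y → ¬ R x y) xs → Unique xs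
AllPairs-unique r = AllPairs.map λ { n refl → n r }

module Transversal {A : Set} (R : A → A → Set) (R? : ∀ x y → Dec (R x y)) (R-refl : ∀ {x} → R x x)
  (R-sym : ∀ {x y} → R x y → R y x) (R-trans : ∀ {x y z} → R x y → R y z → R x z) (xs : List A) where

  reps : List A
  reps = deduplicate R? xs

  reps-unique : Unique reps
  reps-unique = AllPairs-unique R-refl (deduplicate-≁ R? xs)

  rep-exists : ∀ {x} → x ∈ xs → Any (R x) reps
  rep-exists x∈ = AnyP.deduplicate⁺ R? (λ yz xy → R-trans xy (R-sym yz)) (Any.map (λ { refl → R-refl }) x∈)

  -- Exactly one representative is related to x, so a function that vanishes off the class of x has
  -- a single term on the transversal.
  ∑-reps : ∀ {x} → x ∈ xs → (f : A → ℤ) → (∀ {r} → r ∈ reps → ¬ R x r → f r ≡ + 0) →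
    ∃ λ r → r ∈ reps × R x r × ∑ reps f ≡ f r
  ∑-reps {x} x∈ f z with find (rep-exists x∈)
  ... | r , r∈ , xr = r , r∈ , xr , ∑-single {f = f} reps-unique r∈
    (λ s∈ s≢ → z s∈ (λ r′ → s≢ (AllPairs-≡ R-sym (deduplicate-≁ R? xs) s∈ r∈ (R-trans (R-sym r′) xr))))

_≟ₛ_ : ∀ {n} (Ω Ω′ : Subset n) → Dec (Ω ≡ Ω′)
_≟ₛ_ = V.≡-dec B._≟_

infix 4 _∼_ _∼?_
-- The search over a finite list of residues makes the relation decidable; `∼-intro` then accepts
-- any invertible integer.
record _∼_ {m : ℕ} (Ω Ω′ : Subset (suc m)) : Set where
  constructor via
  field unit : Any (λ u → pull (+ u) Ω′ ≡ Ω) (units (suc m))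

_∼?_ : ∀ {m} (Ω Ω′ : Subset (suc m)) → Dec (Ω ∼ Ω′)
_∼?_ {m} Ω Ω′ = map′ via _∼_.unit (any? (λ u → pull (+ u) Ω′ ≟ₛ Ω) (units (suc m)))

∼-intro : ∀ {m} {Ω Ω′ : Subset (suc m)} u → Invertible u (suc m) → pull u Ω′ ≡ Ω → Ω ∼ Ω′
∼-intro {m} {Ω} {Ω′} u i e = via (Any.map
  (λ { refl → trans (pull-cong Ω′ (rem-≅ (suc m) u)) e })
  (∈-units⁺ (rem-< (suc m) u) (invertible-≅ (≅-sym (rem-≅ (suc m) u)) i)))

∼-elim : ∀ {m} {Ω Ω′ : Subset (suc m)} → Ω ∼ Ω′ →
  ∃ λ u → u ∈ units (suc m) × Invertible (+ u) (suc m) × pull (+ u) Ω′ ≡ Ω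
∼-elim (via e) with find e
... | u , u∈ , eq = u , u∈ , proj₂ (∈-units⁻ u∈) , eq

∼-refl : ∀ {m} {Ω : Subset (suc m)} → Ω ∼ Ω
∼-refl {Ω = Ω} = ∼-intro (+ 1) (+ 1 , ≅-refl) (pull-1 Ω)

invertible-inverse : ∀ {u v n} → u *ℤ v ≅ + 1 [ n ] → Invertible v n
invertible-inverse {u} {v} e = u , ≅-trans (≅-reflexive (ℤ.*-comm v u)) e

∼-sym : ∀ {m} {Ω Ω′ : Subset (suc m)} → Ω ∼ Ω′ → Ω′ ∼ Ω
∼-sym r with ∼-elim r
... | u , _ , (v , e) , eq = ∼-intro v (invertible-inverse {+ u} e) (pull-inverse {u = + u} e eq)

∼-trans : ∀ {m} {Ω Ω′ Ω″ : Subset (suc m)} → Ω ∼ Ω′ → Ω′ ∼ Ω″ → Ω ∼ Ω″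
∼-trans {Ω″ = Ω″} r s with ∼-elim r | ∼-elim s
... | u , _ , i , refl | v , _ , j , refl = ∼-intro (+ v *ℤ + u) (invertible-* j i) (sym (pull-pull (+ u) (+ v) Ω″))

module Burnside {m : ℕ} (X : List (Subset (suc m))) (X-unique : Unique X)
  (X-closed : ∀ {Ω} u → Invertible u (suc m) → Ω ∈ X → pull u Ω ∈ X) where

  open Transversal _∼_ _∼?_ ∼-refl ∼-sym ∼-trans X public

  private
    us = units (suc m)

    transporter : Subset (suc m) → Subset (suc m) → ℤ
    transporter Ω Ω′ = ∑ us (λ u → ⟪ pull (+ u) Ω ≟ₛ Ω′ ⟫)

    transporter-0 : ∀ {Ω Ω′} → ¬ (Ω′ ∼ Ω) → transporter Ω Ω′ ≡ + 0
    transporter-0 {Ω} {Ω′} n = ∑-0 us (λ {u} u∈ → ⟪⟫-no (pull (+ u) Ω ≟ₛ Ω′)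
      (λ e → n (∼-intro (+ u) (proj₂ (∈-units⁻ u∈)) e)))

    -- The units carrying Ω to Ω′ form a coset of the stabiliser of Ω′: if v is one of them, the
    -- substitution u = v j turns the condition on u into the condition that j fixes Ω′.
    transporter-stab : ∀ {Ω Ω′} → Ω′ ∼ Ω → transporter Ω Ω′ ≡ transporter Ω′ Ω′
    transporter-stab {Ω} {Ω′} r with ∼-elim r
    ... | v , _ , i , e = begin
      ∑ us f ≡⟨ sym (∑-↭ f (units-translate (suc m) (+ v) i)) ⟩
      ∑ (map (λ j → rem (suc m) (+ v *ℤ + j)) us) f ≡⟨ ∑-map (λ j → rem (suc m) (+ v *ℤ + j)) us f ⟩
      ∑ us (λ j → f (rem (suc m) (+ v *ℤ + j)))
        ≡⟨ ∑-cong us (λ {j} _ → cong (λ Ω → ⟪ Ω ≟ₛ Ω′ ⟫) (shift j)) ⟩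
      ∑ us (λ j → ⟪ pull (+ j) Ω′ ≟ₛ Ω′ ⟫) ∎
      where
      open ≡-Reasoning
      f : ℕ → ℤ
      f u = ⟪ pull (+ u) Ω ≟ₛ Ω′ ⟫
      shift : ∀ j → pull (+ rem (suc m) (+ v *ℤ + j)) Ω ≡ pull (+ j) Ω′
      shift j = trans (pull-cong Ω (rem-≅ (suc m) (+ v *ℤ + j))) (trans (sym (pull-pull (+ j) (+ v) Ω)) (cong (pull (+ j)) e))

    ∑-transporter : ∀ {Ω} → Ω ∈ X → ∑ reps (λ r → transporter r Ω) ≡ transporter Ω Ω
    ∑-transporter {Ω} Ω∈ = go (∑-reps Ω∈ (λ r → transporter r Ω) (λ _ → transporter-0))
      where
      go : (∃ λ r → r ∈ reps × Ω ∼ r × ∑ reps (λ r → transporter r Ω) ≡ transporter r Ω) →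
        ∑ reps (λ r → transporter r Ω) ≡ transporter Ω Ω
      go (r , _ , Ωr , e) = trans e (transporter-stab Ωr)

  -- Pairs of a representative r and a unit u are counted twice. Each pair has one image in `X`,
  -- which gives the left side. Sorted by the image Ω, only the representative of the class of Ω
  -- contributes, with as many units as the stabiliser of Ω has.
  burnside : + length us *ℤ + length reps ≡ ∑ us (λ u → ∑ X (λ Ω → ⟪ pull (+ u) Ω ≟ₛ Ω ⟫))
  burnside = sym (begin
    ∑ us (λ u → ∑ X (λ Ω → ⟪ pull (+ u) Ω ≟ₛ Ω ⟫)) ≡⟨ ∑-swap us X (λ u Ω → ⟪ pull (+ u) Ω ≟ₛ Ω ⟫) ⟩
    ∑ X (λ Ω → transporter Ω Ω) ≡⟨ ∑-cong X (λ Ω∈ → sym (∑-transporter Ω∈)) ⟩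
    ∑ X (λ Ω → ∑ reps (λ r → transporter r Ω)) ≡⟨ ∑-swap X reps (λ Ω r → transporter r Ω) ⟩
    ∑ reps (λ r → ∑ X (transporter r)) ≡⟨ ∑-cong reps (λ {r} _ → ∑-swap X us (λ Ω u → ⟪ pull (+ u) r ≟ₛ Ω ⟫)) ⟩
    ∑ reps (λ r → ∑ us (λ u → ∑ X (λ Ω → ⟪ pull (+ u) r ≟ₛ Ω ⟫)))
      ≡⟨ ∑-cong reps (λ r∈ → ∑-cong us (λ u∈ → one (deduplicate-⊆ _∼?_ X r∈) u∈)) ⟩
    ∑ reps (λ r → ∑ us (λ u → + 1)) ≡⟨ ∑-cong reps (λ _ → ∑-length us) ⟩
    ∑ reps (λ r → + length us) ≡⟨ ∑-const reps (+ length us) ⟩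
    + length reps *ℤ + length us ≡⟨ ℤ.*-comm (+ length reps) (+ length us) ⟩
    + length us *ℤ + length reps ∎)
    where
    open ≡-Reasoning
    one : ∀ {r u} → r ∈ X → u ∈ us → ∑ X (λ Ω → ⟪ pull (+ u) r ≟ₛ Ω ⟫) ≡ + 1
    one {r} {u} r∈ u∈ = trans
      (∑-single {f = λ Ω → ⟪ pull (+ u) r ≟ₛ Ω ⟫} X-unique (X-closed (+ u) (proj₂ (∈-units⁻ u∈)) r∈)
        (λ {Ω} _ n → ⟪⟫-no (pull (+ u) r ≟ₛ Ω) (λ e → n (sym e))))
      (⟪⟫-yes (pull (+ u) r ≟ₛ pull (+ u) r) refl)

-- The automorphism is multiplication by u = α(1), by induction on the multiple of 1. The translated
-- map is never built: f(x) - f(0) = α(x) suffices, for x lies in Ω iff 0 and x are adjacent, iff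
-- f(0) and f(x) are, iff α(x) lies in Ω′.
WE⇒∼ : ∀ {m} {Ω Ω′ : Subset (suc m)} → WeaklyEquivalent Ω Ω′ → Ω ∼ Ω′
WE⇒∼ {m} {Ω} {Ω′} (f , (_ , adj) , α , (((_ , α-sur) , α-hom)) , f-α) = ∼-intro u inv (lookup-ext λ x →
  trans (lookup-pull u Ω′ x) (trans (cong (lookup Ω′) (sym (α-• x))) (same x)))
  where
  N = suc m
  u = ⟦ α (res (+ 1)) ⟧
  α-0 : ⟦ α Fin.zero ⟧ ≅ + 0 [ N ]
  α-0 = ≅-trans (≅-reflexive (sym (cancel ⟦ α Fin.zero ⟧))) (≅⇒-0 e)
    where
    cancel : ∀ x → (x +ℤ x) -ℤ x ≡ x
    cancel = solve-∀
    e : ⟦ α Fin.zero ⟧ +ℤ ⟦ α Fin.zero ⟧ ≅ ⟦ α Fin.zero ⟧ [ N ]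
    e = ≅-trans (≅-sym (⟦⊕⟧ (α Fin.zero) (α Fin.zero)))
      (≅-reflexive (cong ⟦_⟧ (trans (sym (α-hom Fin.zero Fin.zero)) (cong α (⟦⟧-injective (⟦⊕⟧ {m} Fin.zero Fin.zero))))))
  α-ℕ : ∀ k → ⟦ α (res (+ k)) ⟧ ≅ u *ℤ + k [ N ]
  α-ℕ zero = ≅-trans (≅-reflexive (cong (λ x → ⟦ α x ⟧) (⟦⟧-injective {x = res (+ 0)} {y = Fin.zero} (res-≅ (+ 0)))))
    (≅-trans α-0 (≅-reflexive (sym (ℤ.*-zeroʳ u))))
  α-ℕ (suc k) = ≅-trans (≅-reflexive (cong ⟦_⟧ (trans (cong α step) (α-hom (res (+ 1)) (res (+ k))))))
    (≅-trans (⟦⊕⟧ (α (res (+ 1))) (α (res (+ k)))) (≅-trans (≅-+ (≅-refl {x = u}) (α-ℕ k)) (≅-reflexive (dist u (+ k)))))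
    where
    dist : ∀ u k → u +ℤ u *ℤ k ≡ u *ℤ (+ 1 +ℤ k)
    dist = solve-∀
    step : res (+ suc k) ≡ res (+ 1) ⊕ res (+ k)
    step = ⟦⟧-injective (≅-trans (res-≅ (+ suc k)) (≅-sym (≅-trans (⟦⊕⟧ (res (+ 1)) (res (+ k))) (≅-+ (res-≅ (+ 1)) (res-≅ (+ k))))))
  α-• : ∀ x → α x ≡ u • x
  α-• x = ⟦⟧-injective (≅-trans (≅-reflexive (cong (λ y → ⟦ α y ⟧) (⟦⟧-injective {x = x} {y = res ⟦ x ⟧} (≅-sym (res-≅ ⟦ x ⟧)))))
    (≅-trans (α-ℕ (toℕ x)) (≅-sym (⟦•⟧ u x))))
  -- The preimage of 1 under α is an inverse of u.
  inv : Invertible u N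
  inv with α-sur (res (+ 1))
  ... | x , e = ⟦ x ⟧ , ≅-trans (≅-sym (⟦•⟧ u x)) (≅-trans (≅-reflexive (cong ⟦_⟧ (trans (sym (α-• x)) (e refl)))) (res-≅ (+ 1)))
  ⊖-0 : ∀ x → x ⊖ Fin.zero ≡ x
  ⊖-0 x = ⟦⟧-injective (≅-trans (⟦⊖⟧ x Fin.zero) (≅-reflexive (ℤ.+-identityʳ ⟦ x ⟧)))
  f-diff : ∀ x → f x ⊖ f Fin.zero ≡ α x
  f-diff x = ⟦⟧-injective (≅-trans (⟦⊖⟧ (f x) (f Fin.zero)) (≅-trans
    (≅-+ (≅-trans (≅-reflexive (cong ⟦_⟧ (trans (cong f (sym x⊕0)) (f-α x Fin.zero)))) (⟦⊕⟧ (α x) (f Fin.zero))) (≅-refl {x = - ⟦ f Fin.zero ⟧}))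
    (≅-reflexive (cancel ⟦ α x ⟧ ⟦ f Fin.zero ⟧))))
    where
    cancel : ∀ a b → (a +ℤ b) -ℤ b ≡ a
    cancel = solve-∀
    x⊕0 : x ⊕ Fin.zero ≡ x
    x⊕0 = ⟦⟧-injective (≅-trans (⟦⊕⟧ x Fin.zero) (≅-reflexive (ℤ.+-identityʳ ⟦ x ⟧)))
  same : ∀ x → lookup Ω′ (α x) ≡ lookup Ω x
  same x with lookup Ω x in eq | lookup Ω′ (α x) in eq′
  ... | true | true = refl
  ... | false | false = refl
  ... | true | false = trans (sym eq′) (∈ₛ⇒lookup (subst (_∈ₛ Ω′) (f-diff x)
    (Equivalence.to (adj Fin.zero x) (subst (_∈ₛ Ω) (sym (⊖-0 x)) (lookup⇒∈ₛ eq)))))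
  ... | false | true = trans (sym (∈ₛ⇒lookup (subst (_∈ₛ Ω) (⊖-0 x)
    (Equivalence.from (adj Fin.zero x) (subst (_∈ₛ Ω′) (sym (f-diff x)) (lookup⇒∈ₛ eq′)))))) eq

-- Multiplication by u serves both as the graph isomorphism and as the automorphism; the condition
-- linking the two is then additivity.
∼⇒WE : ∀ {m} {Ω Ω′ : Subset (suc m)} → Ω ∼ Ω′ → WeaklyEquivalent Ω Ω′
∼⇒WE {m} {Ω} {Ω′} r with ∼-elim r
... | w , _ , (v , e) , refl = (u •_) , (bij , adj) , (u •_) , (bij , hom) , hom
  where
  u = + w
  undo : ∀ a b (x : Fin (suc m)) → a *ℤ b ≅ + 1 [ suc m ] → a • b • x ≡ x
  undo a b x e = trans (•-• a b x) (trans (•-cong x e) (1-• x))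
  e′ : v *ℤ u ≅ + 1 [ suc m ]
  e′ = ≅-trans (≅-reflexive (ℤ.*-comm v u)) e
  bij : Bijective _≡_ _≡_ (u •_)
  bij = (λ {x} {y} q → trans (sym (undo v u x e′)) (trans (cong (v •_) q) (undo v u y e′)))
      , (λ y → v • y , λ { refl → undo u v y e })
  hom : ∀ a b → u • (a ⊕ b) ≡ (u • a) ⊕ (u • b)
  hom a b = ⟦⟧-injective (≅-trans (⟦•⟧ u (a ⊕ b)) (≅-trans (≅-*ˡ u (⟦⊕⟧ a b))
    (≅-trans (≅-reflexive (ℤ.*-distribˡ-+ u ⟦ a ⟧ ⟦ b ⟧)) (≅-sym (≅-trans (⟦⊕⟧ (u • a) (u • b)) (≅-+ (⟦•⟧ u a) (⟦•⟧ u b)))))))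
  hom-⊖ : ∀ a b → u • (a ⊖ b) ≡ (u • a) ⊖ (u • b)
  hom-⊖ a b = ⟦⟧-injective (≅-trans (⟦•⟧ u (a ⊖ b)) (≅-trans (≅-*ˡ u (⟦⊖⟧ a b))
    (≅-trans (≅-reflexive (dist u ⟦ a ⟧ ⟦ b ⟧)) (≅-sym (≅-trans (⟦⊖⟧ (u • a) (u • b)) (≅-+ (⟦•⟧ u a) (≅-neg (⟦•⟧ u b))))))))
    where
    dist : ∀ u a b → u *ℤ (a -ℤ b) ≡ u *ℤ a -ℤ u *ℤ b
    dist = solve-∀
  adj : ∀ g h → Adj (pull u Ω′) g h ⇔ Adj Ω′ (u • g) (u • h)
  adj g h = mk⇔
    (λ a → lookup⇒∈ₛ (trans (cong (lookup Ω′) (sym (hom-⊖ h g))) (trans (sym (lookup-pull u Ω′ (h ⊖ g))) (∈ₛ⇒lookup a))))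
    (λ a → lookup⇒∈ₛ (trans (lookup-pull u Ω′ (h ⊖ g)) (trans (cong (lookup Ω′) (hom-⊖ h g)) (∈ₛ⇒lookup a))))

-- Orders of residues and sums of totients

^-mul : ∀ u a b → u ^ℤ (a * b) ≡ (u ^ℤ a) ^ℤ b
^-mul u a b = sym (ℤ.^-*-assoc u a b)

1^ : ∀ k → (+ 1) ^ℤ k ≡ + 1
1^ = ℤ.^-zeroˡ

^-multiple : ∀ {u n e j} → u ^ℤ e ≅ + 1 [ n ] → e ∣ j → u ^ℤ j ≅ + 1 [ n ]
^-multiple {u} {n} {e} h (divides q refl) = ≅-trans (≅-reflexive (trans (cong (u ^ℤ_) (ℕ.*-comm q e)) (^-mul u e q)))
  (≅-trans (≅-^ q h) (≅-reflexive (1^ q)))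

-- Minimality is phrased through divisibility, the form in which least common multiples and
-- uniqueness use it.
record Order (n : ℕ) (u : ℤ) (e : ℕ) : Set where
  constructor order
  field
    positive : 0 < e
    power : u ^ℤ e ≅ + 1 [ n ]
    minimal : ∀ {j} → u ^ℤ j ≅ + 1 [ n ] → e ∣ j

Order-unique : ∀ {n u e e′} → Order n u e → Order n u e′ → e ≡ e′
Order-unique o o′ = Dv.∣-antisym (Order.minimal o (Order.power o′)) (Order.minimal o′ (Order.power o))

Order-≅ : ∀ {n u v e} → u ≅ v [ n ] → Order n u e → Order n v e
Order-≅ {e = e} c (order e> pw mn) = order e> (≅-trans (≅-^ e (≅-sym c)) pw) (λ {j} h → mn (≅-trans (≅-^ j c) h))

least : ∀ {P : ℕ → Set} (P? : ∀ n → Dec (P n)) N → P N → ∃ λ e → P e × (∀ {j} → j < e → ¬ P j)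
least {P} P? N pN = go N zero (λ ()) (subst P (sym (ℕ.+-identityʳ N)) pN)
  where
  go : ∀ k b → (∀ {j} → j < b → ¬ P j) → P (k + b) → ∃ λ e → P e × (∀ {j} → j < e → ¬ P j)
  go k b low p with P? b
  ... | yes q = b , q , low
  go zero b low p | no q = contradiction p q
  go (suc k) b low p | no q = go k (suc b) low′ (subst P (sym (ℕ.+-suc k b)) p)
    where
    low′ : ∀ {j} → j < suc b → ¬ P j
    low′ {j} (s≤s j≤b) pj with ℕ.m≤n⇒m<n∨m≡n j≤b
    ... | inj₁ j<b = low j<b pj
    ... | inj₂ refl = q pj

-- The least positive exponent works: reducing any other exponent modulo it leaves a smaller one,
-- which must be 0.
order-exists : ∀ {n u} N → 0 < N → u ^ℤ N ≅ + 1 [ n ] → ∃ (Order n u)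
order-exists {n} {u} N N> h with least (λ j → (0 ℕ.<? j) ×-dec ((u ^ℤ j) ≅? + 1 [ n ])) N (N> , h)
... | suc e , (_ , pw) , low = suc e , order (s≤s z≤n) pw min
  where
  min : ∀ {j} → u ^ℤ j ≅ + 1 [ n ] → suc e ∣ j
  min {j} hj = Dv.m%n≡0⇒n∣m j (suc e) (zero-rem (j % suc e) (DM.m%n<n j (suc e)) r-pow)
    where
    r-pow : u ^ℤ (j % suc e) ≅ + 1 [ n ]
    r-pow = ≅-trans (≅-reflexive (sym (ℤ.*-identityʳ (u ^ℤ (j % suc e)))))
      (≅-trans (≅-*ˡ (u ^ℤ (j % suc e)) (≅-sym (^-multiple {u} {e = suc e} pw (divides (j / suc e) refl))))
      (≅-trans (≅-reflexive (trans (sym (ℤ.^-distribˡ-+-* u (j % suc e) (j / suc e * suc e))) (cong (u ^ℤ_) (sym (DM.m≡m%n+[m/n]*n j (suc e)))))) hj))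
    zero-rem : ∀ r → r < suc e → u ^ℤ r ≅ + 1 [ n ] → r ≡ 0
    zero-rem zero _ _ = refl
    zero-rem (suc r) r< hr = contradiction (s≤s z≤n , hr) (low r<)

∏-≅ : ∀ {A : Set} {n} (xs : List A) {f g : A → ℤ} → (∀ {x} → x ∈ xs → f x ≅ g x [ n ]) → ∏ xs f ≅ ∏ xs g [ n ]
∏-≅ [] h = ≅-refl
∏-≅ (x ∷ xs) h = ≅-* (h (here refl)) (∏-≅ xs (h ∘ there))

∏-invertible : ∀ {A : Set} {n} (xs : List A) {f : A → ℤ} → (∀ {x} → x ∈ xs → Invertible (f x) n) → Invertible (∏ xs f) n
∏-invertible [] h = + 1 , ≅-refl
∏-invertible (x ∷ xs) h = invertible-* (h (here refl)) (∏-invertible xs (h ∘ there))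

∏-const : ∀ {A : Set} (xs : List A) u → ∏ xs (λ _ → u) ≡ u ^ℤ length xs
∏-const [] u = refl
∏-const (x ∷ xs) u = cong (u *ℤ_) (∏-const xs u)

-- Multiplication by u permutes the units, so their product Q satisfies u^k Q = Q with k the number
-- of units, and Q is invertible.
euler : ∀ n .{{_ : NonZero n}} {u} → Invertible u n → u ^ℤ length (units n) ≅ + 1 [ n ]
euler n {u} i = invertible-cancel {Q} (∏-invertible us (λ j∈ → proj₂ (∈-units⁻ j∈)))
  (≅-trans (≅-reflexive (ℤ.*-comm Q (u ^ℤ length us))) (≅-trans (≅-reflexive lhs) (≅-trans (≅-sym eq) (≅-reflexive (sym (ℤ.*-identityʳ Q))))))
  where
  us = units n
  Q = ∏ us (λ j → + j)
  tr : ℕ → ℕ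
  tr j = rem n (u *ℤ + j)
  lhs : (u ^ℤ length us) *ℤ Q ≡ ∏ us (λ j → u *ℤ + j)
  lhs = sym (trans (∏-* us (λ _ → u) (λ j → + j)) (cong (_*ℤ Q) (∏-const us u)))
  eq : Q ≅ ∏ us (λ j → u *ℤ + j) [ n ]
  eq = ≅-trans (≅-reflexive (trans (sym (∏-↭ (λ j → + j) (units-translate n u i))) (∏-map tr us (λ j → + j))))
    (∏-≅ us (λ {j} _ → rem-≅ n (u *ℤ + j)))

units-nonempty : ∀ n .{{_ : NonZero n}} → 0 < length (units n)
units-nonempty n with units n | ∈-units⁺ {n} (rem-< n (+ 1)) (invertible-≅ (≅-sym (rem-≅ n (+ 1))) (+ 1 , ≅-refl))
... | _ ∷ _ | _ = s≤s z≤n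

∈-range⁺ : ∀ {m j} → 0 < j → j ≤ m → j ∈ map suc (upTo m)
∈-range⁺ {j = suc j} _ j≤ = ∈-map⁺ suc (∈-upTo⁺ j≤)

∈-range⁻ : ∀ {m j} → j ∈ map suc (upTo m) → 0 < j × j ≤ m
∈-range⁻ j∈ with ∈-map⁻ suc j∈
... | i , i∈ , refl = s≤s z≤n , ∈-upTo⁻ i∈

range-unique : ∀ m → Unique (map suc (upTo m))
range-unique m = U.map⁺ ℕ.suc-injective (U.upTo⁺ m)

∈-divisors⁺ : ∀ {m d} → 0 < m → d ∣ m → d ∈ divisors m
∈-divisors⁺ {m@(suc _)} {d} _ d∣ = ∈-filter⁺ (λ d → d ∣? m) (∈-range⁺ (d> d d∣) (Dv.∣⇒≤ d∣)) d∣
  where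
  d> : ∀ d → d ∣ m → 0 < d
  d> zero h = contradiction (Dv.0∣⇒≡0 h) (λ ())
  d> (suc d) h = s≤s z≤n

∈-divisors⁻ : ∀ {m d} → d ∈ divisors m → d ∣ m × 0 < d
∈-divisors⁻ {m} d∈ with ∈-filter⁻ (λ d → d ∣? m) {xs = map suc (upTo m)} d∈
... | r , h = h , proj₁ (∈-range⁻ r)

divisors-unique : ∀ m → Unique (divisors m)
divisors-unique m = U.filter⁺ (λ d → d ∣? m) (range-unique m)

div-* : ∀ e {d} → 0 < d → div (e * d) d ≡ e
div-* e {suc d} _ = DM.m*n/n≡m e (suc d)

-- With m = e d, the numbers whose gcd with m is d are the multiples k d with k prime to e.
φ-gcd : ∀ {m d} → 0 < m → d ∈ divisors m → length (filter (λ j → gcd j m ℕ.≟ d) (map suc (upTo m))) ≡ φ (div m d)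
φ-gcd {m} {d} m> d∈ with ∈-divisors⁻ {m} {d} d∈
... | divides e refl , d> = trans (P.↭-length perm) (trans (LP.length-map (_* d) C′) (cong φ (sym (div-* e d>))))
  where
  instance
    d≢0 : NonZero d
    d≢0 = ℕ.>-nonZero d>
  A = filter (λ j → gcd j (e * d) ℕ.≟ d) (map suc (upTo (e * d)))
  C′ = filter (λ j → gcd j e ℕ.≟ 1) (map suc (upTo e))
  gcd-scale : ∀ k → gcd (k * d) (e * d) ≡ gcd k e * d
  gcd-scale k = trans (cong₂ gcd (ℕ.*-comm k d) (ℕ.*-comm e d)) (trans (sym (G.c*gcd[m,n]≡gcd[cm,cn] d k e)) (ℕ.*-comm d (gcd k e)))
  to : ∀ {j} → j ∈ A → j ∈ map (_* d) C′
  to {j} j∈ with ∈-filter⁻ (λ j → gcd j (e * d) ℕ.≟ d) {xs = map suc (upTo (e * d))} j∈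
  ... | r , g with subst (_∣ j) g (G.gcd[m,n]∣m j (e * d))
  ... | divides k refl = ∈-map⁺ (_* d) (∈-filter⁺ (λ j → gcd j e ℕ.≟ 1)
    (∈-range⁺ (ℕ.n≢0⇒n>0 λ { refl → contradiction (proj₁ (∈-range⁻ r)) (λ ()) }) (ℕ.*-cancelʳ-≤ k e d (proj₂ (∈-range⁻ r))))
    (ℕ.*-cancelʳ-≡ (gcd k e) 1 d (trans (sym (gcd-scale k)) (trans g (sym (ℕ.*-identityˡ d))))))
  from : ∀ {j} → j ∈ map (_* d) C′ → j ∈ A
  from j∈ with ∈-map⁻ (_* d) j∈
  ... | k , k∈ , refl with ∈-filter⁻ (λ j → gcd j e ℕ.≟ 1) {xs = map suc (upTo e)} k∈
  ... | r , g = ∈-filter⁺ (λ j → gcd j (e * d) ℕ.≟ d)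
    (∈-range⁺ (ℕ.*-mono-≤ (proj₁ (∈-range⁻ r)) d>) (ℕ.*-monoˡ-≤ d (proj₂ (∈-range⁻ r))))
    (trans (gcd-scale k) (trans (cong (_* d) g) (ℕ.*-identityˡ d)))
  perm : A ↭ map (_* d) C′
  perm = unique⇒↭ (U.filter⁺ (λ j → gcd j (e * d) ℕ.≟ d) (range-unique (e * d)))
    (U.map⁺ (λ {x} {y} → ℕ.*-cancelʳ-≡ x y d) (U.filter⁺ (λ j → gcd j e ℕ.≟ 1) (range-unique e))) to from

-- Group the residues 1, …, m by their gcd with m.
∑-φ : ∀ {m} → 0 < m → ∑ (divisors m) (λ d → + φ (div m d)) ≡ + m
∑-φ {m} m> = begin
  ∑ (divisors m) (λ d → + φ (div m d)) ≡⟨ ∑-cong (divisors m) (λ d∈ → cong +_ (sym (φ-gcd m> d∈))) ⟩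
  ∑ (divisors m) (λ d → + length (filter (λ j → gcd j m ℕ.≟ d) R))
    ≡⟨ ∑-cong (divisors m) (λ {d} _ → sym (∑-length (filter (λ j → gcd j m ℕ.≟ d) R))) ⟩
  ∑ (divisors m) (λ d → ∑ (filter (λ j → gcd j m ℕ.≟ d) R) (λ _ → + 1))
    ≡⟨ sym (∑-fibres ℕ._≟_ (λ j → gcd j m) R (divisors m) (λ _ → + 1) (divisors-unique m)
         (λ {j} _ → ∈-divisors⁺ m> (G.gcd[m,n]∣n j m))) ⟩
  ∑ R (λ _ → + 1) ≡⟨ ∑-length R ⟩
  + length R ≡⟨ cong +_ (trans (LP.length-map suc (upTo m)) (LP.length-upTo m)) ⟩
  + m ∎
  where
  open ≡-Reasoning
  R = map suc (upTo m)

+-cancelˡ : ∀ c {a b} → c +ℤ a ≡ c +ℤ b → a ≡ b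
+-cancelˡ c {a} {b} e = trans (sym (undo c a)) (trans (cong (- c +ℤ_) e) (undo c b))
  where
  undo : ∀ c a → - c +ℤ (c +ℤ a) ≡ a
  undo = solve-∀

+-cancelʳ-≤ : ∀ c {a b} → a +ℤ c ℤ.≤ b +ℤ c → a ℤ.≤ b
+-cancelʳ-≤ c {a} {b} h = subst₂ ℤ._≤_ (undo a c) (undo b c) (ℤ.+-monoˡ-≤ (- c) h)
  where
  undo : ∀ a c → (a +ℤ c) -ℤ c ≡ a
  undo = solve-∀

∑-≤ : ∀ {A : Set} (xs : List A) {f g : A → ℤ} → (∀ {x} → x ∈ xs → f x ℤ.≤ g x) → ∑ xs f ℤ.≤ ∑ xs g
∑-≤ [] h = ℤ.≤-refl
∑-≤ (x ∷ xs) h = ℤ.+-mono-≤ (h (here refl)) (∑-≤ xs (h ∘ there))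

-- This closes the squeeze that turns upper bounds for the number of residues of each index into
-- exact values.
∑-≤-≡ : ∀ {A : Set} (xs : List A) {f g : A → ℤ} → (∀ {x} → x ∈ xs → f x ℤ.≤ g x) → ∑ xs f ≡ ∑ xs g →
  ∀ {x} → x ∈ xs → f x ≡ g x
∑-≤-≡ (y ∷ xs) {f} {g} h e = λ where
    (here refl) → head
    (there x∈) → ∑-≤-≡ xs (h ∘ there) (+-cancelˡ (f y) (trans e (cong (_+ℤ ∑ xs g) (sym head)))) x∈
  where
  head : f y ≡ g y
  head = ℤ.≤-antisym (h (here refl)) (+-cancelʳ-≤ (∑ xs g)
    (ℤ.≤-trans (ℤ.≤-reflexive (sym e)) (ℤ.+-monoʳ-≤ (f y) (∑-≤ xs (h ∘ there)))))

-- The two ranges differ only in the endpoints 0 and n, where f takes the same value.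
∑-range : ∀ n (f : ℕ → ℤ) → f 0 ≡ f n → ∑ (map suc (upTo n)) f ≡ ∑ (upTo n) f
∑-range n f e = +-cancelˡ (f 0) (trans (cong (λ xs → f 0 +ℤ ∑ xs f) (LP.map-upTo suc n))
  (trans (cong (λ xs → ∑ xs f) (sym (LP.upTo-∷ʳ n))) (trans (∑-++ (upTo n) (n ∷ []) f)
  (trans (cong (∑ (upTo n) f +ℤ_) (ℤ.+-identityʳ (f n))) (trans (ℤ.+-comm (∑ (upTo n) f) (f n)) (cong (_+ℤ ∑ (upTo n) f) (sym e)))))))

length-units : ∀ n → + length (units n) ≡ ∑ (upTo n) (λ j → ⟪ gcd j n ℕ.≟ 1 ⟫)
length-units n = trans (cong (λ us → + length us) (units-def n)) (sym (∑-⟪⟫ (λ j → gcd j n ℕ.≟ 1) (upTo n)))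

φ-units : ∀ n → φ n ≡ length (units n)
φ-units n = ℤ.+-injective (trans (sym (∑-⟪⟫ (λ j → gcd j n ℕ.≟ 1) (map suc (upTo n))))
  (trans (∑-range n (λ j → ⟪ gcd j n ℕ.≟ 1 ⟫) (cong (λ g → ⟪ g ℕ.≟ 1 ⟫) (trans (G.gcd-identityˡ n) (sym gcd-diag)))) (sym (length-units n))))
  where
  gcd-diag : gcd n n ≡ n
  gcd-diag = Dv.∣-antisym (G.gcd[m,n]∣m n n) (G.gcd-greatest Dv.∣-refl Dv.∣-refl)

-- The number of residues of given index modulo a prime

eval : List ℤ → ℤ → ℤ
eval [] x = + 0
eval (a ∷ f) x = a +ℤ x *ℤ eval f x

-- Synthetic division by x - r: the coefficients of the quotient are the intermediate Horner values
-- at r. The quotient is one coefficient shorter, which drives the induction of the root bound.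
divide-root : ∀ a f r → ∃ λ q → length q ≡ length f × (∀ x → eval (a ∷ f) x ≡ eval (a ∷ f) r +ℤ (x -ℤ r) *ℤ eval q x)
divide-root a [] r = [] , refl , λ x → lem a x r
  where
  lem : ∀ a x r → a +ℤ x *ℤ + 0 ≡ (a +ℤ r *ℤ + 0) +ℤ (x -ℤ r) *ℤ + 0
  lem = solve-∀
divide-root a (b ∷ f) r with divide-root b f r
... | q , l , e = eval (b ∷ f) r ∷ q , cong suc l , λ x →
  trans (cong (λ z → a +ℤ x *ℤ z) (e x)) (lem a x r (eval (b ∷ f) r) (eval q x))
  where
  lem : ∀ a x r v w → a +ℤ x *ℤ (v +ℤ (x -ℤ r) *ℤ w) ≡ (a +ℤ r *ℤ v) +ℤ (x -ℤ r) *ℤ (v +ℤ x *ℤ w)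
  lem = solve-∀

-- Stated without degrees or leading coefficients: as many incongruent roots as coefficients make f
-- vanish identically modulo p. Dividing by x - r keeps the other roots, because a prime dividing (s
-- - r) q(s) divides one of the factors.
root-bound : ∀ {p} → Prime p → ∀ f rs → AllPairs (λ r s → ¬ r ≅ s [ p ]) rs → All (λ r → eval f r ≅ + 0 [ p ]) rs →
  length f ≤ length rs → ∀ x → eval f x ≅ + 0 [ p ]
root-bound pr [] rs ap ro l x = ≅-refl
root-bound {p} pr (a ∷ f) (r ∷ rs) (r# ∷ ap) (r0 ∷ ro) (s≤s l) x with divide-root a f r
... | q , lq , e = ≅-trans (≅-reflexive (e x)) (≅-trans (≅-+ r0 (≅-*ˡ (x -ℤ r)
    (root-bound pr q rs ap (All.zipWith (λ (n , z) → q-root n z) (r# , ro)) (ℕ.≤-trans (ℕ.≤-reflexive lq) l) x)))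
    (≅-reflexive (trans (ℤ.+-identityˡ ((x -ℤ r) *ℤ + 0)) (ℤ.*-zeroʳ (x -ℤ r)))))
  where
  cancel : ∀ a b → (a +ℤ b) -ℤ a ≡ b
  cancel = solve-∀
  q-root : ∀ {s} → ¬ r ≅ s [ p ] → eval (a ∷ f) s ≅ + 0 [ p ] → eval q s ≅ + 0 [ p ]
  q-root {s} n z = pick (≅-prime (s -ℤ r) (eval q s) pr
      (≅-trans (≅-reflexive (trans (sym (cancel (eval (a ∷ f) r) ((s -ℤ r) *ℤ eval q s))) (cong (_-ℤ eval (a ∷ f) r) (sym (e s)))))
        (≅-+ z (≅-neg r0))))
    where
    pick : s -ℤ r ≅ + 0 [ p ] ⊎ eval q s ≅ + 0 [ p ] → eval q s ≅ + 0 [ p ]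
    pick (inj₁ h) = contradiction (≅-sym (-0⇒≅ h)) n
    pick (inj₂ h) = h

monomial : ℕ → List ℤ
monomial zero = + 1 ∷ []
monomial (suc k) = + 0 ∷ monomial k

eval-monomial : ∀ k x → eval (monomial k) x ≡ x ^ℤ k
eval-monomial zero x = trans (cong (+ 1 +ℤ_) (ℤ.*-zeroʳ x)) refl
eval-monomial (suc k) x = trans (ℤ.+-identityˡ _) (cong (x *ℤ_) (eval-monomial k x))

length-monomial : ∀ k → length (monomial k) ≡ suc k
length-monomial zero = refl
length-monomial (suc k) = cong suc (length-monomial k)

-- With more than e roots, x^e - 1 would vanish modulo p at x = 0, and p would divide 1.
unity-roots-bound : ∀ {p} → Prime p → ∀ e → 0 < e → ∀ rs → AllPairs (λ r s → ¬ r ≅ s [ p ]) rs →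
  All (λ r → r ^ℤ e ≅ + 1 [ p ]) rs → length rs ≤ e
unity-roots-bound {p} pr (suc k) _ rs ap ro = ℕ.≮⇒≥ λ l →
  ℕ.nonTrivial⇒≢1 {p} {{Pr.prime⇒nonTrivial pr}} (Dv.∣1⇒≡1 (≅-0 {x = - + 1}
    (root-bound pr f rs ap (All.map (λ {r} → root {r}) ro) (ℕ.≤-trans (ℕ.≤-reflexive (cong suc (length-monomial k))) l) (+ 0))))
  where
  f = - + 1 ∷ monomial k
  root : ∀ {r} → r ^ℤ suc k ≅ + 1 [ p ] → eval f r ≅ + 0 [ p ]
  root {r} h = ≅-trans (≅-reflexive (cong (λ z → - + 1 +ℤ r *ℤ z) (eval-monomial k r))) (≅-+ (≅-refl {x = - + 1}) h)

module PrimeIndex (p : ℕ) (pr : Prime p) where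

  private
    instance
      p≢0 : NonZero p
      p≢0 = Pr.prime⇒nonZero pr

  1<p : 1 < p
  1<p = ℕ.nonTrivial⇒n>1 p {{Pr.prime⇒nonTrivial pr}}

  0<p-1 : 0 < p ∸ 1
  0<p-1 = ℕ.m<n⇒0<n∸m 1<p

  non-multiple-invertible : ∀ {a} → ¬ p ∣ a → Invertible (+ a) p
  non-multiple-invertible {a} n = coprime⇒invertible a p (pick (Pr.prime⇒irreducible pr (G.gcd[m,n]∣n a p)))
    where
    pick : gcd a p ≡ 1 ⊎ gcd a p ≡ p → gcd a p ≡ 1
    pick (inj₁ h) = h
    pick (inj₂ h) = contradiction (subst (_∣ a) h (G.gcd[m,n]∣m a p)) n

  invertible-non-multiple : ∀ {u} → Invertible u p → ¬ u ≅ + 0 [ p ]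
  invertible-non-multiple (v , e) z = ℕ.<⇒≢ 1<p (sym (Dv.∣1⇒≡1 (≅-0 {x = + 1} (≅-trans (≅-sym e) (≅-*ʳ v z)))))

  length-units-prime : length (units p) ≡ p ∸ 1
  length-units-prime = trans (P.↭-length (unique⇒↭ (units-unique p) (range-unique (p ∸ 1)) to from))
    (trans (LP.length-map suc (upTo (p ∸ 1))) (LP.length-upTo (p ∸ 1)))
    where
    to : ∀ {j} → j ∈ units p → j ∈ map suc (upTo (p ∸ 1))
    to {zero} j∈ = contradiction ≅-refl (invertible-non-multiple (proj₂ (∈-units⁻ {p} j∈)))
    to {suc j} j∈ = ∈-range⁺ (s≤s z≤n) (ℕ.m+n≤o⇒m≤o∸n (suc j) (subst (_≤ p) (ℕ.+-comm 1 (suc j)) (proj₁ (∈-units⁻ {p} j∈))))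
    from : ∀ {j} → j ∈ map suc (upTo (p ∸ 1)) → j ∈ units p
    from {j} j∈ with ∈-range⁻ j∈
    ... | j> , j≤ = ∈-units⁺ j<p (non-multiple-invertible (λ d → ℕ.<⇒≢ j> (sym (small-multiple j<p d))))
      where
      j<p : j < p
      j<p = ℕ.≤-<-trans j≤ (subst (p ∸ 1 <_) (ℕ.m∸n+n≡m (ℕ.<⇒≤ 1<p)) (ℕ.m<m+n (p ∸ 1) (s≤s z≤n)))

  fermat : ∀ {u} → Invertible u p → u ^ℤ (p ∸ 1) ≅ + 1 [ p ]
  fermat {u} i = subst (λ k → u ^ℤ k ≅ + 1 [ p ]) length-units-prime (euler p i)

  -- The index in the full unit group of the subgroup generated by u. This replaces a discrete
  -- logarithm to a primitive root.
  Index : ℤ → ℕ → Set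
  Index u d = ∃ λ e → p ∸ 1 ≡ e * d × Order p u e

  index-exists : ∀ {u} → Invertible u p → ∃ (Index u)
  index-exists {u} i = go (order-exists {p} {u} (p ∸ 1) 0<p-1 (fermat i))
    where
    go : ∃ (Order p u) → ∃ (Index u)
    go (e , o) = cofactor (Order.minimal o {p ∸ 1} (fermat i))
      where
      cofactor : e ∣ p ∸ 1 → ∃ (Index u)
      cofactor (divides d eq) = d , e , trans eq (ℕ.*-comm d e) , o

  Index-≅ : ∀ {u v d} → u ≅ v [ p ] → Index u d → Index v d
  Index-≅ c (e , eq , o) = e , eq , Order-≅ c o

  Index-positive : ∀ {u d} → Index u d → 0 < d
  Index-positive {d = zero} (e , eq , _) = contradiction (subst (0 <_) (trans eq (ℕ.*-zeroʳ e)) 0<p-1) (λ ())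
  Index-positive {d = suc d} _ = s≤s z≤n

  Index-divisor : ∀ {u d} → Index u d → d ∈ divisors (p ∸ 1)
  Index-divisor (e , eq , _) = ∈-divisors⁺ 0<p-1 (divides e eq)

  Index-unique : ∀ {u d d′} → Index u d → Index u d′ → d ≡ d′
  Index-unique {d = d} {d′} (e , eq , o) (e′ , eq′ , o′) with Order-unique o o′
  ... | refl = ℕ.*-cancelˡ-≡ d d′ e {{ℕ.>-nonZero (Order.positive o)}} (trans (sym eq) eq′)

  index? : ∀ {a} → Dec (p ∣ a) → ℕ
  index? (yes _) = 0
  index? (no n) = proj₁ (index-exists (non-multiple-invertible n))

  -- The value 0 marks the multiples of p.
  index : ℕ → ℕ
  index a = index? (p ∣? a)

  index-correct : ∀ {a} → Invertible (+ a) p → Index (+ a) (index a)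
  index-correct {a} i = go (p ∣? a)
    where
    go : (d : Dec (p ∣ a)) → Index (+ a) (index? d)
    go (yes d) = contradiction (0-≅ℕ d) (invertible-non-multiple i)
    go (no n) = proj₂ (index-exists (non-multiple-invertible n))

  index-multiple : ∀ {a} → p ∣ a → index a ≡ 0
  index-multiple {a} d = go (p ∣? a)
    where
    go : (d : Dec (p ∣ a)) → index? d ≡ 0
    go (yes _) = refl
    go (no n) = contradiction d n

  index-invertible : ∀ {a} → 0 < index a → Invertible (+ a) p
  index-invertible {a} h = go (p ∣? a)
    where
    go : Dec (p ∣ a) → Invertible (+ a) p
    go (yes d) = contradiction (subst (0 <_) (index-multiple d) h) (λ ())
    go (no n) = non-multiple-invertible n

  index-≅ : ∀ a b → + a ≅ + b [ p ] → index a ≡ index b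
  index-≅ a b c = go (p ∣? a)
    where
    go : Dec (p ∣ a) → index a ≡ index b
    go (yes d) = trans (index-multiple d) (sym (index-multiple (≅-0 (≅-trans (≅-sym c) (0-≅ℕ d)))))
    go (no n) = Index-unique (Index-≅ c (index-correct i)) (index-correct (invertible-≅ c i))
      where i = non-multiple-invertible n

  ofIndex : ℕ → List ℕ
  ofIndex d = filter (λ a → index a ℕ.≟ d) (units p)

  ∈-ofIndex : ∀ {a d} → a ∈ ofIndex d → a ∈ units p × Index (+ a) d
  ∈-ofIndex {a} {d} a∈ with ∈-filter⁻ (λ a → index a ℕ.≟ d) {xs = units p} a∈
  ... | h , refl = h , index-correct (proj₂ (∈-units⁻ h))

  private
    power : ℕ → ℕ → ℕ
    power a j = rem p ((+ a) ^ℤ j)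

    power-≅ : ∀ a j → + power a j ≅ (+ a) ^ℤ j [ p ]
    power-≅ a j = rem-≅ p ((+ a) ^ℤ j)

    power-injective : ∀ {a e i j} → Order p (+ a) e → i < j → j < e → ¬ + power a i ≅ + power a j [ p ]
    power-injective {a} {e} {i} {j} o i<j j<e h = ℕ.<⇒≢ (ℕ.m<n⇒0<n∸m i<j) (sym (small-multiple
      (ℕ.<-≤-trans (s≤s (ℕ.m∸n≤m j i)) j<e) (Order.minimal o {j ∸ i} (≅-sym (invertible-cancel {(+ a) ^ℤ i} inv (≅-trans (≅-reflexive (ℤ.*-identityʳ ((+ a) ^ℤ i)))
        (≅-trans (≅-sym (power-≅ a i)) (≅-trans h (≅-trans (power-≅ a j) (≅-reflexive split))))))))))
      where
      split : (+ a) ^ℤ j ≡ (+ a) ^ℤ i *ℤ (+ a) ^ℤ (j ∸ i)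
      split = trans (cong ((+ a) ^ℤ_) (sym (ℕ.m+[n∸m]≡n (ℕ.<⇒≤ i<j)))) (ℤ.^-distribˡ-+-* (+ a) i (j ∸ i))
      inv : Invertible ((+ a) ^ℤ i) p
      inv = (+ a) ^ℤ (e ∸ i) , ≅-trans (≅-reflexive (trans (sym (ℤ.^-distribˡ-+-* (+ a) i (e ∸ i)))
        (cong ((+ a) ^ℤ_) (ℕ.m+[n∸m]≡n (ℕ.<⇒≤ (ℕ.<-trans i<j j<e)))))) (Order.power o)

    -- By the root bound the powers of an element a of order e exhaust the e-th roots of unity,
    -- so every element of order e is a power of a with exponent prime to e.
    power-surjective : ∀ {a b e} → Order p (+ a) e → Order p (+ b) e → b < p → b ∈ map (power a) (units e)
    power-surjective {a} {b} {e} o o′ b<p = go (any? (λ j → + power a j ≅? + b [ p ]) (upTo e))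
      where
      powers = map (λ j → + power a j) (upTo e)
      powers-roots : All (λ r → r ^ℤ e ≅ + 1 [ p ]) powers
      powers-roots = AllP.map⁺ (All.universal (λ j → ≅-trans (≅-^ e (power-≅ a j)) (≅-trans
        (≅-reflexive (trans (ℤ.^-*-assoc (+ a) j e) (trans (cong ((+ a) ^ℤ_) (ℕ.*-comm j e)) (^-mul (+ a) e j))))
        (≅-trans (≅-^ j (Order.power o)) (≅-reflexive (1^ j))))) (upTo e))
      powers-distinct : AllPairs (λ r s → ¬ r ≅ s [ p ]) powers
      powers-distinct = AllPairsP.map⁺ (AllPairsP.applyUpTo⁺₁ id e (λ i<j j<e → power-injective {a} o i<j j<e))
      go : Dec (Any (λ j → + power a j ≅ + b [ p ]) (upTo e)) → b ∈ map (power a) (units e)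
      -- Were b not a power of a, then b and the e distinct powers of a would be e + 1 roots of x^e
      -- - 1.
      go (no n) = contradiction
        (unity-roots-bound pr e (Order.positive o) (+ b ∷ powers)
          (AllP.map⁺ (All.map (λ q h → q (≅-sym h)) (AllP.¬Any⇒All¬ (upTo e) n)) ∷ powers-distinct) (Order.power o′ ∷ powers-roots))
        (ℕ.<⇒≱ (s≤s (ℕ.≤-reflexive (sym (trans (LP.length-map _ (upTo e)) (LP.length-upTo e))))))
      go (yes h) with find h
      ... | j , j∈ , c = subst (_∈ map (power a) (units e)) (≅-small (rem-< p ((+ a) ^ℤ j)) b<p c)
        (∈-map⁺ (power a) (∈-units⁺ (∈-upTo⁻ j∈) (coprime⇒invertible j e prime-to)))
        where
        g = gcd j e
        -- Since (a^j)^(e/g) = (a^e)^(j/g) = 1, the order e of b = a^j divides e/g.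
        prime-to : g ≡ 1
        prime-to with G.gcd[m,n]∣m j e | G.gcd[m,n]∣n j e
        ... | divides j′ ej | divides e′ ee = scale e′ ee (Order.minimal o′ {e′} (≅-trans (≅-^ e′ (≅-trans (≅-sym c) (power-≅ a j)))
          (≅-trans (≅-reflexive (trans (ℤ.^-*-assoc (+ a) j e′) (cong ((+ a) ^ℤ_) exps))) (≅-trans (≅-reflexive (^-mul (+ a) e j′)) (≅-trans (≅-^ j′ (Order.power o)) (≅-reflexive (1^ j′)))))))
          where
          exps : j * e′ ≡ e * j′
          exps = trans (cong (_* e′) ej) (trans (ℕ.*-assoc j′ g e′) (trans (cong (j′ *_) (trans (ℕ.*-comm g e′) (sym ee))) (ℕ.*-comm j′ e)))
          scale : ∀ e′ → e ≡ e′ * g → e ∣ e′ → g ≡ 1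
          scale zero q _ = contradiction (subst (0 <_) q (Order.positive o)) (λ ())
          scale (suc e″) q d = ℕ.≤-antisym
            (ℕ.*-cancelˡ-≤ (suc e″) (ℕ.≤-trans (ℕ.≤-reflexive (sym q)) (ℕ.≤-trans (Dv.∣⇒≤ d) (ℕ.≤-reflexive (sym (ℕ.*-identityʳ (suc e″)))))))
            (ℕ.n≢0⇒n>0 (λ g0 → contradiction (subst (0 <_) (trans q (trans (cong (suc e″ *_) g0) (ℕ.*-zeroʳ (suc e″)))) (Order.positive o)) (λ ())))

    -- If some a has index d, every residue of index d has the same order e as a and is a power of a
    -- with exponent prime to e. If none has, the bound is trivial.
    ofIndex-≤ : ∀ {d} → d ∈ divisors (p ∸ 1) → length (ofIndex d) ≤ φ (div (p ∸ 1) d)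
    ofIndex-≤ {d} d∈ = go (ofIndex d) refl
      where
      go : ∀ xs → ofIndex d ≡ xs → length xs ≤ φ (div (p ∸ 1) d)
      go [] _ = z≤n
      go (a ∷ xs) eq = sz (∈-ofIndex (subst (a ∈_) (sym eq) (here refl)))
        where
        sz : a ∈ units p × Index (+ a) d → length (a ∷ xs) ≤ φ (div (p ∸ 1) d)
        sz (_ , e , pe , o) = ℕ.≤-trans
          (unique-length-≤ (subst Unique eq (U.filter⁺ (λ a → index a ℕ.≟ d) (units-unique p))) (λ {b} b∈ → mem (∈-ofIndex (subst (b ∈_) (sym eq) b∈))))
          (ℕ.≤-reflexive (trans (LP.length-map (power a) (units e)) (trans (sym (φ-units e))
            (cong φ (sym (trans (cong (λ z → div z d) pe) (div-* e (proj₂ (∈-divisors⁻ {p ∸ 1} d∈)))))))))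
          where
          mem : ∀ {b} → b ∈ units p × Index (+ b) d → b ∈ map (power a) (units e)
          mem {b} (b∈ , e′ , pe′ , o′) = power-surjective o (subst (Order p (+ b)) (ℕ.*-cancelʳ-≡ e′ e d {{ℕ.>-nonZero (proj₂ (∈-divisors⁻ {p ∸ 1} d∈))}} (trans (sym pe′) pe)) o′) (proj₁ (∈-units⁻ b∈))

  -- The residues of the various indices partition the p - 1 units, and the upper bounds φ((p -
  -- 1)/d) also add up to p - 1, so every bound is attained.
  length-ofIndex : ∀ {d} → d ∈ divisors (p ∸ 1) → + length (ofIndex d) ≡ + φ (div (p ∸ 1) d)
  length-ofIndex = ∑-≤-≡ (divisors (p ∸ 1)) (λ d∈ → ℤ.+≤+ (ofIndex-≤ d∈)) (begin
    ∑ (divisors (p ∸ 1)) (λ d → + length (ofIndex d)) ≡⟨ ∑-cong (divisors (p ∸ 1)) (λ {d} _ → sym (∑-length (ofIndex d))) ⟩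
    ∑ (divisors (p ∸ 1)) (λ d → ∑ (ofIndex d) (λ _ → + 1))
      ≡⟨ sym (∑-fibres ℕ._≟_ index (units p) (divisors (p ∸ 1)) (λ _ → + 1) (divisors-unique (p ∸ 1))
           (λ a∈ → Index-divisor (index-correct (proj₂ (∈-units⁻ a∈))))) ⟩
    ∑ (units p) (λ _ → + 1) ≡⟨ ∑-length (units p) ⟩
    + length (units p) ≡⟨ cong +_ length-units-prime ⟩
    + (p ∸ 1) ≡⟨ sym (∑-φ 0<p-1) ⟩
    ∑ (divisors (p ∸ 1)) (λ d → + φ (div (p ∸ 1) d)) ∎)
    where open ≡-Reasoning

  -- The sum may run over all residues: multiples of p have index value 0, which differs from the
  -- positive d.
  count-index : ∀ {d} → d ∈ divisors (p ∸ 1) → ∑ (upTo p) (λ a → ⟪ d ℕ.≟ index a ⟫) ≡ + φ (div (p ∸ 1) d)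
  count-index {d} d∈ = trans (∑-⟪⟫ (λ a → d ℕ.≟ index a) (upTo p))
    (trans (cong +_ (P.↭-length (unique⇒↭ (U.filter⁺ (λ a → d ℕ.≟ index a) (U.upTo⁺ p))
      (U.filter⁺ (λ a → index a ℕ.≟ d) (units-unique p)) to from))) (length-ofIndex d∈))
    where
    to : ∀ {a} → a ∈ filter (λ a → d ℕ.≟ index a) (upTo p) → a ∈ ofIndex d
    to {a} a∈ with ∈-filter⁻ (λ a → d ℕ.≟ index a) {xs = upTo p} a∈
    ... | h , e = ∈-filter⁺ (λ a → index a ℕ.≟ d) (∈-units⁺ (∈-upTo⁻ h)
      (index-invertible (subst (0 <_) e (proj₂ (∈-divisors⁻ {p ∸ 1} d∈))))) (sym e)
    from : ∀ {a} → a ∈ ofIndex d → a ∈ filter (λ a → d ℕ.≟ index a) (upTo p)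
    from {a} a∈ with ∈-filter⁻ (λ a → index a ℕ.≟ d) {xs = units p} a∈
    ... | h , e = ∈-filter⁺ (λ a → d ℕ.≟ index a) (∈-upTo⁺ (proj₁ (∈-units⁻ h))) (sym e)

-- Chinese remaindering of sums

Periodic : ℕ → (ℕ → ℤ) → Set
Periodic q g = ∀ x y → + x ≅ + y [ q ] → g x ≡ g y

∑-cartesian : ∀ {A B : Set} (xs : List A) (ys : List B) (f : A → ℤ) (g : B → ℤ) →
  ∑ (List.cartesianProduct xs ys) (λ (a , b) → f a *ℤ g b) ≡ ∑ xs f *ℤ ∑ ys g
∑-cartesian [] ys f g = sym (ℤ.*-zeroˡ (∑ ys g))
∑-cartesian (x ∷ xs) ys f g = begin
  ∑ (map (x ,_) ys ++ List.cartesianProduct xs ys) F ≡⟨ ∑-++ (map (x ,_) ys) (List.cartesianProduct xs ys) F ⟩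
  ∑ (map (x ,_) ys) F +ℤ ∑ (List.cartesianProduct xs ys) F
    ≡⟨ cong₂ _+ℤ_ (trans (∑-map (x ,_) ys F) (∑-*ˡ (f x) ys g)) (∑-cartesian xs ys f g) ⟩
  f x *ℤ ∑ ys g +ℤ ∑ xs f *ℤ ∑ ys g ≡⟨ sym (ℤ.*-distribʳ-+ (∑ ys g) (f x) (∑ xs f)) ⟩
  (f x +ℤ ∑ xs f) *ℤ ∑ ys g ∎
  where
  open ≡-Reasoning
  F = λ ((a , b) : _ × _) → f a *ℤ g b

length-cartesianProduct : ∀ {A B : Set} (xs : List A) (ys : List B) →
  length (List.cartesianProduct xs ys) ≡ length xs * length ys
length-cartesianProduct xs ys = ℤ.+-injective (trans (sym (∑-length (List.cartesianProduct xs ys)))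
  (trans (∑-cartesian xs ys (λ _ → + 1) (λ _ → + 1))
  (trans (cong₂ _*ℤ_ (∑-length xs) (∑-length ys)) (sym (ℤ.pos-* (length xs) (length ys))))))

-- By coprimality x is determined below a b by its two remainders, and there are exactly a b pairs
-- of remainders; so the sum may be taken over pairs.
∑-crt₂ : ∀ a b .{{_ : NonZero a}} .{{_ : NonZero b}} → Coprime a b → ∀ {g h} → Periodic a g → Periodic b h →
  ∑ (upTo (a * b)) (λ x → g x *ℤ h x) ≡ ∑ (upTo a) g *ℤ ∑ (upTo b) h
∑-crt₂ a b co {g} {h} pg ph = begin
  ∑ (upTo (a * b)) (λ x → g x *ℤ h x)
    ≡⟨ ∑-cong (upTo (a * b)) (λ {x} _ → cong₂ _*ℤ_ (pg x (x % a) (≅-sym (≅-% x a))) (ph x (x % b) (≅-sym (≅-% x b)))) ⟩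
  ∑ (upTo (a * b)) (λ x → F (split x)) ≡⟨ sym (∑-map split (upTo (a * b)) F) ⟩
  ∑ (map split (upTo (a * b))) F ≡⟨ ∑-↭ F perm ⟩
  ∑ (List.cartesianProduct (upTo a) (upTo b)) F ≡⟨ ∑-cartesian (upTo a) (upTo b) g h ⟩
  ∑ (upTo a) g *ℤ ∑ (upTo b) h ∎
  where
  open ≡-Reasoning
  F : ℕ × ℕ → ℤ
  F (i , j) = g i *ℤ h j
  split : ℕ → ℕ × ℕ
  split x = x % a , x % b
  inj : ∀ {x y} → x ∈ upTo (a * b) → y ∈ upTo (a * b) → split x ≡ split y → x ≡ y
  inj {x} {y} x∈ y∈ e = ≅-small (∈-upTo⁻ x∈) (∈-upTo⁻ y∈) (≅-coprime co
    (≅-trans (≅-sym (≅-% x a)) (≅-trans (≅-reflexive (cong (λ z → + proj₁ z) e)) (≅-% y a)))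
    (≅-trans (≅-sym (≅-% x b)) (≅-trans (≅-reflexive (cong (λ z → + proj₂ z) e)) (≅-% y b))))
  sub : ∀ {z} → z ∈ map split (upTo (a * b)) → z ∈ List.cartesianProduct (upTo a) (upTo b)
  sub z∈ with ∈-map⁻ split z∈
  ... | x , _ , refl = ∈-cartesianProduct⁺ (∈-upTo⁺ (DM.m%n<n x a)) (∈-upTo⁺ (DM.m%n<n x b))
  perm : map split (upTo (a * b)) ↭ List.cartesianProduct (upTo a) (upTo b)
  perm = length-≤⇒↭ (unique-map split inj (U.upTo⁺ (a * b))) sub (ℕ.≤-reflexive (trans
    (length-cartesianProduct (upTo a) (upTo b)) (trans (cong₂ _*_ (LP.length-upTo a) (LP.length-upTo b))
    (sym (trans (LP.length-map split (upTo (a * b))) (LP.length-upTo (a * b)))))))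

prodF-suc : ∀ l (f : Fin (suc l) → ℕ) → prodF (suc l) f ≡ f Fin.zero * prodF l (f ∘ Fin.suc)
prodF-suc l f = trans (cong (λ xs → foldr _*_ 1 (map f xs)) (allFin-suc l))
  (cong (λ xs → f Fin.zero * foldr _*_ 1 xs) (sym (LP.map-∘ (allFin l))))

coprime-*ʳ : ∀ {a b c} → Coprime a b → Coprime a c → Coprime a (b * c)
coprime-*ʳ {a} {b} {c} ab ac {d} (d∣a , d∣bc) = ac (d∣a , C.coprime-divisor {d} {b} {c}
  (λ (e∣d , e∣b) → ab (Dv.∣-trans e∣d d∣a , e∣b)) d∣bc)

coprime-prodF : ∀ l {a} (q : Fin l → ℕ) → (∀ i → Coprime a (q i)) → Coprime a (prodF l q)
coprime-prodF zero q h (_ , d∣1) = Dv.∣1⇒≡1 d∣1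
coprime-prodF (suc l) {a} q h = subst (Coprime a) (sym (prodF-suc l q))
  (coprime-*ʳ (h Fin.zero) (coprime-prodF l (q ∘ Fin.suc) (h ∘ Fin.suc)))

PairwiseCoprime : ∀ {l} → (Fin l → ℕ) → Set
PairwiseCoprime q = ∀ i j → i ≢ j → Coprime (q i) (q j)

pairwise-tail : ∀ {l} {q : Fin (suc l) → ℕ} → PairwiseCoprime q → PairwiseCoprime (q ∘ Fin.suc)
pairwise-tail h i j n = h (Fin.suc i) (Fin.suc j) (n ∘ F.suc-injective)

prodF-nonZero : ∀ l (q : Fin l → ℕ) → (∀ i → NonZero (q i)) → NonZero (prodF l q)
prodF-nonZero zero q h = _
prodF-nonZero (suc l) q h = subst NonZero (sym (prodF-suc l q))
  (ℕ.m*n≢0 (q Fin.zero) _ {{h Fin.zero}} {{prodF-nonZero l (q ∘ Fin.suc) (h ∘ Fin.suc)}})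

factor-∣-prodF : ∀ l (q : Fin l → ℕ) i → q i ∣ prodF l q
factor-∣-prodF (suc l) q Fin.zero = subst (q Fin.zero ∣_) (sym (prodF-suc l q)) (Dv.m∣m*n _)
factor-∣-prodF (suc l) q (Fin.suc i) = subst (q (Fin.suc i) ∣_) (sym (prodF-suc l q))
  (Dv.∣-trans (factor-∣-prodF l (q ∘ Fin.suc) i) (Dv.n∣m*n (q Fin.zero)))

≅-prodF : ∀ l (q : Fin l → ℕ) → PairwiseCoprime q → ∀ {x y} → (∀ i → x ≅ y [ q i ]) → x ≅ y [ prodF l q ]
≅-prodF zero q co {x} {y} h = -0⇒≅ (0-≅ {x = x -ℤ y} (Dv.1∣ _))
≅-prodF (suc l) q co {x} {y} h = subst (x ≅ y [_]) (sym (prodF-suc l q)) (≅-coprime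
  (coprime-prodF l (q ∘ Fin.suc) (λ i → co Fin.zero (Fin.suc i) λ ()))
  (h Fin.zero) (≅-prodF l (q ∘ Fin.suc) (pairwise-tail co) (h ∘ Fin.suc)))

-- Counts residues modulo n by local conditions. It is applied to the elements of a given type and
-- to the units with given indices.
∑-crt : ∀ l (q : Fin l → ℕ) → (∀ i → NonZero (q i)) → PairwiseCoprime q →
  (g : Fin l → ℕ → ℤ) → (∀ i → Periodic (q i) (g i)) →
  ∑ (upTo (prodF l q)) (λ x → ∏ (allFin l) (λ i → g i x)) ≡ ∏ (allFin l) (λ i → ∑ (upTo (q i)) (g i))
∑-crt zero q nz co g pg = refl
∑-crt (suc l) q nz co g pg = begin
  ∑ (upTo (prodF (suc l) q)) (λ x → ∏ (allFin (suc l)) (λ i → g i x))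
    ≡⟨ cong (λ n → ∑ (upTo n) (λ x → ∏ (allFin (suc l)) (λ i → g i x))) (prodF-suc l q) ⟩
  ∑ (upTo (q Fin.zero * prodF l q′)) (λ x → ∏ (allFin (suc l)) (λ i → g i x))
    ≡⟨ ∑-cong (upTo (q Fin.zero * prodF l q′)) (λ {x} _ → ∏-allFin (λ i → g i x)) ⟩
  ∑ (upTo (q Fin.zero * prodF l q′)) (λ x → g Fin.zero x *ℤ h x)
    ≡⟨ ∑-crt₂ (q Fin.zero) (prodF l q′) {{nz Fin.zero}} {{prodF-nonZero l q′ (nz ∘ Fin.suc)}}
         (coprime-prodF l q′ (λ i → co Fin.zero (Fin.suc i) λ ())) (pg Fin.zero) ph ⟩
  ∑ (upTo (q Fin.zero)) (g Fin.zero) *ℤ ∑ (upTo (prodF l q′)) h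
    ≡⟨ cong (∑ (upTo (q Fin.zero)) (g Fin.zero) *ℤ_) (∑-crt l q′ (nz ∘ Fin.suc) (pairwise-tail co) (g ∘ Fin.suc) (pg ∘ Fin.suc)) ⟩
  ∑ (upTo (q Fin.zero)) (g Fin.zero) *ℤ ∏ (allFin l) (λ i → ∑ (upTo (q′ i)) (g (Fin.suc i)))
    ≡⟨ sym (∏-allFin (λ i → ∑ (upTo (q i)) (g i))) ⟩
  ∏ (allFin (suc l)) (λ i → ∑ (upTo (q i)) (g i)) ∎
  where
  open ≡-Reasoning
  q′ = q ∘ Fin.suc
  h : ℕ → ℤ
  h x = ∏ (allFin l) (λ i → g (Fin.suc i) x)
  ph : Periodic (prodF l q′) h
  ph x y c = ∏-cong (allFin l) (λ {i} _ → pg (Fin.suc i) x y (≅-weaken (factor-∣-prodF l q′ i) c))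

∑-tuples : ∀ l (L : Fin l → List ℕ) (g : Fin l → ℕ → ℤ) →
  ∑ (tuples l L) (λ d → ∏ (allFin l) (λ i → g i (d i))) ≡ ∏ (allFin l) (λ i → ∑ (L i) (g i))
∑-tuples zero L g = refl
∑-tuples (suc l) L g = begin
  ∑ (tuples (suc l) L) G ≡⟨ ∑-concatMap _ (L Fin.zero) G ⟩
  ∑ (L Fin.zero) _ ≡⟨ ∑-cong (L Fin.zero) (λ {a} _ → fibre a _ (λ _ → refl) (λ _ _ → refl)) ⟩
  ∑ (L Fin.zero) (λ a → g Fin.zero a *ℤ ∏ (allFin l) (λ i → ∑ (L (Fin.suc i)) (g (Fin.suc i))))
    ≡⟨ ∑-*ʳ (L Fin.zero) (g Fin.zero) _ ⟩
  ∑ (L Fin.zero) (g Fin.zero) *ℤ ∏ (allFin l) (λ i → ∑ (L (Fin.suc i)) (g (Fin.suc i)))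
    ≡⟨ sym (∏-allFin (λ i → ∑ (L i) (g i))) ⟩
  ∏ (allFin (suc l)) (λ i → ∑ (L i) (g i)) ∎
  where
  open ≡-Reasoning
  G : (Fin (suc l) → ℕ) → ℤ
  G d = ∏ (allFin (suc l)) (λ i → g i (d i))
  ts = tuples l (L ∘ Fin.suc)
  -- `tuples` prepends entries by a function local to it; here c stands for that function, known
  -- only through its two defining equations.
  fibre : ∀ a (c : (Fin l → ℕ) → Fin (suc l) → ℕ) → (∀ t → c t Fin.zero ≡ a) → (∀ t i → c t (Fin.suc i) ≡ t i) →
    ∑ (map c ts) G ≡ g Fin.zero a *ℤ ∏ (allFin l) (λ i → ∑ (L (Fin.suc i)) (g (Fin.suc i)))
  fibre a c c0 cs = begin
    ∑ (map c ts) G ≡⟨ ∑-map c ts G ⟩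
    ∑ ts (λ t → G (c t)) ≡⟨ ∑-cong ts (λ {t} _ → trans (∏-allFin (λ i → g i (c t i)))
      (cong₂ _*ℤ_ (cong (g Fin.zero) (c0 t)) (∏-cong (allFin l) (λ {i} _ → cong (g (Fin.suc i)) (cs t i))))) ⟩
    ∑ ts (λ t → g Fin.zero a *ℤ ∏ (allFin l) (λ i → g (Fin.suc i) (t i)))
      ≡⟨ ∑-*ˡ (g Fin.zero a) ts (λ t → ∏ (allFin l) (λ i → g (Fin.suc i) (t i))) ⟩
    g Fin.zero a *ℤ ∑ ts (λ t → ∏ (allFin l) (λ i → g (Fin.suc i) (t i)))
      ≡⟨ cong (g Fin.zero a *ℤ_) (∑-tuples l (L ∘ Fin.suc) (g ∘ Fin.suc)) ⟩
    g Fin.zero a *ℤ ∏ (allFin l) (λ i → ∑ (L (Fin.suc i)) (g (Fin.suc i))) ∎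

∈-tuples : ∀ l (L : Fin l → List ℕ) {d} → d ∈ tuples l L → ∀ i → d i ∈ L i
∈-tuples (suc l) L {d} d∈ i with find (∈-concatMap⁻ _ {xs = L Fin.zero} d∈)
... | a , a∈ , d∈′ with ∈-map⁻ _ d∈′
∈-tuples (suc l) L d∈ Fin.zero | a , a∈ , d∈′ | t , t∈ , refl = a∈
∈-tuples (suc l) L d∈ (Fin.suc i) | a , a∈ , d∈′ | t , t∈ , refl = ∈-tuples l (L ∘ Fin.suc) t∈ i

-- Unions of equivalence classes, counted by size

pmul-psum : ∀ {A : Set} (f : A → Poly) (xs : List A) r → pmul (psum (map f xs)) r ≈ₚ psum (map (λ x → pmul (f x) r) xs)
pmul-psum f [] r = ≈ₚ-refl
pmul-psum f (x ∷ xs) r = ≈ₚ-trans (pmul-distribʳ r (f x) (psum (map f xs))) (padd-cong (≈ₚ-refl {pmul (f x) r}) (pmul-psum f xs r))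

does-true : {P : Set} (P? : Dec P) → does P? ≡ true → P
does-true (yes p) _ = p

does-false : {P : Set} (P? : Dec P) → does P? ≡ false → ¬ P
does-false (no n) _ = n

bool-cong : ∀ {a b : Bool} → (a ≡ true → b ≡ true) → (b ≡ true → a ≡ true) → a ≡ b
bool-cong {true} {true} f g = refl
bool-cong {true} {false} f g = sym (f refl)
bool-cong {false} {true} f g = g refl
bool-cong {false} {false} f g = refl

module ClosedSets {n : ℕ} (R : Fin n → Fin n → Set) (R? : ∀ x y → Dec (R x y)) (R-refl : ∀ {x} → R x x)
  (R-sym : ∀ {x y} → R x y → R y x) (R-trans : ∀ {x y z} → R x y → R y z → R x z) where

  open Transversal R R? R-refl R-sym R-trans (allFin n) public

  Closed : Subset n → Set
  Closed B = ∀ {x y} → R x y → lookup B x ≡ true → lookup B y ≡ true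

  abstract
    class : Fin n → Subset n
    class r = tabulate (λ x → does (R? r x))

    lookup-class : ∀ r x → lookup (class r) x ≡ does (R? r x)
    lookup-class r x = V.lookup∘tabulate (λ x → does (R? r x)) x

    join : Fin n → Subset n → Subset n
    join r B = tabulate (λ x → lookup B x ∨ does (R? r x))

    lookup-join : ∀ r B x → lookup (join r B) x ≡ lookup B x ∨ does (R? r x)
    lookup-join r B x = V.lookup∘tabulate (λ x → lookup B x ∨ does (R? r x)) x

    remove : Fin n → Subset n → Subset n
    remove r B = tabulate (λ x → lookup B x ∧ not (does (R? r x)))

    lookup-remove : ∀ r B x → lookup (remove r B) x ≡ lookup B x ∧ not (does (R? r x))
    lookup-remove r B x = V.lookup∘tabulate (λ x → lookup B x ∧ not (does (R? r x))) x

  join⁺ˡ : ∀ r B {x} → lookup B x ≡ true → lookup (join r B) x ≡ true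
  join⁺ˡ r B {x} h = trans (lookup-join r B x) (cong (_∨ does (R? r x)) h)

  join⁺ʳ : ∀ r B {x} → R r x → lookup (join r B) x ≡ true
  join⁺ʳ r B {x} h = trans (lookup-join r B x) (lem (lookup B x) (dec-true (R? r x) h))
    where
    lem : ∀ b {c} → c ≡ true → b ∨ c ≡ true
    lem true _ = refl
    lem false e = e

  join⁻ : ∀ r B {x} → lookup (join r B) x ≡ true → lookup B x ≡ true ⊎ R r x
  join⁻ r B {x} h = lem (lookup B x) refl (trans (sym (lookup-join r B x)) h)
    where
    lem : ∀ b → lookup B x ≡ b → b ∨ does (R? r x) ≡ true → lookup B x ≡ true ⊎ R r x
    lem true e _ = inj₁ e
    lem false _ e = inj₂ (does-true (R? r x) e)

  remove⁺ : ∀ r B {x} → lookup B x ≡ true → ¬ R r x → lookup (remove r B) x ≡ true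
  remove⁺ r B {x} h n = trans (lookup-remove r B x) (cong₂ (λ a b → a ∧ not b) h (dec-false (R? r x) n))

  remove⁻ : ∀ r B {x} → lookup (remove r B) x ≡ true → lookup B x ≡ true × ¬ R r x
  remove⁻ r B {x} h = lem (lookup B x) (does (R? r x)) refl refl (trans (sym (lookup-remove r B x)) h)
    where
    lem : ∀ a b → lookup B x ≡ a → does (R? r x) ≡ b → a ∧ not b ≡ true → lookup B x ≡ true × ¬ R r x
    lem true false e f _ = e , does-false (R? r x) f

  -- The unions of classes of the listed representatives, each class being left out or joined in
  -- turn. The recursion mirrors the expansion of a product of binomials.
  enum : List (Fin n) → List (Subset n)
  enum [] = Vec.replicate n false ∷ []
  enum (r ∷ rs) = enum rs ++ map (join r) (enum rs)

  Covered : List (Fin n) → Subset n → Set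
  Covered rs B = ∀ {x} → lookup B x ≡ true → Any (λ r → R r x) rs

  enum-sound : ∀ rs {B} → B ∈ enum rs → Closed B × Covered rs B
  enum-sound [] (here refl) = (λ {x} _ h → contradiction (trans (sym (V.lookup-replicate x false)) h) λ ())
                            , (λ {x} h → contradiction (trans (sym (V.lookup-replicate x false)) h) λ ())
  enum-sound (r ∷ rs) {B} B∈ = go (∈-++⁻ (enum rs) B∈)
    where
    go : B ∈ enum rs ⊎ B ∈ map (join r) (enum rs) → Closed B × Covered (r ∷ rs) B
    go (inj₁ h) with enum-sound rs h
    ... | cl , co = cl , there ∘ co
    go (inj₂ h) with ∈-map⁻ (join r) h
    ... | B′ , B′∈ , refl with enum-sound rs B′∈
    ... | cl , co = cl′ , co′
      where
      cl′ : Closed (join r B′)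
      cl′ {x} {y} xy h with join⁻ r B′ h
      ... | inj₁ b = join⁺ˡ r B′ (cl xy b)
      ... | inj₂ c = join⁺ʳ r B′ (R-trans c xy)
      co′ : Covered (r ∷ rs) (join r B′)
      co′ h with join⁻ r B′ h
      ... | inj₁ b = there (co b)
      ... | inj₂ c = here c

  -- A closed set containing r contains the whole class of r; this class is removed, the rest found
  -- in the enumeration for the other representatives, and the class joined again.
  enum-complete : ∀ rs B → Closed B → Covered rs B → B ∈ enum rs
  enum-complete [] B cl co = here (lookup-ext λ x → bool-cong (λ h → contradiction (co h) λ ())
    (λ h → contradiction (trans (sym (V.lookup-replicate x false)) h) λ ()))
  enum-complete (r ∷ rs) B cl co = go (lookup B r) refl
    where
    tail-cover : ∀ {x} → ¬ R r x → Any (λ r → R r x) (r ∷ rs) → Any (λ r → R r x) rs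
    tail-cover n (here h) = contradiction h n
    tail-cover n (there h) = h
    go : ∀ b → lookup B r ≡ b → B ∈ enum (r ∷ rs)
    go false e = ∈-++⁺ˡ (enum-complete rs B cl λ h → tail-cover
      (λ rx → contradiction (trans (sym e) (cl (R-sym rx) h)) λ ()) (co h))
    go true e = ∈-++⁺ʳ (enum rs) (subst (_∈ map (join r) (enum rs)) (sym rebuild) (∈-map⁺ (join r)
      (enum-complete rs (remove r B)
        (λ xy h → let (b , nr) = remove⁻ r B h in remove⁺ r B (cl xy b) (λ ry → nr (R-trans ry (R-sym xy))))
        (λ h → let (b , nr) = remove⁻ r B h in tail-cover nr (co b)))))
      where
      rebuild : B ≡ join r (remove r B)
      rebuild = lookup-ext λ x → bool-cong (fwd x) (bwd x)
        where
        fwd : ∀ x → lookup B x ≡ true → lookup (join r (remove r B)) x ≡ true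
        fwd x h with R? r x
        ... | yes c = join⁺ʳ r (remove r B) c
        ... | no c = join⁺ˡ r (remove r B) (remove⁺ r B h c)
        bwd : ∀ x → lookup (join r (remove r B)) x ≡ true → lookup B x ≡ true
        bwd x h with join⁻ r (remove r B) h
        ... | inj₁ b = proj₁ (remove⁻ r B b)
        ... | inj₂ c = cl c e

  Separated : List (Fin n) → Set
  Separated = AllPairs (λ x y → ¬ R x y)

  avoids : ∀ {r rs B} → Separated (r ∷ rs) → B ∈ enum rs → ∀ {x} → R r x → lookup B x ≡ false
  avoids {r} {rs} {B} (a ∷ _) B∈ {x} rx = go (lookup B x) refl
    where
    go : ∀ b → lookup B x ≡ b → b ≡ false
    go false _ = refl
    go true e with find (proj₂ (enum-sound rs B∈) e)
    ... | s , s∈ , sx = contradiction (R-trans rx (R-sym sx)) (All.lookup a s∈)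

  -- Only the joined sets contain r, and joining is injective because sets in the shorter
  -- enumeration avoid the class of r.
  enum-unique : ∀ rs → Separated rs → Unique (enum rs)
  enum-unique [] _ = [] ∷ []
  enum-unique (r ∷ rs) sep@(a ∷ s) = U.++⁺ (enum-unique rs s) (unique-map (join r) inj (enum-unique rs s)) disj
    where
    disj : ∀ {B} → B ∈ enum rs × B ∈ map (join r) (enum rs) → ⊥
    disj (B∈ , B∈′) with ∈-map⁻ (join r) B∈′
    ... | B′ , _ , refl = contradiction (trans (sym (join⁺ʳ r B′ R-refl)) (avoids sep B∈ R-refl)) λ ()
    half : ∀ {B B′} → B ∈ enum rs → join r B ≡ join r B′ → ∀ x → lookup B x ≡ true → lookup B′ x ≡ true
    half {B} {B′} B∈ e x h with join⁻ r B′ (trans (cong (λ A → lookup A x) (sym e)) (join⁺ˡ r B h))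
    ... | inj₁ b = b
    ... | inj₂ c = contradiction (trans (sym h) (avoids sep B∈ c)) λ ()
    inj : ∀ {B B′} → B ∈ enum rs → B′ ∈ enum rs → join r B ≡ join r B′ → B ≡ B′
    inj B∈ B′∈ e = lookup-ext λ x → bool-cong (half B∈ e x) (half B′∈ (sym e) x)

  size-join : ∀ {r rs B} → Separated (r ∷ rs) → B ∈ enum rs → ∣ join r B ∣ ≡ ∣ class r ∣ + ∣ B ∣
  size-join {r} {rs} {B} sep B∈ = ℤ.+-injective (begin
    + ∣ join r B ∣ ≡⟨ ∣∣-count (join r B) ⟩
    count (allFin n) (join r B) ≡⟨ ∑-cong (allFin n) (λ {x} _ → pointwise x) ⟩
    ∑ (allFin n) (λ x → ⟪ lookup (class r) x B.≟ true ⟫ +ℤ ⟪ lookup B x B.≟ true ⟫) ≡⟨ ∑-+ (allFin n) _ _ ⟩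
    count (allFin n) (class r) +ℤ count (allFin n) B ≡⟨ cong₂ _+ℤ_ (sym (∣∣-count (class r))) (sym (∣∣-count B)) ⟩
    + ∣ class r ∣ +ℤ + ∣ B ∣ ≡⟨ sym (ℤ.pos-+ ∣ class r ∣ ∣ B ∣) ⟩
    + (∣ class r ∣ + ∣ B ∣) ∎)
    where
    open ≡-Reasoning
    lem : ∀ a b → (b ≡ true → a ≡ false) → ⟪ (a ∨ b) B.≟ true ⟫ ≡ ⟪ b B.≟ true ⟫ +ℤ ⟪ a B.≟ true ⟫
    lem true true h = contradiction (h refl) λ ()
    lem true false h = refl
    lem false true h = refl
    lem false false h = refl
    pointwise : ∀ x → ⟪ lookup (join r B) x B.≟ true ⟫ ≡ ⟪ lookup (class r) x B.≟ true ⟫ +ℤ ⟪ lookup B x B.≟ true ⟫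
    pointwise x = trans (cong (λ b → ⟪ b B.≟ true ⟫) (lookup-join r B x)) (trans
      (lem (lookup B x) (does (R? r x)) (λ c → avoids sep B∈ (does-true (R? r x) c)))
      (cong (λ c → ⟪ c B.≟ true ⟫ +ℤ ⟪ lookup B x B.≟ true ⟫) (sym (lookup-class r x))))

  binomial : Fin n → Poly
  binomial r = padd pone (xpow ∣ class r ∣)

  -- The class of r is disjoint from the sets enumerated before it is joined, so joining it adds its
  -- size and contributes the factor 1 + x^s with s that size.
  enum-genfun : ∀ rs → Separated rs → psum (map (λ B → xpow ∣ B ∣) (enum rs)) ≈ₚ ∏ₚ rs binomial
  enum-genfun [] _ = mk λ k → trans (coeff-psum k (λ B → xpow ∣ B ∣) (enum []))
    (trans (ℤ.+-identityʳ _) (cong (λ j → coeff k (xpow j)) ∣empty∣))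
    where
    ∣empty∣ : ∣ Vec.replicate n false ∣ ≡ 0
    ∣empty∣ = ℤ.+-injective (trans (∣∣-count (Vec.replicate n false)) (∑-0 (allFin n) (λ {x} _ →
      cong (λ b → ⟪ b B.≟ true ⟫) (V.lookup-replicate x false))))
  enum-genfun (r ∷ rs) sep@(_ ∷ s) = ≈ₚ-trans (mk split) (≈ₚ-trans
    (≈ₚ-sym (pmul-distribʳ G pone (xpow ∣ class r ∣)))
    (pmul-congʳ (binomial r) (enum-genfun rs s)))
    where
    G = psum (map (λ B → xpow ∣ B ∣) (enum rs))
    open ≡-Reasoning
    split : ∀ k → coeff k (psum (map (λ B → xpow ∣ B ∣) (enum (r ∷ rs)))) ≡ coeff k (padd (pmul pone G) (pmul (xpow ∣ class r ∣) G))
    split k = begin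
      coeff k (psum (map (λ B → xpow ∣ B ∣) (enum (r ∷ rs)))) ≡⟨ coeff-psum k (λ B → xpow ∣ B ∣) (enum (r ∷ rs)) ⟩
      ∑ (enum rs ++ map (join r) (enum rs)) f ≡⟨ ∑-++ (enum rs) (map (join r) (enum rs)) f ⟩
      ∑ (enum rs) f +ℤ ∑ (map (join r) (enum rs)) f
        ≡⟨ cong₂ _+ℤ_ (trans (sym (coeff-psum k (λ B → xpow ∣ B ∣) (enum rs))) (sym (at (pmul-identityˡ G) k)))
             (trans (∑-map (join r) (enum rs) f) (trans (∑-cong (enum rs) shifted)
             (trans (sym (coeff-psum k (λ B → pmul (xpow ∣ B ∣) (xpow ∣ class r ∣)) (enum rs)))
             (trans (sym (at (pmul-psum (λ B → xpow ∣ B ∣) (enum rs) (xpow ∣ class r ∣)) k)) (at (pmul-comm G (xpow ∣ class r ∣)) k))))) ⟩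
      coeff k (pmul pone G) +ℤ coeff k (pmul (xpow ∣ class r ∣) G) ≡⟨ sym (coeff-padd k (pmul pone G) _) ⟩
      coeff k (padd (pmul pone G) (pmul (xpow ∣ class r ∣) G)) ∎
      where
      f : Subset n → ℤ
      f B = coeff k (xpow ∣ B ∣)
      shifted : ∀ {B} → B ∈ enum rs → f (join r B) ≡ coeff k (pmul (xpow ∣ B ∣) (xpow ∣ class r ∣))
      shifted {B} B∈ = trans (cong (λ j → coeff k (xpow j)) (trans (size-join sep B∈) (ℕ.+-comm ∣ class r ∣ ∣ B ∣)))
        (sym (at (pmul-xpow ∣ B ∣ ∣ class r ∣) k))

  -- Since S is itself a union of classes, a closed set inside S amounts to a choice among the
  -- representatives that satisfy S. The list `Bs` is any enumeration of these sets without
  -- repetition.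
  closed-genfun : {S : Fin n → Set} (S? : ∀ x → Dec (S x)) → (∀ {x y} → R x y → S x → S y) →
    (Bs : List (Subset n)) → Unique Bs → (∀ {B} → B ∈ Bs → Closed B × (∀ {x} → lookup B x ≡ true → S x)) →
    (∀ {B} → Closed B → (∀ {x} → lookup B x ≡ true → S x) → B ∈ Bs) →
    ∀ k → ∑ Bs (λ B → ⟪ ∣ B ∣ ℕ.≟ k ⟫) ≡ coeff k (∏ₚ (filter S? reps) binomial)
  closed-genfun {S} S? S-resp Bs uBs to from k = begin
    ∑ Bs (λ B → ⟪ ∣ B ∣ ℕ.≟ k ⟫) ≡⟨ ∑-↭ (λ B → ⟪ ∣ B ∣ ℕ.≟ k ⟫) (unique⇒↭ uBs (enum-unique rs sep) fwd bwd) ⟩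
    ∑ (enum rs) (λ B → ⟪ ∣ B ∣ ℕ.≟ k ⟫) ≡⟨ ∑-cong (enum rs) (λ {B} _ → sym (coeff-xpow k ∣ B ∣)) ⟩
    ∑ (enum rs) (λ B → coeff k (xpow ∣ B ∣)) ≡⟨ sym (coeff-psum k (λ B → xpow ∣ B ∣) (enum rs)) ⟩
    coeff k (psum (map (λ B → xpow ∣ B ∣) (enum rs))) ≡⟨ at (enum-genfun rs sep) k ⟩
    coeff k (∏ₚ rs binomial) ∎
    where
    open ≡-Reasoning
    rs = filter S? reps
    sep : Separated rs
    sep = AllPairsP.filter⁺ S? (deduplicate-≁ R? (allFin n))
    cover : ∀ {x} → S x → Any (λ r → R r x) rs
    cover {x} sx with find (rep-exists (∈-allFin x))
    ... | r , r∈ , xr = Any.map (λ { refl → R-sym xr }) (∈-filter⁺ S? r∈ (S-resp xr sx))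
    fwd : ∀ {B} → B ∈ Bs → B ∈ enum rs
    fwd {B} B∈ = enum-complete rs B (proj₁ (to B∈)) (λ h → cover (proj₂ (to B∈) h))
    bwd : ∀ {B} → B ∈ enum rs → B ∈ Bs
    bwd {B} B∈ = from (proj₁ (enum-sound rs B∈)) λ h → supp (proj₂ (enum-sound rs B∈) h)
      where
      supp : ∀ {x} → Any (λ r → R r x) rs → S x
      supp a with find a
      ... | r , r∈ , rx = S-resp rx (proj₂ (∈-filter⁻ S? {xs = reps} r∈))

-- Orbits of the group generated by u and -1

sign : Bool → ℤ
sign false = + 1
sign true = - + 1

sign-square : ∀ s → sign s *ℤ sign s ≡ + 1
sign-square false = refl
sign-square true = refl

sign-* : ∀ s t → ∃ λ r → sign s *ℤ sign t ≡ sign r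
sign-* false false = false , refl
sign-* false true = true , refl
sign-* true false = true , refl
sign-* true true = false , refl

inter-* : ∀ a b c d → (a *ℤ b) *ℤ (c *ℤ d) ≡ (a *ℤ c) *ℤ (b *ℤ d)
inter-* = solve-∀

module SignedPowers {m : ℕ} (u : ℤ) (u-inv : Invertible u (suc m)) where

  private
    N = suc m

  period : ℕ
  period = length (units N)

  instance
    period≢0 : NonZero period
    period≢0 = ℕ.>-nonZero (units-nonempty N)

  u^period : u ^ℤ period ≅ + 1 [ N ]
  u^period = euler N u-inv

  multiplier : Bool → ℕ → ℤ
  multiplier s j = sign s *ℤ u ^ℤ j

  -- Exponents are confined to one period of u, supplied by Euler's theorem, which makes the
  -- relation decidable; `related-intro` accepts every exponent.
  record Related (x y : Fin (suc m)) : Set where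
    constructor related
    field
      witness : Any (λ s → Any (λ j → multiplier s j • x ≡ y) (upTo period)) (false ∷ true ∷ [])

  related? : ∀ x y → Dec (Related x y)
  related? x y = map′ related Related.witness
    (any? (λ s → any? (λ j → multiplier s j • x F.≟ y) (upTo period)) (false ∷ true ∷ []))

  power-mod : ∀ j → u ^ℤ (j % period) ≅ u ^ℤ j [ N ]
  power-mod j = ≅-sym (≅-trans (≅-reflexive (trans (cong (u ^ℤ_) (DM.m≡m%n+[m/n]*n j period)) (ℤ.^-distribˡ-+-* u (j % period) (j / period * period))))
    (≅-trans (≅-*ˡ (u ^ℤ (j % period)) (^-multiple {u} {e = period} u^period (divides (j / period) refl))) (≅-reflexive (ℤ.*-identityʳ (u ^ℤ (j % period))))))

  related-intro : ∀ {x y} s j → multiplier s j • x ≡ y → Related x y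
  related-intro {x} {y} s j e = related (Any.map (λ { refl → Any.map (λ { refl → trans (•-cong x (≅-*ˡ (sign s) (power-mod j))) e })
    (∈-upTo⁺ (DM.m%n<n j period)) }) (s∈ s))
    where
    s∈ : ∀ s → s ∈ (false ∷ true ∷ [])
    s∈ false = here refl
    s∈ true = there (here refl)

  related-elim : ∀ {x y} → Related x y → ∃ λ s → ∃ λ j → multiplier s j • x ≡ y
  related-elim (related w) with find w
  ... | s , _ , w′ with find w′
  ... | j , _ , e = s , j , e

  related-refl : ∀ {x} → Related x x
  related-refl {x} = related-intro false 0 (1-• x)

  -- Added to j this gives a multiple of the period, so inverses stay among the powers with natural
  -- exponents.
  inverse-exponent : ℕ → ℕ
  inverse-exponent j = j * (period ∸ 1)

  inverse-power : ∀ j → u ^ℤ j *ℤ u ^ℤ inverse-exponent j ≅ + 1 [ N ]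
  inverse-power j = ≅-trans (≅-reflexive (sym (ℤ.^-distribˡ-+-* u j (inverse-exponent j))))
    (^-multiple {u} {e = period} u^period (divides j (trans (sym (ℕ.*-suc j (period ∸ 1))) (cong (j *_) (ℕ.suc-pred period)))))

  multiplier-inverse : ∀ s j → multiplier s (inverse-exponent j) *ℤ multiplier s j ≅ + 1 [ N ]
  multiplier-inverse s j = ≅-trans (≅-reflexive (trans (inter-* (sign s) (u ^ℤ inverse-exponent j) (sign s) (u ^ℤ j))
    (cong₂ _*ℤ_ (sign-square s) (ℤ.*-comm (u ^ℤ inverse-exponent j) (u ^ℤ j)))))
    (≅-trans (≅-reflexive (ℤ.*-identityˡ (u ^ℤ j *ℤ u ^ℤ inverse-exponent j))) (inverse-power j))

  related-sym : ∀ {x y} → Related x y → Related y x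
  related-sym {x} {y} r with related-elim r
  ... | s , j , e = related-intro s (inverse-exponent j)
    (sym (•-assoc-≅ (multiplier s (inverse-exponent j)) (multiplier s j) y x (multiplier-inverse s j) (sym e)))

  related-trans : ∀ {x y z} → Related x y → Related y z → Related x z
  related-trans {x} {y} {z} r r′ with related-elim r | related-elim r′
  ... | s , j , e | t , k , e′ with sign-* t s
  ... | v , ev = related-intro v (k + j) (trans (•-cong x (≅-reflexive (sym product)))
    (trans (sym (•-• (multiplier t k) (multiplier s j) x)) (trans (cong (multiplier t k •_) e) e′)))
    where
    product : multiplier t k *ℤ multiplier s j ≡ multiplier v (k + j)
    product = trans (inter-* (sign t) (u ^ℤ k) (sign s) (u ^ℤ j)) (cong₂ _*ℤ_ ev (sym (ℤ.^-distribˡ-+-* u k j)))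

  open ClosedSets Related related? related-refl related-sym related-trans public

  -- Here L is the length of the orbit of x under u alone. The class of x is this orbit together
  -- with its negative, and the two either coincide or are disjoint.
  module ClassSize (x : Fin (suc m)) (L : ℕ) (0<L : 0 < L)
    (fixes⁺ : ∀ {j} → L ∣ j → u ^ℤ j • x ≡ x) (fixes⁻ : ∀ {j} → u ^ℤ j • x ≡ x → L ∣ j) where

    private
      instance
        L≢0 : NonZero L
        L≢0 = ℕ.>-nonZero 0<L

    multiplier-reduce : ∀ s j → multiplier s (j % L) • x ≡ multiplier s j • x
    multiplier-reduce s j = sym (begin
      multiplier s j • x ≡⟨ •-cong x (≅-reflexive (trans (cong (multiplier s) (DM.m≡m%n+[m/n]*n j L))
        (trans (cong (sign s *ℤ_) (ℤ.^-distribˡ-+-* u (j % L) (j / L * L))) (sym (ℤ.*-assoc (sign s) (u ^ℤ (j % L)) (u ^ℤ (j / L * L))))))) ⟩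
      (multiplier s (j % L) *ℤ u ^ℤ (j / L * L)) • x ≡⟨ sym (•-• (multiplier s (j % L)) (u ^ℤ (j / L * L)) x) ⟩
      multiplier s (j % L) • (u ^ℤ (j / L * L)) • x ≡⟨ cong (multiplier s (j % L) •_) (fixes⁺ (divides (j / L) refl)) ⟩
      multiplier s (j % L) • x ∎)
      where open ≡-Reasoning

    orbit : Bool → List (Fin (suc m))
    orbit s = map (λ j → multiplier s j • x) (upTo L)

    ∈-orbit : ∀ s j → multiplier s j • x ∈ orbit s
    ∈-orbit s j = subst (_∈ orbit s) (multiplier-reduce s j) (∈-map⁺ (λ j → multiplier s j • x) (∈-upTo⁺ (DM.m%n<n j L)))

    -- Clears the power u^j. A common element of the orbit and its negative thus shows that -1 acts
    -- on x as a power of u.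
    cancel-multiplier : ∀ s t j k → multiplier s j • x ≡ multiplier t k • x →
      (sign s *ℤ sign t) • x ≡ u ^ℤ (inverse-exponent j + k) • x
    cancel-multiplier s t j k e = begin
      (sign s *ℤ sign t) • x ≡⟨ sym (•-cong x (≅-trans (≅-reflexive (regroup (sign s) (sign t) (u ^ℤ i) (u ^ℤ j)))
          (≅-trans (≅-*ˡ (sign s *ℤ sign t) (inverse-power j)) (≅-reflexive (ℤ.*-identityʳ (sign s *ℤ sign t)))))) ⟩
      ((sign t *ℤ u ^ℤ i) *ℤ multiplier s j) • x ≡⟨ sym (•-• (sign t *ℤ u ^ℤ i) (multiplier s j) x) ⟩
      (sign t *ℤ u ^ℤ i) • multiplier s j • x ≡⟨ cong ((sign t *ℤ u ^ℤ i) •_) e ⟩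
      (sign t *ℤ u ^ℤ i) • multiplier t k • x ≡⟨ •-• (sign t *ℤ u ^ℤ i) (multiplier t k) x ⟩
      ((sign t *ℤ u ^ℤ i) *ℤ multiplier t k) • x ≡⟨ cong (_• x) (trans (inter-* (sign t) (u ^ℤ i) (sign t) (u ^ℤ k))
          (trans (cong₂ _*ℤ_ (sign-square t) (sym (ℤ.^-distribˡ-+-* u i k))) (ℤ.*-identityˡ (u ^ℤ (i + k))))) ⟩
      u ^ℤ (i + k) • x ∎
      where
      open ≡-Reasoning
      i = inverse-exponent j
      regroup : ∀ s t a b → (t *ℤ a) *ℤ (s *ℤ b) ≡ (s *ℤ t) *ℤ (b *ℤ a)
      regroup = solve-∀

    orbit-distinct : ∀ s {j k} → j < k → k < L → ¬ multiplier s j • x ≡ multiplier s k • x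
    orbit-distinct s {j} {k} j<k k<L e = ℕ.<⇒≢ (ℕ.m<n⇒0<n∸m j<k) (sym (small-multiple (ℕ.<-≤-trans (s≤s (ℕ.m∸n≤m k j)) k<L)
      (fixes⁻ {k ∸ j} (begin
        u ^ℤ (k ∸ j) • x ≡⟨ sym (undo (u ^ℤ (k ∸ j) • x)) ⟩
        multiplier s (inverse-exponent j) • multiplier s j • (u ^ℤ (k ∸ j)) • x
          ≡⟨ cong (multiplier s (inverse-exponent j) •_) (•-• (multiplier s j) (u ^ℤ (k ∸ j)) x) ⟩
        multiplier s (inverse-exponent j) • ((multiplier s j *ℤ u ^ℤ (k ∸ j)) • x)
          ≡⟨ cong (λ z → multiplier s (inverse-exponent j) • (z • x)) (trans (ℤ.*-assoc (sign s) (u ^ℤ j) (u ^ℤ (k ∸ j)))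
               (cong (sign s *ℤ_) (trans (sym (ℤ.^-distribˡ-+-* u j (k ∸ j))) (cong (u ^ℤ_) (ℕ.m+[n∸m]≡n (ℕ.<⇒≤ j<k)))))) ⟩
        multiplier s (inverse-exponent j) • multiplier s k • x ≡⟨ cong (multiplier s (inverse-exponent j) •_) (sym e) ⟩
        multiplier s (inverse-exponent j) • multiplier s j • x ≡⟨ undo x ⟩
        x ∎))))
      where
      open ≡-Reasoning
      undo : ∀ y → multiplier s (inverse-exponent j) • multiplier s j • y ≡ y
      undo y = trans (•-• (multiplier s (inverse-exponent j)) (multiplier s j) y) (trans (•-cong y (multiplier-inverse s j)) (1-• y))

    orbit-unique : ∀ s → Unique (orbit s)
    orbit-unique s = AllPairsP.map⁺ (AllPairsP.applyUpTo⁺₁ id L (orbit-distinct s))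

    length-orbit : ∀ s → length (orbit s) ≡ L
    length-orbit s = trans (LP.length-map _ (upTo L)) (LP.length-upTo L)

    size-class : ∀ ys → Unique ys → (∀ {y} → Related x y → y ∈ ys) → (∀ {y} → y ∈ ys → Related x y) → ∣ class x ∣ ≡ length ys
    size-class ys u to from = ℤ.+-injective (trans (∣∣-count (class x)) (trans
      (∑-⟪⟫ (λ y → lookup (class x) y B.≟ true) (allFin (suc m)))
      (cong +_ (P.↭-length (unique⇒↭ (U.filter⁺ (λ y → lookup (class x) y B.≟ true) (U.allFin⁺ (suc m))) u fwd bwd)))))
      where
      fwd : ∀ {y} → y ∈ filter (λ y → lookup (class x) y B.≟ true) (allFin (suc m)) → y ∈ ys
      fwd {y} y∈ = to (does-true (related? x y) (trans (sym (lookup-class x y))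
        (proj₂ (∈-filter⁻ (λ y → lookup (class x) y B.≟ true) {xs = allFin (suc m)} y∈))))
      bwd : ∀ {y} → y ∈ ys → y ∈ filter (λ y → lookup (class x) y B.≟ true) (allFin (suc m))
      bwd {y} y∈ = ∈-filter⁺ (λ y → lookup (class x) y B.≟ true) (∈-allFin y)
        (trans (lookup-class x y) (dec-true (related? x y) (from y∈)))

    orbit⇒related : ∀ s {y} → y ∈ orbit s → Related x y
    orbit⇒related s y∈ with ∈-map⁻ (λ j → multiplier s j • x) y∈
    ... | j , _ , e = related-intro s j (sym e)

    -- The element -u^j x equals u^(j+c) x, so the orbit under u already is the whole class.
    class-size-with-negation : ∀ c → u ^ℤ c • x ≡ sign true • x → ∣ class x ∣ ≡ L
    class-size-with-negation c e = trans (size-class (orbit false) (orbit-unique false) to (orbit⇒related false)) (length-orbit false)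
      where
      to : ∀ {y} → Related x y → y ∈ orbit false
      to {y} r with related-elim r
      ... | false , j , e′ = subst (_∈ orbit false) e′ (∈-orbit false j)
      ... | true , j , e′ = subst (_∈ orbit false) (trans eq e′) (∈-orbit false (j + c))
        where
        open ≡-Reasoning
        eq : multiplier false (j + c) • x ≡ multiplier true j • x
        eq = begin
          multiplier false (j + c) • x ≡⟨ cong (_• x) (trans (ℤ.*-identityˡ (u ^ℤ (j + c))) (ℤ.^-distribˡ-+-* u j c)) ⟩
          (u ^ℤ j *ℤ u ^ℤ c) • x ≡⟨ sym (•-• (u ^ℤ j) (u ^ℤ c) x) ⟩
          u ^ℤ j • (u ^ℤ c • x) ≡⟨ cong (u ^ℤ j •_) e ⟩
          u ^ℤ j • (sign true • x) ≡⟨ •-• (u ^ℤ j) (sign true) x ⟩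
          (u ^ℤ j *ℤ sign true) • x ≡⟨ cong (_• x) (ℤ.*-comm (u ^ℤ j) (sign true)) ⟩
          multiplier true j • x ∎

    -- If the orbit met its negative, some power of u would negate x; so the class consists of two
    -- disjoint lists of length L.
    class-size-without-negation : (∀ c → ¬ u ^ℤ c • x ≡ sign true • x) → ∣ class x ∣ ≡ 2 * L
    class-size-without-negation n = trans (size-class (orbit false ++ orbit true)
      (U.++⁺ (orbit-unique false) (orbit-unique true) disj) to from)
      (trans (LP.length-++ (orbit false)) (trans (cong₂ _+_ (length-orbit false) (length-orbit true)) (cong (λ z → L + z) (sym (ℕ.+-identityʳ L)))))
      where
      disj : ∀ {y} → y ∈ orbit false × y ∈ orbit true → ⊥
      disj {y} (y∈ , y∈′) with ∈-map⁻ (λ j → multiplier false j • x) y∈ | ∈-map⁻ (λ j → multiplier true j • x) y∈′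
      ... | j , _ , e | k , _ , e′ = n (inverse-exponent j + k) (sym (cancel-multiplier false true j k (trans (sym e) e′)))
      to : ∀ {y} → Related x y → y ∈ orbit false ++ orbit true
      to r with related-elim r
      ... | false , j , e = ∈-++⁺ˡ (subst (_∈ orbit false) e (∈-orbit false j))
      ... | true , j , e = ∈-++⁺ʳ (orbit false) (subst (_∈ orbit true) e (∈-orbit true j))
      from : ∀ {y} → y ∈ orbit false ++ orbit true → Related x y
      from y∈ with ∈-++⁻ (orbit false) y∈
      ... | inj₁ h = orbit⇒related false h
      ... | inj₂ h = orbit⇒related true h

-- When -1 is a power of u

all-true⁺ : ∀ {A : Set} (f : A → Bool) (xs : List A) → (∀ {x} → x ∈ xs → f x ≡ true) → all f xs ≡ true
all-true⁺ f [] h = refl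
all-true⁺ f (x ∷ xs) h = cong₂ _∧_ (h (here refl)) (all-true⁺ f xs (h ∘ there))

∧-true : ∀ {a b} → a ∧ b ≡ true → a ≡ true × b ≡ true
∧-true {true} {true} _ = refl , refl

all-true⁻ : ∀ {A : Set} (f : A → Bool) (xs : List A) → all f xs ≡ true → ∀ {x} → x ∈ xs → f x ≡ true
all-true⁻ f (y ∷ xs) h (here refl) = proj₁ (∧-true h)
all-true⁻ f (y ∷ xs) h (there x∈) = all-true⁻ f xs (proj₂ (∧-true {f y} h)) x∈

any-true⁺ : ∀ {A : Set} (f : A → Bool) (xs : List A) {x} → x ∈ xs → f x ≡ true → any f xs ≡ true
any-true⁺ f (y ∷ xs) (here refl) h = cong (_∨ any f xs) h
any-true⁺ f (y ∷ xs) (there x∈) h = trans (cong (f y ∨_) (any-true⁺ f xs x∈ h)) (B.∨-zeroʳ (f y))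

any-true⁻ : ∀ {A : Set} (f : A → Bool) (xs : List A) → any f xs ≡ true → ∃ λ x → x ∈ xs × f x ≡ true
any-true⁻ f (y ∷ xs) h = go (f y) refl h
  where
  go : ∀ b → f y ≡ b → b ∨ any f xs ≡ true → ∃ λ x → x ∈ (y ∷ xs) × f x ≡ true
  go true e _ = y , here refl , e
  go false _ h′ with any-true⁻ f xs h′
  ... | x , x∈ , e = x , there x∈ , e

T-true : ∀ {b} → T b → b ≡ true
T-true {true} _ = refl

congMod⁺ : ∀ {a b m} → 0 < m → + a ≅ + b [ m ] → congMod a b m ≡ true
congMod⁺ {a} {b} {suc m} _ c = T-true (ℕ.≡⇒≡ᵇ (a % suc m) (b % suc m)
  (≅-small (DM.m%n<n a (suc m)) (DM.m%n<n b (suc m)) (≅-trans (≅-% a (suc m)) (≅-trans c (≅-sym (≅-% b (suc m)))))))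

congMod⁻ : ∀ {a b m} → 0 < m → congMod a b m ≡ true → + a ≅ + b [ m ]
congMod⁻ {a} {b} {suc m} _ h = ≅-trans (≅-sym (≅-% a (suc m))) (≅-trans
  (≅-reflexive (cong +_ (ℕ.≡ᵇ⇒≡ (a % suc m) (b % suc m) (subst T (sym h) tt)))) (≅-% b (suc m)))

module OddPrime {p : ℕ} (pr : Prime p) (odd : p % 2 ≡ 1) where

  open PrimeIndex p pr public using (1<p; 0<p-1)

  h : ℕ
  h = div (p ∸ 1) 2

  private
    p-1-even : p ∸ 1 ≡ p / 2 * 2
    p-1-even = cong (_∸ 1) (trans (DM.m≡m%n+[m/n]*n p 2) (cong (_+ p / 2 * 2) odd))

  p-1≡h*2 : p ∸ 1 ≡ h * 2
  p-1≡h*2 = trans p-1-even (cong (_* 2) (sym (trans (cong (λ z → div z 2) p-1-even) (div-* (p / 2) (s≤s z≤n)))))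

  0<h : 0 < h
  0<h = ℕ.n≢0⇒n>0 λ e → contradiction (subst (0 <_) (trans p-1≡h*2 (cong (_* 2) e)) 0<p-1) λ ()

  1≇-1 : ¬ + 1 ≅ - + 1 [ p ]
  1≇-1 c = contradiction (trans (sym odd) (cong (_% 2) p≡2)) λ ()
    where
    p≡2 : p ≡ 2
    p≡2 = ℕ.≤-antisym (Dv.∣⇒≤ (≅-0 {x = + 2} (≅⇒-0 c))) 1<p

  module _ {u : ℤ} {e d : ℕ} (ed : p ∸ 1 ≡ e * d) (o : Order p u e) where

    private
      instance
        d≢0 : NonZero d
        d≢0 = ℕ.>-nonZero (ℕ.n≢0⇒n>0 λ { refl → contradiction (subst (0 <_) (trans ed (ℕ.*-zeroʳ e)) 0<p-1) λ () })

    -- From u^(2c) = 1 one has 2c = t e. An even t would give e | c and u^c = 1, so t is odd;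
    -- multiplying by d, 2cd is an odd multiple of p - 1, and cd is h plus a multiple of p - 1.
    neg-power⁺ : ∀ c → u ^ℤ c ≅ - + 1 [ p ] → + (c * d) ≅ + h [ p ∸ 1 ]
    neg-power⁺ c n = go (Order.minimal o {c * 2} (≅-trans (≅-reflexive (^-mul u c 2)) (≅-^ 2 n)))
      where
      go : e ∣ c * 2 → + (c * d) ≅ + h [ p ∸ 1 ]
      go (divides t eq) = parity (t % 2) (DM.m%n<n t 2) (DM.m≡m%n+[m/n]*n t 2)
        where
        open ≡-Reasoning
        s = t / 2
        parity : ∀ r → r < 2 → t ≡ r + s * 2 → + (c * d) ≅ + h [ p ∸ 1 ]
        parity zero _ ev = contradiction (≅-trans (≅-sym (^-multiple {u} {e = e} (Order.power o) (divides s
          (ℕ.*-cancelʳ-≡ c (s * e) 2 (begin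
            c * 2 ≡⟨ eq ⟩
            t * e ≡⟨ cong (_* e) ev ⟩
            s * 2 * e ≡⟨ ℕ.*-assoc s 2 e ⟩
            s * (2 * e) ≡⟨ cong (s *_) (ℕ.*-comm 2 e) ⟩
            s * (e * 2) ≡⟨ sym (ℕ.*-assoc s e 2) ⟩
            s * e * 2 ∎))))) n) 1≇-1
        parity (suc zero) _ od = ≅-trans (≅-reflexive (cong +_ half)) (≅-trans
          (≅-reflexive (ℤ.pos-+ h (s * (p ∸ 1)))) (≅-trans (≅-+ (≅-refl {x = + h}) (0-≅ℕ (divides s refl))) (≅-reflexive (ℤ.+-identityʳ (+ h)))))
          where
          half : c * d ≡ h + s * (p ∸ 1)
          half = ℕ.*-cancelʳ-≡ (c * d) (h + s * (p ∸ 1)) 2 (begin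
            c * d * 2 ≡⟨ ℕ.*-assoc c d 2 ⟩
            c * (d * 2) ≡⟨ cong (c *_) (ℕ.*-comm d 2) ⟩
            c * (2 * d) ≡⟨ sym (ℕ.*-assoc c 2 d) ⟩
            c * 2 * d ≡⟨ cong (_* d) eq ⟩
            t * e * d ≡⟨ ℕ.*-assoc t e d ⟩
            t * (e * d) ≡⟨ cong₂ _*_ od (sym ed) ⟩
            (p ∸ 1) + s * 2 * (p ∸ 1) ≡⟨ cong₂ _+_ p-1≡h*2 (trans (ℕ.*-assoc s 2 (p ∸ 1)) (trans (cong (s *_) (ℕ.*-comm 2 (p ∸ 1))) (sym (ℕ.*-assoc s (p ∸ 1) 2)))) ⟩
            h * 2 + s * (p ∸ 1) * 2 ≡⟨ sym (ℕ.*-distribʳ-+ 2 h (s * (p ∸ 1))) ⟩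
            (h + s * (p ∸ 1)) * 2 ∎)
        parity (suc (suc r)) (s≤s (s≤s ())) _

    -- Writing cd = h + k(p - 1) and doubling gives 2c = (1 + 2k) e, so u^c is a square root of 1
    -- modulo p. The root 1 is impossible: it would give e | c, hence p - 1 | h, although 0 < h < p
    -- - 1.
    neg-power⁻ : ∀ c → + (c * d) ≅ + h [ p ∸ 1 ] → u ^ℤ c ≅ - + 1 [ p ]
    neg-power⁻ c (by k eq) = pick (≅-prime (u ^ℤ c -ℤ + 1) (u ^ℤ c +ℤ + 1) pr
        (≅-trans (≅-reflexive (square (u ^ℤ c))) (≅⇒-0 (≅-trans (≅-reflexive (sym (^-mul u c 2))) (^-multiple {u} {e = e} (Order.power o) e∣2c)))))
      where
      open ≡-Reasoning
      square : ∀ a → (a -ℤ + 1) *ℤ (a +ℤ + 1) ≡ (a *ℤ (a *ℤ + 1)) -ℤ + 1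
      square = solve-∀
      doubled : + (c * 2) *ℤ + d ≡ ((+ 1 +ℤ k *ℤ + 2) *ℤ + e) *ℤ + d
      doubled = begin
        + (c * 2) *ℤ + d ≡⟨ trans (cong (_*ℤ + d) (ℤ.pos-* c 2)) (swap₂ (+ c) (+ d)) ⟩
        (+ c *ℤ + d) *ℤ + 2 ≡⟨ cong (_*ℤ + 2) (sym (ℤ.pos-* c d)) ⟩
        + (c * d) *ℤ + 2 ≡⟨ split (+ (c * d)) (+ h) ⟩
        (+ (c * d) -ℤ + h) *ℤ + 2 +ℤ + h *ℤ + 2 ≡⟨ cong₂ (λ a b → a *ℤ + 2 +ℤ b) eq (trans (sym (ℤ.pos-* h 2)) (cong +_ (sym p-1≡h*2))) ⟩
        (k *ℤ + (p ∸ 1)) *ℤ + 2 +ℤ + (p ∸ 1) ≡⟨ collect k (+ (p ∸ 1)) ⟩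
        (+ 1 +ℤ k *ℤ + 2) *ℤ + (p ∸ 1) ≡⟨ cong ((+ 1 +ℤ k *ℤ + 2) *ℤ_) (trans (cong +_ ed) (ℤ.pos-* e d)) ⟩
        (+ 1 +ℤ k *ℤ + 2) *ℤ (+ e *ℤ + d) ≡⟨ sym (ℤ.*-assoc (+ 1 +ℤ k *ℤ + 2) (+ e) (+ d)) ⟩
        ((+ 1 +ℤ k *ℤ + 2) *ℤ + e) *ℤ + d ∎
        where
        swap₂ : ∀ c d → (c *ℤ + 2) *ℤ d ≡ (c *ℤ d) *ℤ + 2
        swap₂ = solve-∀
        split : ∀ a h → a *ℤ + 2 ≡ (a -ℤ h) *ℤ + 2 +ℤ h *ℤ + 2
        split = solve-∀
        collect : ∀ k m → (k *ℤ m) *ℤ + 2 +ℤ m ≡ (+ 1 +ℤ k *ℤ + 2) *ℤ m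
        collect = solve-∀
      e∣2c : e ∣ c * 2
      e∣2c = ≅-0 {x = + (c * 2)} (by (+ 1 +ℤ k *ℤ + 2) (trans (ℤ.+-identityʳ (+ (c * 2)))
        (ℤ.*-cancelʳ-≡ (+ (c * 2)) ((+ 1 +ℤ k *ℤ + 2) *ℤ + e) (+ d) doubled)))
      pick : u ^ℤ c -ℤ + 1 ≅ + 0 [ p ] ⊎ u ^ℤ c +ℤ + 1 ≅ + 0 [ p ] → u ^ℤ c ≅ - + 1 [ p ]
      pick (inj₂ z) = -0⇒≅ z
      pick (inj₁ z) = contradiction (absurd (Order.minimal o {c} (-0⇒≅ z))) λ ()
        where
        absurd : e ∣ c → 0 < 0
        absurd (divides t refl) = subst (0 <_) (small-multiple h<p-1 (≅-0 {x = + h} (≅-trans (≅-sym (by k eq)) (0-≅ℕ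
          (divides t (trans (ℕ.*-assoc t e d) (cong (t *_) (sym ed)))))))) 0<h
          where
          h<p-1 : h < p ∸ 1
          h<p-1 = subst (h <_) (sym p-1≡h*2) (subst (_< h * 2) (ℕ.*-identityʳ h) (ℕ.*-monoʳ-< h {{ℕ.>-nonZero 0<h}} (s≤s (s≤s z≤n))))

    d∣h : ∀ c → + (c * d) ≅ + h [ p ∸ 1 ] → d ∣ h
    d∣h c x = ≅-0 {x = + h} (≅-trans (≅-sym (≅-weaken (divides e ed) x)) (0-≅ℕ (divides c refl)))

    -- If e = 2s, then p - 1 = 2sd and h = sd is a multiple of d.
    e-odd : ¬ d ∣ h → gcd 2 e ≡ 1
    e-odd n = go (Pr.prime⇒irreducible Pr.prime[2] (G.gcd[m,n]∣m 2 e)) refl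
      where
      go : ∀ {g} → g ≡ 1 ⊎ g ≡ 2 → gcd 2 e ≡ g → gcd 2 e ≡ 1
      go (inj₁ refl) q = q
      go (inj₂ refl) q with subst (_∣ e) q (G.gcd[m,n]∣n 2 e)
      ... | divides s refl = contradiction (divides s (ℕ.*-cancelʳ-≡ h (s * d) 2 (trans (sym p-1≡h*2) (trans ed
        (trans (ℕ.*-assoc s 2 d) (trans (cong (s *_) (ℕ.*-comm 2 d)) (sym (ℕ.*-assoc s d 2)))))))) n

    single-true : d ∣ h → div (p ∸ 1) (gcd d h) ≡ e
    single-true x = trans (cong₂ div ed (Dv.∣-antisym (G.gcd[m,n]∣m d h) (G.gcd-greatest Dv.∣-refl x))) (div-* e (ℕ.>-nonZero⁻¹ d))

    -- As e is odd, 2 gcd(d, h) = gcd(2d, e d) = d gcd(2, e) = d, so the divisor is half of d and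
    -- the quotient doubles.
    single-false : ¬ d ∣ h → div (p ∸ 1) (gcd d h) ≡ 2 * e
    single-false n = trans (cong (λ z → div z g) total) (div-* (2 * e) 0<g)
      where
      open ≡-Reasoning
      g = gcd d h
      2g : 2 * g ≡ d
      2g = begin
        2 * g ≡⟨ G.c*gcd[m,n]≡gcd[cm,cn] 2 d h ⟩
        gcd (2 * d) (2 * h) ≡⟨ cong₂ gcd (ℕ.*-comm 2 d) (trans (ℕ.*-comm 2 h) (trans (sym p-1≡h*2) (trans ed (ℕ.*-comm e d)))) ⟩
        gcd (d * 2) (d * e) ≡⟨ sym (G.c*gcd[m,n]≡gcd[cm,cn] d 2 e) ⟩
        d * gcd 2 e ≡⟨ cong (d *_) (e-odd n) ⟩
        d * 1 ≡⟨ ℕ.*-identityʳ d ⟩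
        d ∎
      0<g : 0 < g
      0<g = ℕ.n≢0⇒n>0 λ z → contradiction (trans (sym 2g) (cong (2 *_) z)) (ℕ.≢-nonZero⁻¹ d)
      total : p ∸ 1 ≡ 2 * e * g
      total = trans ed (trans (cong (e *_) (sym 2g)) (trans (sym (ℕ.*-assoc e 2 g)) (cong (_* g) (ℕ.*-comm e 2))))

    solution : d ∣ h → ∃ λ c → + (c * d) ≅ + h [ p ∸ 1 ]
    solution (divides c eq) = c , ≅-reflexive (cong +_ (sym eq))

-- Types: the set of prime factors of n that do not divide x

distinct-primes-coprime : ∀ {p q} → Prime p → Prime q → p ≢ q → Coprime p q
distinct-primes-coprime {p} {q} pp pq n {d} (d∣p , d∣q) = go (Pr.prime⇒irreducible pp d∣p) (Pr.prime⇒irreducible pq d∣q)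
  where
  go : d ≡ 1 ⊎ d ≡ p → d ≡ 1 ⊎ d ≡ q → d ≡ 1
  go (inj₁ e) _ = e
  go (inj₂ _) (inj₁ e) = e
  go (inj₂ refl) (inj₂ refl) = contradiction refl n

lookup-tail : ∀ {A : Set} {l} (xs : Vec A (suc l)) i → lookup (Vec.tail xs) i ≡ lookup xs (Fin.suc i)
lookup-tail (x ∷ xs) i = refl

∈-elems⁺ : ∀ {l} (S : Subset l) {i} → lookup S i ≡ true → i ∈ elems S
∈-elems⁺ S {i} h = ∈-filter⁺ (λ i → lookup S i B.≟ true) (∈-allFin i) h

∈-elems⁻ : ∀ {l} (S : Subset l) {i} → i ∈ elems S → lookup S i ≡ true
∈-elems⁻ {l} S i∈ = proj₂ (∈-filter⁻ (λ i → lookup S i B.≟ true) {xs = allFin l} i∈)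

lcm-list-least : ∀ {A : Set} (f : A → ℕ) (xs : List A) {c} → (∀ {x} → x ∈ xs → f x ∣ c) → foldr lcm 1 (map f xs) ∣ c
lcm-list-least f [] h = Dv.1∣ _
lcm-list-least f (x ∷ xs) h = L.lcm-least (h (here refl)) (lcm-list-least f xs (h ∘ there))

∣-lcm-list : ∀ {A : Set} (f : A → ℕ) (xs : List A) {x} → x ∈ xs → f x ∣ foldr lcm 1 (map f xs)
∣-lcm-list f (y ∷ xs) (here refl) = L.m∣lcm[m,n] (f y) _
∣-lcm-list f (y ∷ xs) (there x∈) = Dv.∣-trans (∣-lcm-list f xs x∈) (L.n∣lcm[m,n] (f y) _)

∣-product-list : ∀ {A : Set} (f : A → ℕ) (xs : List A) {x} → x ∈ xs → f x ∣ foldr _*_ 1 (map f xs)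
∣-product-list f (y ∷ xs) (here refl) = Dv.m∣m*n _
∣-product-list f (y ∷ xs) (there x∈) = Dv.∣-trans (∣-product-list f xs x∈) (Dv.n∣m*n (f y))

product-list-positive : ∀ {A : Set} (f : A → ℕ) (xs : List A) → (∀ x → 0 < f x) → 0 < foldr _*_ 1 (map f xs)
product-list-positive f [] h = s≤s z≤n
product-list-positive f (x ∷ xs) h = ℕ.*-mono-≤ (h x) (product-list-positive f xs h)

module Setting (l : ℕ) (p : Fin l → ℕ) (pr : ∀ i → Prime (p i)) (odd : ∀ i → p i % 2 ≡ 1) (inj : Injective _≡_ _≡_ p)
  where

  -- With 2 at position zero, a type is a parity bit followed by a set of odd primes, and `Vec.tail`
  -- forgets the parity.
  q : Fin (suc l) → ℕ
  q Fin.zero = 2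
  q (Fin.suc i) = p i

  q-prime : ∀ i → Prime (q i)
  q-prime Fin.zero = Pr.prime[2]
  q-prime (Fin.suc i) = pr i

  q-nonZero : ∀ i → NonZero (q i)
  q-nonZero i = Pr.prime⇒nonZero (q-prime i)

  q-injective : ∀ i j → q i ≡ q j → i ≡ j
  q-injective Fin.zero Fin.zero e = refl
  q-injective Fin.zero (Fin.suc j) e = contradiction (trans (cong (_% 2) e) (odd j)) λ ()
  q-injective (Fin.suc i) Fin.zero e = contradiction (trans (cong (_% 2) (sym e)) (odd i)) λ ()
  q-injective (Fin.suc i) (Fin.suc j) e = cong Fin.suc (inj e)

  q-coprime : PairwiseCoprime q
  q-coprime i j n = distinct-primes-coprime (q-prime i) (q-prime j) (n ∘ q-injective i j)

  abstract
    type : ℕ → Subset (suc l)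
    type x = tabulate (λ i → not (does (q i ∣? x)))

    type-true⁺ : ∀ x i → ¬ q i ∣ x → lookup (type x) i ≡ true
    type-true⁺ x i n = trans (V.lookup∘tabulate (λ i → not (does (q i ∣? x))) i) (cong not (dec-false (q i ∣? x) n))

    type-true⁻ : ∀ x i → lookup (type x) i ≡ true → ¬ q i ∣ x
    type-true⁻ x i h d = contradiction (trans (sym h) (trans (V.lookup∘tabulate (λ i → not (does (q i ∣? x))) i)
      (cong not (dec-true (q i ∣? x) d)))) λ ()

  type-false : ∀ x i → lookup (type x) i ≡ false → q i ∣ x
  type-false x i h = go (q i ∣? x)
    where
    go : Dec (q i ∣ x) → q i ∣ x
    go (yes d) = d
    go (no n) = contradiction (trans (sym h) (type-true⁺ x i n)) λ ()

  module Modulus (m : ℕ) (n-def : suc m ≡ prodF (suc l) q) where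

    q∣n : ∀ i → q i ∣ suc m
    q∣n i = subst (q i ∣_) (sym n-def) (factor-∣-prodF (suc l) q i)

    ≅-n : ∀ {x y} → (∀ i → x ≅ y [ q i ]) → x ≅ y [ suc m ]
    ≅-n {x} {y} h = subst (x ≅ y [_]) (sym n-def) (≅-prodF (suc l) q q-coprime h)

    invertible-q : ∀ {u} → Invertible u (suc m) → ∀ i → Invertible u (q i)
    invertible-q (v , e) i = v , ≅-weaken (q∣n i) e

    odd-≅-1 : ∀ {u} → Invertible u (suc m) → u ≅ + 1 [ 2 ]
    odd-≅-1 {u} ui = go (rem 2 u) (rem-< 2 u) (rem-≅ 2 u)
      where
      go : ∀ r → r < 2 → + r ≅ u [ 2 ] → u ≅ + 1 [ 2 ]
      go zero _ c = contradiction (≅-sym c) (PrimeIndex.invertible-non-multiple 2 Pr.prime[2] (invertible-q ui Fin.zero))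
      go (suc zero) _ c = ≅-sym c
      go (suc (suc r)) (s≤s (s≤s ())) c

    -- Modulo a prime dividing x both products vanish, so only the primes in the type of x impose a
    -- condition on the multipliers.
    •-≡⁺ : ∀ {g h} x → (∀ i → lookup (type (toℕ x)) i ≡ true → g ≅ h [ q i ]) → g • x ≡ h • x
    •-≡⁺ {g} {h} x eq = ⟦⟧-injective {n = suc m} (≅-trans (⟦•⟧ g x) (≅-trans (≅-n local) (≅-sym (⟦•⟧ h x))))
      where
      local : ∀ i → g *ℤ ⟦ x ⟧ ≅ h *ℤ ⟦ x ⟧ [ q i ]
      local i = go (lookup (type (toℕ x)) i) refl
        where
        go : ∀ b → lookup (type (toℕ x)) i ≡ b → g *ℤ ⟦ x ⟧ ≅ h *ℤ ⟦ x ⟧ [ q i ]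
        go true e = ≅-*ʳ ⟦ x ⟧ (eq i e)
        go false e = ≅-trans (kill g) (≅-sym (kill h))
          where
          kill : ∀ g → g *ℤ ⟦ x ⟧ ≅ + 0 [ q i ]
          kill g = ≅-trans (≅-*ˡ g (0-≅ℕ (type-false (toℕ x) i e))) (≅-reflexive (ℤ.*-zeroʳ g))

    -- A prime in the type of x does not divide x, so x can be cancelled modulo it.
    •-≡⁻ : ∀ {g h} (x : Fin (suc m)) → g • x ≡ h • x → ∀ i → lookup (type (toℕ x)) i ≡ true → g ≅ h [ q i ]
    •-≡⁻ {g} {h} x e i t = go (≅-prime (g -ℤ h) ⟦ x ⟧ (q-prime i) (≅-trans (≅-reflexive (dist g h ⟦ x ⟧)) (≅⇒-0 (≅-weaken (q∣n i)
        (≅-trans (≅-sym (⟦•⟧ g x)) (≅-trans (≅-reflexive (cong ⟦_⟧ e)) (⟦•⟧ h x)))))))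
      where
      dist : ∀ g h x → (g -ℤ h) *ℤ x ≡ g *ℤ x -ℤ h *ℤ x
      dist = solve-∀
      go : g -ℤ h ≅ + 0 [ q i ] ⊎ ⟦ x ⟧ ≅ + 0 [ q i ] → g ≅ h [ q i ]
      go (inj₁ z) = -0⇒≅ z
      go (inj₂ z) = contradiction (≅-0 {x = ⟦ x ⟧} z) (type-true⁻ (toℕ x) i t)

    type-• : ∀ {u} → Invertible u (suc m) → ∀ x → type (toℕ (u • x)) ≡ type (toℕ x)
    type-• {u} ui x = lookup-ext λ i → bool-cong
      (λ h → type-true⁺ (toℕ x) i (λ d → type-true⁻ (toℕ (u • x)) i h (≅-0 {x = ⟦ u • x ⟧} (≅-trans (≅-weaken (q∣n i) (⟦•⟧ u x))
        (≅-trans (≅-*ˡ u (0-≅ℕ d)) (≅-reflexive (ℤ.*-zeroʳ u)))))))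
      (λ h → type-true⁺ (toℕ (u • x)) i (λ d → type-true⁻ (toℕ x) i h (≅-0 {x = ⟦ x ⟧}
        (invertible-cancel {u} (invertible-q ui i) (≅-trans (≅-sym (≅-weaken (q∣n i) (⟦•⟧ u x))) (≅-trans (0-≅ℕ d) (≅-reflexive (sym (ℤ.*-zeroʳ u)))))))))

    module Unit (u : ℤ) (u-inv : Invertible u (suc m)) (d : Fin l → ℕ) (u-index : ∀ i → PrimeIndex.Index (p i) (pr i) u (d i)) where

      open SignedPowers {m} u u-inv public

      e : Fin l → ℕ
      e i = proj₁ (u-index i)

      ed : ∀ i → p i ∸ 1 ≡ e i * d i
      ed i = proj₁ (proj₂ (u-index i))

      e-order : ∀ i → Order (p i) u (e i)
      e-order i = proj₂ (proj₂ (u-index i))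

      d-positive : ∀ i → 0 < d i
      d-positive i = PrimeIndex.Index-positive (p i) (pr i) {u} (u-index i)

      div-e : ∀ i → div (m′ p d i) (d i) ≡ e i
      div-e i = trans (cong (λ z → div z (d i)) (ed i)) (div-* (e i) (d-positive i))

      0<m′ : ∀ i → 0 < m′ p d i
      0<m′ i = PrimeIndex.0<p-1 (p i) (pr i)

      Solution : Subset l → ℕ → Set
      Solution S c = ∀ {i} → lookup S i ≡ true → + (c * d i) ≅ + h′ p d i [ p i ∸ 1 ]

      solvable : Subset l → Bool
      solvable S = allDivHalf p d S ∧ commonSol p d S

      -- Replacing c by its remainder modulo the product P of all p_i - 1 brings it into the range
      -- of the search and preserves every congruence. Each d_i divides h_i because it divides both
      -- c d_i and the modulus p_i - 1.
      solvable⁺ : ∀ S c → Solution S c → solvable S ≡ true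
      solvable⁺ S c sol = cong₂ _∧_
        (all-true⁺ (λ i → ⌊ d i ∣? h′ p d i ⌋) (elems S) (λ {i} i∈ → trans (isYes≗does (d i ∣? h′ p d i)) (dec-true (d i ∣? h′ p d i)
          (OddPrime.d∣h (pr i) (odd i) (ed i) (e-order i) c (sol (∈-elems⁻ S i∈))))))
        (any-true⁺ (λ c → all (λ i → congMod (c * d i) (h′ p d i) (m′ p d i)) (elems S)) (upTo P) (∈-upTo⁺ (DM.m%n<n c P))
          (all-true⁺ (λ i → congMod (c % P * d i) (h′ p d i) (m′ p d i)) (elems S) λ {i} i∈ → congMod⁺ (0<m′ i)
            (≅-trans (≅-reflexive (ℤ.pos-* (c % P) (d i))) (≅-trans (≅-*ʳ (+ d i) (≅-weaken (∣-product-list (m′ p d) (elems S) i∈) (≅-% c P)))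
            (≅-trans (≅-reflexive (sym (ℤ.pos-* c (d i)))) (sol (∈-elems⁻ S i∈)))))))
        where
        P = prodT p d S
        instance
          P≢0 : NonZero P
          P≢0 = ℕ.>-nonZero (product-list-positive (m′ p d) (elems S) 0<m′)

      solvable⁻ : ∀ S → solvable S ≡ true → ∃ (Solution S)
      solvable⁻ S h with any-true⁻ (λ c → all (λ i → congMod (c * d i) (h′ p d i) (m′ p d i)) (elems S)) (upTo (prodT p d S)) (proj₂ (∧-true {allDivHalf p d S} h))
      ... | c , _ , a = c , λ {i} i∈ → congMod⁻ (0<m′ i) (all-true⁻ (λ i → congMod (c * d i) (h′ p d i) (m′ p d i)) (elems S) a (∈-elems⁺ S i∈))

      -- Kept opaque so that rewriting by a value of elems S does not reach inside it.
      abstract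
        size : Subset l → ℕ
        size S = if solvable S then LT p d S else 2 * LT p d S

        size-def : ∀ S → size S ≡ (if solvable S then LT p d S else 2 * LT p d S)
        size-def S = refl

      alpha-[] : ∀ S → elems S ≡ [] → alpha p d S ≡ size S
      alpha-[] S eq rewrite eq = sym (size-def S)

      alpha-∷∷ : ∀ S {i j is} → elems S ≡ i ∷ j ∷ is → alpha p d S ≡ size S
      alpha-∷∷ S eq rewrite eq = sym (size-def S)

      alpha-single : ∀ S {i} → elems S ≡ i ∷ [] → alpha p d S ≡ div (m′ p d i) (gcd (d i) (h′ p d i))
      alpha-single S eq rewrite eq = refl

      size-true : ∀ S → solvable S ≡ true → size S ≡ LT p d S
      size-true S h = trans (size-def S) (cong (λ b → if b then LT p d S else 2 * LT p d S) h)

      size-false : ∀ S → solvable S ≡ false → size S ≡ 2 * LT p d S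
      size-false S h = trans (size-def S) (cong (λ b → if b then LT p d S else 2 * LT p d S) h)

      -- In particular the separate formula for |T| = 1 in the definition of alpha agrees with the general one.
      alpha-size : ∀ S → alpha p d S ≡ size S
      alpha-size S = go (elems S) refl
        where
        go : ∀ is → elems S ≡ is → alpha p d S ≡ size S
        go [] eq = alpha-[] S eq
        go (i ∷ j ∷ is) eq = alpha-∷∷ S eq
        go (i ∷ []) eq = trans (alpha-single S eq) (single (d i ∣? h′ p d i))
          where
          i∈ : lookup S i ≡ true
          i∈ = ∈-elems⁻ S (subst (i ∈_) (sym eq) (here refl))
          only : ∀ {j} → lookup S j ≡ true → j ≡ i
          only {j} j∈ with subst (j ∈_) eq (∈-elems⁺ S j∈)
          ... | here r = r
          LT-e : LT p d S ≡ e i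
          LT-e = trans (cong (λ is → foldr lcm 1 (map (λ i → div (m′ p d i) (d i)) is)) eq)
            (trans (Dv.∣-antisym (L.lcm-least Dv.∣-refl (Dv.1∣ _)) (L.m∣lcm[m,n] _ 1)) (div-e i))
          single : Dec (d i ∣ h′ p d i) → div (m′ p d i) (gcd (d i) (h′ p d i)) ≡ size S
          single (yes dv) = trans (OddPrime.single-true (pr i) (odd i) (ed i) (e-order i) dv)
            (sym (trans (size-true S (uncurry-sol (OddPrime.solution (pr i) (odd i) (ed i) (e-order i) dv))) LT-e))
            where
            uncurry-sol : (∃ λ c → + (c * d i) ≅ + h′ p d i [ p i ∸ 1 ]) → solvable S ≡ true
            uncurry-sol (c , s) = solvable⁺ S c λ {j} j∈ → subst (λ j → + (c * d j) ≅ + h′ p d j [ p j ∸ 1 ]) (sym (only j∈)) s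
          single (no nd) = trans (OddPrime.single-false (pr i) (odd i) (ed i) (e-order i) nd)
            (sym (trans (size-false S (unsolvable (solvable S) refl)) (cong (2 *_) LT-e)))
            where
            unsolvable : ∀ b → solvable S ≡ b → b ≡ false
            unsolvable false _ = refl
            unsolvable true s = contradiction (OddPrime.d∣h (pr i) (odd i) (ed i) (e-order i) (proj₁ (solvable⁻ S s)) (proj₂ (solvable⁻ S s) i∈)) nd

      module _ (x : Fin (suc m)) where

        private
          S = Vec.tail (type (toℕ x))
          tail-lookup : ∀ i → lookup S i ≡ lookup (type (toℕ x)) (Fin.suc i)
          tail-lookup i = lookup-tail (type (toℕ x)) i

        -- At each odd prime of the type, u^j is 1 as soon as the order e_i divides j, and `LT` is
        -- the least common multiple of these orders. Modulo 2 the unit u is 1.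
        power-fixes⁺ : ∀ {j} → LT p d S ∣ j → u ^ℤ j • x ≡ x
        power-fixes⁺ {j} dv = trans (•-≡⁺ {u ^ℤ j} {+ 1} x local) (1-• x)
          where
          local : ∀ i → lookup (type (toℕ x)) i ≡ true → u ^ℤ j ≅ + 1 [ q i ]
          local Fin.zero _ = ≅-trans (≅-^ j (odd-≅-1 u-inv)) (≅-reflexive (1^ j))
          local (Fin.suc i) t = ^-multiple {u} {e = e i} (Order.power (e-order i))
            (Dv.∣-trans (subst (_∣ LT p d S) (div-e i) (∣-lcm-list (λ i → div (m′ p d i) (d i)) (elems S) (∈-elems⁺ S (trans (tail-lookup i) t)))) dv)

        power-fixes⁻ : ∀ {j} → u ^ℤ j • x ≡ x → LT p d S ∣ j
        power-fixes⁻ {j} eq = lcm-list-least (λ i → div (m′ p d i) (d i)) (elems S) λ {i} i∈ →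
          subst (_∣ j) (sym (div-e i)) (Order.minimal (e-order i)
            (•-≡⁻ {u ^ℤ j} {+ 1} x (trans eq (sym (1-• x))) (Fin.suc i) (trans (sym (tail-lookup i)) (∈-elems⁻ S i∈))))

        -- The power of u at its period fixes x, so `LT` divides the nonzero period.
        LT-positive : 0 < LT p d S
        LT-positive = ℕ.n≢0⇒n>0 λ z → ℕ.≢-nonZero⁻¹ period (Dv.0∣⇒≡0 (subst (_∣ period) z
          (power-fixes⁻ {period} (trans (•-cong x u^period) (1-• x)))))

        negates⁺ : ∀ c → Solution S c → u ^ℤ c • x ≡ sign true • x
        negates⁺ c sol = •-≡⁺ {u ^ℤ c} { - + 1} x local
          where
          local : ∀ i → lookup (type (toℕ x)) i ≡ true → u ^ℤ c ≅ - + 1 [ q i ]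
          -- Modulo 2 the numbers 1 and -1 agree, their difference being 1 times 2.
          local Fin.zero _ = ≅-trans (≅-^ c (odd-≅-1 u-inv)) (≅-trans (≅-reflexive (1^ c)) (by (+ 1) refl))
          local (Fin.suc i) t = OddPrime.neg-power⁻ (pr i) (odd i) (ed i) (e-order i) c (sol (trans (tail-lookup i) t))

        negates⁻ : ∀ c → u ^ℤ c • x ≡ sign true • x → Solution S c
        negates⁻ c eq {i} t = OddPrime.neg-power⁺ (pr i) (odd i) (ed i) (e-order i) c
          (•-≡⁻ {u ^ℤ c} { - + 1} x eq (Fin.suc i) (trans (sym (tail-lookup i)) t))

        class-size : ∣ class x ∣ ≡ alpha p d S
        class-size = trans (go (solvable S) refl) (sym (alpha-size S))
          where
          open ClassSize x (LT p d S) LT-positive power-fixes⁺ power-fixes⁻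
          go : ∀ b → solvable S ≡ b → ∣ class x ∣ ≡ size S
          go true s = trans (class-size-with-negation (proj₁ (solvable⁻ S s)) (negates⁺ (proj₁ (solvable⁻ S s)) (proj₂ (solvable⁻ S s))))
            (sym (size-true S s))
          go false s = trans (class-size-without-negation λ c eq → contradiction (trans (sym s) (solvable⁺ S c (negates⁻ c eq))) λ ())
            (sym (size-false S s))

-- Counting the elements and the orbits of each type

∏-0 : ∀ {A : Set} (xs : List A) {f : A → ℤ} {x} → x ∈ xs → f x ≡ + 0 → ∏ xs f ≡ + 0
∏-0 (y ∷ xs) {f} (here refl) h = cong (_*ℤ ∏ xs f) h
∏-0 (y ∷ xs) {f} (there x∈) h = trans (cong (f y *ℤ_) (∏-0 xs x∈ h)) (ℤ.*-zeroʳ (f y))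

∏-⟪⟫ : ∀ {n} {P : Fin n → Set} {Q : Set} (P? : ∀ i → Dec (P i)) (Q? : Dec Q) → (Q → ∀ i → P i) → ((∀ i → P i) → Q) →
  ∏ (allFin n) (λ i → ⟪ P? i ⟫) ≡ ⟪ Q? ⟫
∏-⟪⟫ {n} P? (yes q) f g = ∏-1 (allFin n) (λ {i} _ → ⟪⟫-yes (P? i) (f q i))
∏-⟪⟫ {n} P? (no nq) f g with F.¬∀⟶∃¬ n _ P? (nq ∘ g)
... | i , np = ∏-0 (allFin n) (∈-allFin i) (⟪⟫-no (P? i) np)

∑-upTo-suc : ∀ k (f : ℕ → ℤ) → ∑ (upTo (suc k)) f ≡ f 0 +ℤ ∑ (upTo k) (f ∘ suc)
∑-upTo-suc k f = cong (f 0 +ℤ_) (trans (cong (λ xs → ∑ xs f) (sym (LP.map-upTo suc k))) (∑-map suc (upTo k) f))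

∑-allFin-toℕ : ∀ n (f : ℕ → ℤ) → ∑ (allFin n) (λ x → f (toℕ x)) ≡ ∑ (upTo n) f
∑-allFin-toℕ n f = trans (sym (∑-map toℕ (allFin n) f)) (∑-↭ f (length-≤⇒↭ (U.map⁺ F.toℕ-injective (U.allFin⁺ n))
  (λ x∈ → sub (∈-map⁻ toℕ x∈))
  (ℕ.≤-reflexive (trans (LP.length-upTo n) (sym (trans (LP.length-map toℕ (allFin n)) (LP.length-tabulate {n = n} id)))))))
  where
  sub : ∀ {x} → (∃ λ y → y ∈ allFin n × x ≡ toℕ y) → x ∈ upTo n
  sub (y , _ , refl) = ∈-upTo⁺ (F.toℕ<n y)

module Counting (l : ℕ) (p : Fin l → ℕ) (pr : ∀ i → Prime (p i)) (odd : ∀ i → p i % 2 ≡ 1) (inj : Injective _≡_ _≡_ p)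
  (m : ℕ) (n-def : suc m ≡ prodF (suc l) (Setting.q l p pr odd inj)) where

  open Setting l p pr odd inj public
  open Modulus m n-def public

  type-≅ : ∀ x y i → + x ≅ + y [ q i ] → lookup (type x) i ≡ lookup (type y) i
  type-≅ x y i c = bool-cong
    (λ h → type-true⁺ y i (λ dv → type-true⁻ x i h (≅-0 {x = + x} (≅-trans c (0-≅ℕ dv)))))
    (λ h → type-true⁺ x i (λ dv → type-true⁻ y i h (≅-0 {x = + y} (≅-trans (≅-sym c) (0-≅ℕ dv)))))

  lookup-type-0 : ∀ i → lookup (type 0) i ≡ false
  lookup-type-0 i = go (lookup (type 0) i) refl
    where
    go : ∀ b → lookup (type 0) i ≡ b → b ≡ false
    go false _ = refl
    go true h = contradiction (Dv._∣0 (q i)) (type-true⁻ 0 i h)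

  -- The only multiple of `q i` among its residues is 0; the other `q i ∸ 1` residues have the bit
  -- `true`.
  residues-of-type : ∀ i b → ∑ (upTo (q i)) (λ x → ⟪ lookup (type x) i B.≟ b ⟫) ≡ (if b then + (q i ∸ 1) else + 1)
  residues-of-type i b = go (q i) refl
    where
    f : ℕ → ℤ
    f x = ⟪ lookup (type x) i B.≟ b ⟫
    finish : ∀ b k → ⟪ false B.≟ b ⟫ +ℤ + k *ℤ ⟪ true B.≟ b ⟫ ≡ (if b then + k else + 1)
    finish true k = trans (ℤ.+-identityˡ _) (ℤ.*-identityʳ (+ k))
    finish false k = cong (+ 1 +ℤ_) (ℤ.*-zeroʳ (+ k))
    go : ∀ k → q i ≡ k → ∑ (upTo k) f ≡ (if b then + (k ∸ 1) else + 1)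
    go zero e = contradiction e (ℕ.≢-nonZero⁻¹ (q i) {{q-nonZero i}})
    go (suc k) e = begin
      ∑ (upTo (suc k)) f ≡⟨ ∑-upTo-suc k f ⟩
      f 0 +ℤ ∑ (upTo k) (f ∘ suc) ≡⟨ cong₂ _+ℤ_ (cong (λ c → ⟪ c B.≟ b ⟫) (lookup-type-0 i))
          (trans (∑-cong (upTo k) λ {x} x∈ → cong (λ c → ⟪ c B.≟ b ⟫) (type-true⁺ (suc x) i (λ dv →
            contradiction (small-multiple (subst (suc x <_) (sym e) (s≤s (∈-upTo⁻ x∈))) dv) λ ())))
          (trans (∑-const (upTo k) _) (cong (λ j → + j *ℤ ⟪ true B.≟ b ⟫) (LP.length-upTo k)))) ⟩
      ⟪ false B.≟ b ⟫ +ℤ + k *ℤ ⟪ true B.≟ b ⟫ ≡⟨ finish b k ⟩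
      (if b then + k else + 1) ∎
      where open ≡-Reasoning

  prodT-∏ : ∀ (d : Fin l → ℕ) (S : Subset l) → + prodT p d S ≡ ∏ (allFin l) (λ i → if lookup S i then + (p i ∸ 1) else + 1)
  prodT-∏ d S = trans (∏-foldr (m′ p d) (elems S)) (trans (∏-filter (λ i → lookup S i B.≟ true) (allFin l) (λ i → + m′ p d i))
    (∏-cong (allFin l) (λ {i} _ → same (lookup S i))))
    where
    same : ∀ b {x} → (if does (b B.≟ true) then x else + 1) ≡ (if b then x else + 1)
    same true = refl
    same false = refl

  -- Having a given type is a condition at each prime separately, so the count is a product. The
  -- prime 2 has one residue of either parity, hence the same count for both values of b.
  count-type : ∀ (d : Fin l → ℕ) b (S : Subset l) → ∑ (allFin (suc m)) (λ x → ⟪ type (toℕ x) ≟ₛ (b ∷ S) ⟫) ≡ + prodT p d S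
  count-type d b S = begin
    ∑ (allFin (suc m)) (λ x → ⟪ type (toℕ x) ≟ₛ (b ∷ S) ⟫) ≡⟨ ∑-allFin-toℕ (suc m) (λ x → ⟪ type x ≟ₛ (b ∷ S) ⟫) ⟩
    ∑ (upTo (suc m)) (λ x → ⟪ type x ≟ₛ (b ∷ S) ⟫) ≡⟨ cong (λ n → ∑ (upTo n) (λ x → ⟪ type x ≟ₛ (b ∷ S) ⟫)) n-def ⟩
    ∑ (upTo (prodF (suc l) q)) (λ x → ⟪ type x ≟ₛ (b ∷ S) ⟫) ≡⟨ ∑-cong (upTo (prodF (suc l) q)) (λ {x} _ → sym
        (∏-⟪⟫ (λ i → lookup (type x) i B.≟ lookup (b ∷ S) i) (type x ≟ₛ (b ∷ S)) (λ e i → cong (λ T → lookup T i) e) lookup-ext)) ⟩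
    ∑ (upTo (prodF (suc l) q)) (λ x → ∏ (allFin (suc l)) (λ i → g i x))
      ≡⟨ ∑-crt (suc l) q q-nonZero q-coprime g (λ i x y c → cong (λ t → ⟪ t B.≟ lookup (b ∷ S) i ⟫) (type-≅ x y i c)) ⟩
    ∏ (allFin (suc l)) (λ i → ∑ (upTo (q i)) (g i)) ≡⟨ ∏-cong (allFin (suc l)) (λ {i} _ → residues-of-type i (lookup (b ∷ S) i)) ⟩
    ∏ (allFin (suc l)) (λ i → if lookup (b ∷ S) i then + (q i ∸ 1) else + 1)
      ≡⟨ ∏-allFin (λ i → if lookup (b ∷ S) i then + (q i ∸ 1) else + 1) ⟩
    (if b then + 1 else + 1) *ℤ ∏ (allFin l) (λ i → if lookup S i then + (p i ∸ 1) else + 1)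
      ≡⟨ cong₂ _*ℤ_ (one b) (sym (prodT-∏ d S)) ⟩
    + 1 *ℤ + prodT p d S ≡⟨ ℤ.*-identityˡ (+ prodT p d S) ⟩
    + prodT p d S ∎
    where
    open ≡-Reasoning
    g : Fin (suc l) → ℕ → ℤ
    g i x = ⟪ lookup (type x) i B.≟ lookup (b ∷ S) i ⟫
    one : ∀ b → (if b then + 1 else + 1) ≡ + 1
    one true = refl
    one false = refl

  module Classes (u : ℤ) (u-inv : Invertible u (suc m)) (d : Fin l → ℕ) (u-index : ∀ i → PrimeIndex.Index (p i) (pr i) u (d i)) where

    open Unit u u-inv d u-index public

    τ : Fin (suc m) → Subset (suc l)
    τ x = type (toℕ x)

    related-type : ∀ {x y} → Related x y → τ x ≡ τ y
    related-type {x} {y} r with related-elim r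
    ... | s , j , e = sym (trans (cong τ (sym e)) (type-• (invertible-inverse {multiplier s (inverse-exponent j)} (multiplier-inverse s j)) x))

    class-sum : ∀ r → ∑ (allFin (suc m)) (λ x → ⟪ related? r x ⟫) ≡ + ∣ class r ∣
    class-sum r = sym (trans (∣∣-count (class r)) (∑-cong (allFin (suc m)) (λ {x} _ → ⟪⟫-cong (lookup (class r) x B.≟ true) (related? r x)
      (λ h → does-true (related? r x) (trans (sym (lookup-class r x)) h))
      (λ h → trans (lookup-class r x) (dec-true (related? r x) h)))))

    rep-sum : ∀ x → ∑ reps (λ r → ⟪ related? r x ⟫) ≡ + 1
    rep-sum x = go (∑-reps (∈-allFin x) (λ r → ⟪ related? r x ⟫) (λ {r} _ n → ⟪⟫-no (related? r x) (n ∘ related-sym)))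
      where
      go : (∃ λ r → r ∈ reps × Related x r × ∑ reps (λ r → ⟪ related? r x ⟫) ≡ ⟪ related? r x ⟫) → ∑ reps (λ r → ⟪ related? r x ⟫) ≡ + 1
      go (r , _ , xr , e) = trans e (⟪⟫-yes (related? r x) (related-sym xr))

    repsOf : Subset (suc l) → List (Fin (suc m))
    repsOf S = filter (λ r → τ r ≟ₛ S) reps

    -- Pairs of an element of the type and a representative related to it are counted twice: each
    -- element has one representative, and each class keeps to one type and has `alpha p d S`
    -- elements.
    reps-count : ∀ b S → + prodT p d S ≡ + length (repsOf (b ∷ S)) *ℤ + alpha p d S
    reps-count b S = begin
      + prodT p d S ≡⟨ sym (count-type d b S) ⟩
      ∑ xs (λ x → ⟪ τ x ≟ₛ bS ⟫)
        ≡⟨ ∑-cong xs (λ {x} _ → trans (sym (ℤ.*-identityʳ ⟪ τ x ≟ₛ bS ⟫)) (trans (cong (⟪ τ x ≟ₛ bS ⟫ *ℤ_) (sym (rep-sum x)))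
             (sym (∑-*ˡ ⟪ τ x ≟ₛ bS ⟫ reps (λ r → ⟪ related? r x ⟫))))) ⟩
      ∑ xs (λ x → ∑ reps (λ r → ⟪ τ x ≟ₛ bS ⟫ *ℤ ⟪ related? r x ⟫)) ≡⟨ ∑-swap xs reps (λ x r → ⟪ τ x ≟ₛ bS ⟫ *ℤ ⟪ related? r x ⟫) ⟩
      ∑ reps (λ r → ∑ xs (λ x → ⟪ τ x ≟ₛ bS ⟫ *ℤ ⟪ related? r x ⟫))
        ≡⟨ ∑-cong reps (λ {r} _ → trans (∑-cong xs (λ {x} _ → swap-type r x))
             (trans (∑-*ˡ ⟪ τ r ≟ₛ bS ⟫ xs (λ x → ⟪ related? r x ⟫)) (trans (cong (⟪ τ r ≟ₛ bS ⟫ *ℤ_) (class-sum r))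
             (⟪⟫-*-cong (τ r ≟ₛ bS) (λ e → cong +_ (trans (class-size r) (cong (λ T → alpha p d (Vec.tail T)) e))))))) ⟩
      ∑ reps (λ r → ⟪ τ r ≟ₛ bS ⟫ *ℤ + alpha p d S) ≡⟨ sym (∑-⟪⟫-filter (λ r → τ r ≟ₛ bS) reps (λ _ → + alpha p d S)) ⟩
      ∑ (repsOf bS) (λ _ → + alpha p d S) ≡⟨ ∑-const (repsOf bS) (+ alpha p d S) ⟩
      + length (repsOf bS) *ℤ + alpha p d S ∎
      where
      open ≡-Reasoning
      xs = allFin (suc m)
      bS = b ∷ S
      swap-type : ∀ r x → ⟪ τ x ≟ₛ bS ⟫ *ℤ ⟪ related? r x ⟫ ≡ ⟪ τ r ≟ₛ bS ⟫ *ℤ ⟪ related? r x ⟫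
      swap-type r x = trans (ℤ.*-comm ⟪ τ x ≟ₛ bS ⟫ ⟪ related? r x ⟫) (trans
        (⟪⟫-*-cong (related? r x) (λ h → cong (λ T → ⟪ T ≟ₛ bS ⟫) (sym (related-type h))))
        (ℤ.*-comm ⟪ related? r x ⟫ ⟪ τ r ≟ₛ bS ⟫))

    -- The division is exact, and its divisor is nonzero because it divides a product of the
    -- positive numbers p_i - 1.
    length-repsOf : ∀ b S → div (prodT p d S) (alpha p d S) ≡ length (repsOf (b ∷ S))
    length-repsOf b S = trans (cong (λ z → div z (alpha p d S)) total) (div-* (length (repsOf (b ∷ S))) positive)
      where
      total : prodT p d S ≡ length (repsOf (b ∷ S)) * alpha p d S
      total = ℤ.+-injective (trans (reps-count b S) (sym (ℤ.pos-* (length (repsOf (b ∷ S))) (alpha p d S))))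
      positive : 0 < alpha p d S
      positive = ℕ.n≢0⇒n>0 λ z → ℕ.<⇒≢ (product-list-positive (m′ p d) (elems S) 0<m′)
        (sym (trans total (trans (cong (length (repsOf (b ∷ S)) *_) z) (ℕ.*-zeroʳ (length (repsOf (b ∷ S)))))))

    ∏-repsOf : ∀ b S → ∏ₚ (repsOf (b ∷ S)) binomial ≈ₚ fT p d S
    ∏-repsOf b S = ≈ₚ-trans (∏ₚ-cong (repsOf (b ∷ S)) (λ {r} r∈ → ≈ₚ-reflexive (cong (λ j → padd pone (xpow j))
        (trans (class-size r) (cong (λ T → alpha p d (Vec.tail T)) (proj₂ (∈-filter⁻ (λ r → τ r ≟ₛ (b ∷ S)) {xs = reps} r∈)))))))
      (≈ₚ-reflexive (trans (ppow-length (padd pone (xpow (alpha p d S))) (repsOf (b ∷ S)))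
        (cong (ppow (padd pone (xpow (alpha p d S)))) (sym (length-repsOf b S)))))

    ofTypes? : ∀ (ts : List (Subset (suc l))) x → Dec (τ x ∈ ts)
    ofTypes? ts x = any? (τ x ≟ₛ_) ts

    -- Grouping the representatives by type turns the product over classes into one factor f_T for
    -- each type in `ts`, with the parity forgotten.
    ∏-types : ∀ ts → Unique ts → ∏ₚ (filter (ofTypes? ts) reps) binomial ≈ₚ ∏ₚ ts (λ S → fT p d (Vec.tail S))
    ∏-types ts u-ts = ≈ₚ-trans
      (∏ₚ-fibres _≟ₛ_ τ (filter (ofTypes? ts) reps) ts binomial u-ts (λ {x} x∈ → proj₂ (∈-filter⁻ (ofTypes? ts) {xs = reps} x∈)))
      (∏ₚ-cong ts (λ {S} S∈ → ≈ₚ-trans (∏ₚ-↭ binomial (unique⇒↭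
          (U.filter⁺ (λ r → τ r ≟ₛ S) (U.filter⁺ (ofTypes? ts) reps-unique)) (U.filter⁺ (λ r → τ r ≟ₛ S) reps-unique) (to S) (from S S∈)))
        (split S)))
      where
      split : ∀ S → ∏ₚ (repsOf S) binomial ≈ₚ fT p d (Vec.tail S)
      split (b ∷ S) = ∏-repsOf b S
      to : ∀ S {r} → r ∈ filter (λ r → τ r ≟ₛ S) (filter (ofTypes? ts) reps) → r ∈ repsOf S
      to S r∈ with ∈-filter⁻ (λ r → τ r ≟ₛ S) {xs = filter (ofTypes? ts) reps} r∈
      ... | r∈′ , e = ∈-filter⁺ (λ r → τ r ≟ₛ S) (proj₁ (∈-filter⁻ (ofTypes? ts) {xs = reps} r∈′)) e
      from : ∀ S → S ∈ ts → ∀ {r} → r ∈ repsOf S → r ∈ filter (λ r → τ r ≟ₛ S) (filter (ofTypes? ts) reps)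
      from S S∈ {r} r∈ with ∈-filter⁻ (λ r → τ r ≟ₛ S) {xs = reps} r∈
      ... | r∈′ , e = ∈-filter⁺ (λ r → τ r ≟ₛ S) (∈-filter⁺ (ofTypes? ts) r∈′ (subst (_∈ ts) (sym e) S∈)) e

-- Inclusion-exclusion over prime factors

-- The product is multiplied out, R being the set of factors from which -a_i is taken.
moebius : ∀ n (a : Fin n → ℤ) →
  ∑ (allSubsets n) (λ R → sgn ∣ R ∣ *ℤ ∏ (allFin n) (λ i → if lookup R i then a i else + 1)) ≡ ∏ (allFin n) (λ i → + 1 -ℤ a i)
moebius zero a = refl
moebius (suc n) a = begin
  ∑ (allSubsets (suc n)) f ≡⟨ ∑-concatMap (λ s → (outside ∷ s) ∷ (inside ∷ s) ∷ []) (allSubsets n) f ⟩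
  ∑ (allSubsets n) (λ s → f (outside ∷ s) +ℤ (f (inside ∷ s) +ℤ + 0)) ≡⟨ ∑-cong (allSubsets n) (λ {s} _ → pair s) ⟩
  ∑ (allSubsets n) (λ s → (+ 1 -ℤ a Fin.zero) *ℤ g s) ≡⟨ ∑-*ˡ (+ 1 -ℤ a Fin.zero) (allSubsets n) g ⟩
  (+ 1 -ℤ a Fin.zero) *ℤ ∑ (allSubsets n) g ≡⟨ cong ((+ 1 -ℤ a Fin.zero) *ℤ_) (moebius n (a ∘ Fin.suc)) ⟩
  (+ 1 -ℤ a Fin.zero) *ℤ ∏ (allFin n) (λ i → + 1 -ℤ a (Fin.suc i)) ≡⟨ sym (∏-allFin (λ i → + 1 -ℤ a i)) ⟩
  ∏ (allFin (suc n)) (λ i → + 1 -ℤ a i) ∎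
  where
  open ≡-Reasoning
  pr : Subset n → ℤ
  pr s = ∏ (allFin n) (λ i → if lookup s i then a (Fin.suc i) else + 1)
  g : Subset n → ℤ
  g s = sgn ∣ s ∣ *ℤ pr s
  f : Subset (suc n) → ℤ
  f R = sgn ∣ R ∣ *ℤ ∏ (allFin (suc n)) (λ i → if lookup R i then a i else + 1)
  combine : ∀ s x a → s *ℤ (+ 1 *ℤ x) +ℤ ((- s) *ℤ (a *ℤ x) +ℤ + 0) ≡ (+ 1 -ℤ a) *ℤ (s *ℤ x)
  combine = solve-∀
  pair : ∀ s → f (outside ∷ s) +ℤ (f (inside ∷ s) +ℤ + 0) ≡ (+ 1 -ℤ a Fin.zero) *ℤ g s
  pair s = trans (cong₂ (λ x y → sgn ∣ s ∣ *ℤ x +ℤ ((- sgn ∣ s ∣) *ℤ y +ℤ + 0))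
      (∏-allFin (λ i → if lookup (outside ∷ s) i then a i else + 1)) (∏-allFin (λ i → if lookup (inside ∷ s) i then a i else + 1)))
    (combine (sgn ∣ s ∣) (pr s) (a Fin.zero))

Nonempty : ∀ {n} → Subset n → Set
Nonempty S = ∃ λ i → lookup S i ≡ true

∣∣-positive⁺ : ∀ {n} (S : Subset n) → Nonempty S → 1 ≤ ∣ S ∣
∣∣-positive⁺ (true ∷ S) _ = s≤s z≤n
∣∣-positive⁺ (false ∷ S) (Fin.suc i , h) = ∣∣-positive⁺ S (i , h)

∣∣-positive⁻ : ∀ {n} (S : Subset n) → 1 ≤ ∣ S ∣ → Nonempty S
∣∣-positive⁻ (true ∷ S) _ = Fin.zero , refl
∣∣-positive⁻ (false ∷ S) h with ∣∣-positive⁻ S h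
... | i , e = Fin.suc i , e

record Avoids {n : ℕ} (R S : Subset n) : Set where
  constructor avoiding
  field avoid : ∀ i → lookup R i ≡ true → lookup S i ≡ false
open Avoids

avoids-tail : ∀ {n r b} {R S : Subset n} → Avoids (r ∷ R) (b ∷ S) → Avoids R S
avoids-tail av = avoiding (avoid av ∘ Fin.suc)

disjoint⁺ : ∀ {n} (S R : Subset n) → Avoids R S → disjoint S R ≡ true
disjoint⁺ {n} S R (avoiding h) = all-true⁺ (λ i → not (lookup S i ∧ lookup R i)) (allFin n) (λ {i} _ → go (lookup S i) (lookup R i) (h i))
  where
  go : ∀ s r → (r ≡ true → s ≡ false) → not (s ∧ r) ≡ true
  go true true h = contradiction (h refl) λ ()
  go true false h = refl
  go false _ h = refl

disjoint⁻ : ∀ {n} (S R : Subset n) → disjoint S R ≡ true → Avoids R S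
disjoint⁻ {n} S R h = avoiding λ i → go (lookup S i) (lookup R i) (all-true⁻ (λ i → not (lookup S i ∧ lookup R i)) (allFin n) h (∈-allFin i))
  where
  go : ∀ s r → not (s ∧ r) ≡ true → r ≡ true → s ≡ false
  go false _ _ _ = refl
  go true true () _

oddTypes? : ∀ {l} (R T : Subset l) → Dec (1 ≤ ∣ T ∣ × disjoint T R ≡ true)
oddTypes? R T = (1 ℕ.≤? ∣ T ∣) ×-dec (disjoint T R B.≟ true)

oddTypes : ∀ {l} → Subset l → List (Subset l)
oddTypes {l} R = filter (oddTypes? R) (allSubsets l)

oddTypes-unique : ∀ {l} (R : Subset l) → Unique (oddTypes R)
oddTypes-unique {l} R = U.filter⁺ (oddTypes? R) (allSubsets-unique l)

∈-oddTypes⁺ : ∀ {l} {R S : Subset l} → Nonempty S → Avoids R S → S ∈ oddTypes R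
∈-oddTypes⁺ {R = R} {S} ne av = ∈-filter⁺ (oddTypes? R) (allSubsets-complete S) (∣∣-positive⁺ S ne , disjoint⁺ S R av)

∈-oddTypes⁻ : ∀ {l} {R S : Subset l} → S ∈ oddTypes R → Nonempty S × Avoids R S
∈-oddTypes⁻ {l} {R} {S} S∈ with ∈-filter⁻ (oddTypes? R) {xs = allSubsets l} S∈
... | _ , c , dj = ∣∣-positive⁻ S c , disjoint⁻ S R dj

empty : ∀ l → Subset l
empty l = Vec.replicate l false

-- The types of the elements that a set may contain when the primes in R must divide all its
-- elements. If 2 is among them the parity bit is `false`; otherwise both parities occur, together
-- with the type {2}, that of n/2. The empty type, that of 0, is left out.
types : ∀ {l} → Subset (suc l) → List (Subset (suc l))
types (true ∷ R) = map (false ∷_) (oddTypes R)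
types {l} (false ∷ R) = (true ∷ empty l) ∷ map (false ∷_) (oddTypes R) ++ map (true ∷_) (oddTypes R)

types-unique : ∀ {l} (R : Subset (suc l)) → Unique (types R)
types-unique (true ∷ R) = U.map⁺ V.∷-injectiveʳ (oddTypes-unique R)
types-unique {l} (false ∷ R) = All.tabulate fresh ∷
  U.++⁺ (U.map⁺ V.∷-injectiveʳ (oddTypes-unique R)) (U.map⁺ V.∷-injectiveʳ (oddTypes-unique R)) disj
  where
  disj : ∀ {S} → S ∈ map (false ∷_) (oddTypes R) × S ∈ map (true ∷_) (oddTypes R) → ⊥
  disj (a , b) with ∈-map⁻ (false ∷_) a | ∈-map⁻ (true ∷_) b
  ... | _ , _ , refl | _ , _ , ()
  nonempty : ∀ {S} → Nonempty S → empty l ≢ S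
  nonempty (i , h) refl = contradiction (trans (sym h) (V.lookup-replicate i false)) λ ()
  fresh : ∀ {S} → S ∈ map (false ∷_) (oddTypes R) ++ map (true ∷_) (oddTypes R) → true ∷ empty l ≢ S
  fresh S∈ e with ∈-++⁻ (map (false ∷_) (oddTypes R)) S∈
  ... | inj₁ a with ∈-map⁻ (false ∷_) a
  ... | _ , _ , refl = contradiction e λ ()
  fresh S∈ e | inj₂ b with ∈-map⁻ (true ∷_) b
  ... | S , h , refl = nonempty (proj₁ (∈-oddTypes⁻ {R = R} h)) (V.∷-injectiveʳ e)

∈-types⁺ : ∀ {l} (R S : Subset (suc l)) → Nonempty S → Avoids R S → S ∈ types R
∈-types⁺ (true ∷ R) (b ∷ S) ne av with avoid av Fin.zero refl
∈-types⁺ (true ∷ R) (false ∷ S) (Fin.suc i , h) av | refl = ∈-map⁺ (false ∷_) (∈-oddTypes⁺ (i , h) (avoids-tail av))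
∈-types⁺ {l} (false ∷ R) (b ∷ S) ne av = go (1 ℕ.≤? ∣ S ∣) b ne
  where
  go : Dec (1 ≤ ∣ S ∣) → ∀ b → Nonempty (b ∷ S) → (b ∷ S) ∈ types (false ∷ R)
  go (yes c) false _ = there (∈-++⁺ˡ (∈-map⁺ (false ∷_) (∈-oddTypes⁺ (∣∣-positive⁻ S c) (avoids-tail av))))
  go (yes c) true _ = there (∈-++⁺ʳ (map (false ∷_) (oddTypes R)) (∈-map⁺ (true ∷_) (∈-oddTypes⁺ (∣∣-positive⁻ S c) (avoids-tail av))))
  go (no n) false (Fin.suc i , h) = contradiction (∣∣-positive⁺ S (i , h)) n
  go (no n) true _ = here (cong (true ∷_) (lookup-ext λ i → bool-cong
    (λ h → contradiction (∣∣-positive⁺ S (i , h)) n)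
    (λ h → contradiction (trans (sym h) (V.lookup-replicate i false)) λ ())))

avoids-∷ : ∀ {n r b} {R S : Subset n} → (r ≡ true → b ≡ false) → Avoids R S → Avoids (r ∷ R) (b ∷ S)
avoids-∷ h av = avoiding λ { Fin.zero → h ; (Fin.suc i) → avoid av i }

nonempty-∷ : ∀ {n b} {S : Subset n} → Nonempty S → Nonempty (b ∷ S)
nonempty-∷ (i , h) = Fin.suc i , h

∈-types⁻ : ∀ {l} (R : Subset (suc l)) {S} → S ∈ types R → Nonempty S × Avoids R S
∈-types⁻ (true ∷ R) S∈ with ∈-map⁻ (false ∷_) S∈
... | S , h , refl = nonempty-∷ (proj₁ (∈-oddTypes⁻ {R = R} h)) , avoids-∷ (λ _ → refl) (proj₂ (∈-oddTypes⁻ {R = R} h))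
∈-types⁻ (false ∷ R) (here refl) = (Fin.zero , refl) , avoids-∷ (λ ()) (avoiding λ i _ → V.lookup-replicate i false)
∈-types⁻ (false ∷ R) (there S∈) with ∈-++⁻ (map (false ∷_) (oddTypes R)) S∈
... | inj₁ a with ∈-map⁻ (false ∷_) a
... | S , h , refl = nonempty-∷ (proj₁ (∈-oddTypes⁻ {R = R} h)) , avoids-∷ (λ ()) (proj₂ (∈-oddTypes⁻ {R = R} h))
∈-types⁻ (false ∷ R) (there S∈) | inj₂ a with ∈-map⁻ (true ∷_) a
... | S , h , refl = nonempty-∷ (proj₁ (∈-oddTypes⁻ {R = R} h)) , avoids-∷ (λ ()) (proj₂ (∈-oddTypes⁻ {R = R} h))

FR-∏ : ∀ {l} (p d : Fin l → ℕ) R → FR p d R ≡ ∏ₚ (oddTypes R) (fT p d)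
FR-∏ p d R = pprod-∏ₚ (fT p d) (oddTypes R)

elems-empty : ∀ l → elems (empty l) ≡ []
elems-empty l = go (elems (empty l)) (λ i∈ → ∈-elems⁻ (empty l) i∈)
  where
  go : ∀ is → (∀ {i} → i ∈ is → lookup (empty l) i ≡ true) → is ≡ []
  go [] h = refl
  go (i ∷ is) h = contradiction (trans (sym (h (here refl))) (V.lookup-replicate i false)) λ ()

-- For empty T both conditions hold vacuously (the search range is {0}, the empty product being 1),
-- and the empty least common multiple is 1.
alpha-[]≡1 : ∀ {l} (p d : Fin l → ℕ) S → elems S ≡ [] → alpha p d S ≡ 1
alpha-[]≡1 p d S e rewrite e | e = refl

fT-[] : ∀ {l} (p d : Fin l → ℕ) S → elems S ≡ [] → fT p d S ≡ pmul (padd pone (xpow 1)) pone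
fT-[] p d S e = trans (cong (λ a → ppow (padd pone (xpow a)) (div (prodT p d S) a)) (alpha-[]≡1 p d S e))
  (cong (λ is → ppow (padd pone (xpow 1)) (div (foldr _*_ 1 (map (m′ p d) is)) 1)) e)

-- The product of the factors f_T over `types R`. The square comes from the two parities of each
-- nonempty set of odd primes.
genfun : ∀ {l} (p d : Fin l → ℕ) → Subset (suc l) → Poly
genfun p d (true ∷ R) = FR p d R
genfun p d (false ∷ R) = pmul (padd pone (xpow 1)) (pmul (FR p d R) (FR p d R))

∏-types-genfun : ∀ {l} (p d : Fin l → ℕ) R → ∏ₚ (types R) (λ S → fT p d (Vec.tail S)) ≈ₚ genfun p d R
∏-types-genfun p d (true ∷ R) = ≈ₚ-trans (∏ₚ-map (false ∷_) (oddTypes R) (λ S → fT p d (Vec.tail S))) (≈ₚ-reflexive (sym (FR-∏ p d R)))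
∏-types-genfun {l} p d (false ∷ R) = pmul-cong
  (≈ₚ-trans (≈ₚ-reflexive (fT-[] p d (empty l) (elems-empty l))) (pmul-identityʳ (padd pone (xpow 1))))
  (≈ₚ-trans (∏ₚ-++ (map (false ∷_) (oddTypes R)) (map (true ∷_) (oddTypes R)) (λ S → fT p d (Vec.tail S)))
    (pmul-cong (half false) (half true)))
  where
  half : ∀ b → ∏ₚ (map (b ∷_) (oddTypes R)) (λ S → fT p d (Vec.tail S)) ≈ₚ FR p d R
  half b = ≈ₚ-trans (∏ₚ-map (b ∷_) (oddTypes R) (λ S → fT p d (Vec.tail S))) (≈ₚ-reflexive (sym (FR-∏ p d R)))

full : ∀ l → Subset l
full l = Vec.replicate l true

∣full∣ : ∀ l → ∣ full l ∣ ≡ l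
∣full∣ = FS.∣⊤∣≡n

oddTypes-full : ∀ l → oddTypes (full l) ≡ []
oddTypes-full l = go (oddTypes (full l)) (λ S∈ → ∈-oddTypes⁻ S∈)
  where
  go : ∀ Ss → (∀ {S} → S ∈ Ss → Nonempty S × Avoids (full l) S) → Ss ≡ []
  go [] h = refl
  go (S ∷ Ss) h with h (here refl)
  ... | (i , e) , av = contradiction (trans (sym e) (avoid av i (V.lookup-replicate i true))) λ ()

FR-full : ∀ {l} (p d : Fin l → ℕ) → FR p d (full l) ≡ pone
FR-full {l} p d = trans (FR-∏ p d (full l)) (cong (λ Ss → ∏ₚ Ss (fT p d)) (oddTypes-full l))

bracketTerm : ∀ {l} (p d : Fin l → ℕ) → Subset l → Poly
bracketTerm p d R = pscale (sgn ∣ R ∣) (psub (pmul (padd pone (xpow 1)) (pmul (FR p d R) (FR p d R))) (FR p d R))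

-- The summand R = {1, …, ℓ} is (-1)^ℓ ((1 + x) - 1), the isolated term of the bracket.
coeff-bracket : ∀ {l} (p d : Fin l → ℕ) → 1 ≤ l → ∀ k →
  coeff k (bracket p d) ≡ ∑ (allSubsets (suc l)) (λ R → sgn ∣ R ∣ *ℤ coeff k (genfun p d R))
coeff-bracket {l} p d 1≤l k = sym (begin
  ∑ (allSubsets (suc l)) (λ R → sgn ∣ R ∣ *ℤ coeff k (genfun p d R))
    ≡⟨ ∑-concatMap (λ s → (outside ∷ s) ∷ (inside ∷ s) ∷ []) (allSubsets l) (λ R → sgn ∣ R ∣ *ℤ coeff k (genfun p d R)) ⟩
  ∑ (allSubsets l) (λ s → sgn ∣ s ∣ *ℤ coeff k (genfun p d (false ∷ s)) +ℤ ((- sgn ∣ s ∣) *ℤ coeff k (genfun p d (true ∷ s)) +ℤ + 0))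
    ≡⟨ ∑-cong (allSubsets l) (λ {s} _ → pair s) ⟩
  ∑ (allSubsets l) F ≡⟨ ∑-cong (allSubsets l) (λ {R} _ → split (small? R) (F R)) ⟩
  ∑ (allSubsets l) (λ R → (if does (small? R) then F R else + 0) +ℤ (if does (small? R) then + 0 else F R))
    ≡⟨ ∑-+ (allSubsets l) (λ R → if does (small? R) then F R else + 0) (λ R → if does (small? R) then + 0 else F R) ⟩
  ∑ (allSubsets l) (λ R → if does (small? R) then F R else + 0) +ℤ ∑ (allSubsets l) (λ R → if does (small? R) then + 0 else F R)
    ≡⟨ cong₂ _+ℤ_ (sym (∑-filter small? (allSubsets l) F)) (trans (∑-single {f = λ R → if does (small? R) then + 0 else F R}
         (allSubsets-unique l) (allSubsets-complete (full l)) (λ {R} _ n → if-yes (small? R) (not-full R n))) (if-no (small? (full l)) full-large)) ⟩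
  ∑ (filter small? (allSubsets l)) F +ℤ F (full l)
    ≡⟨ cong₂ _+ℤ_ (sym (coeff-psum k (bracketTerm p d) (filter small? (allSubsets l)))) F-full ⟩
  coeff k (psum (map (bracketTerm p d) (filter small? (allSubsets l)))) +ℤ coeff k (pscale (sgn l) (xpow 1))
    ≡⟨ ℤ.+-comm (coeff k (psum (map (bracketTerm p d) (filter small? (allSubsets l))))) (coeff k (pscale (sgn l) (xpow 1))) ⟩
  coeff k (pscale (sgn l) (xpow 1)) +ℤ coeff k (psum (map (bracketTerm p d) (filter small? (allSubsets l))))
    ≡⟨ sym (coeff-padd k (pscale (sgn l) (xpow 1)) (psum (map (bracketTerm p d) (filter small? (allSubsets l))))) ⟩
  coeff k (bracket p d) ∎)
  where
  open ≡-Reasoning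
  small? : ∀ R → Dec (∣ R ∣ ≤ l ∸ 1)
  small? R = ∣ R ∣ ℕ.≤? l ∸ 1
  F : Subset l → ℤ
  F R = coeff k (bracketTerm p d R)
  F-expand : ∀ R → F R ≡ sgn ∣ R ∣ *ℤ (coeff k (genfun p d (false ∷ R)) -ℤ coeff k (FR p d R))
  F-expand R = trans (coeff-pscale k (sgn ∣ R ∣) (psub (pmul (padd pone (xpow 1)) (pmul (FR p d R) (FR p d R))) (FR p d R))) (cong (sgn ∣ R ∣ *ℤ_) (coeff-psub k (genfun p d (false ∷ R)) (FR p d R)))
  dist : ∀ s a b → s *ℤ a +ℤ ((- s) *ℤ b +ℤ + 0) ≡ s *ℤ (a -ℤ b)
  dist = solve-∀
  pair : ∀ s → sgn ∣ s ∣ *ℤ coeff k (genfun p d (false ∷ s)) +ℤ ((- sgn ∣ s ∣) *ℤ coeff k (genfun p d (true ∷ s)) +ℤ + 0) ≡ F s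
  pair s = trans (dist (sgn ∣ s ∣) (coeff k (genfun p d (false ∷ s))) (coeff k (FR p d s))) (sym (F-expand s))
  split : {P : Set} (P? : Dec P) (x : ℤ) → x ≡ (if does P? then x else + 0) +ℤ (if does P? then + 0 else x)
  split (yes _) x = sym (ℤ.+-identityʳ x)
  split (no _) x = sym (ℤ.+-identityˡ x)
  if-yes : {P : Set} (P? : Dec P) {x : ℤ} → P → (if does P? then + 0 else x) ≡ + 0
  if-yes (yes _) _ = refl
  if-yes (no n) h = contradiction h n
  if-no : {P : Set} (P? : Dec P) {x : ℤ} → ¬ P → (if does P? then + 0 else x) ≡ x
  if-no (yes h) n = contradiction h n
  if-no (no _) _ = refl
  -- At l = 0 truncated subtraction would give 0 and the full set would count as small; this is
  -- where 1 ≤ l enters.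
  pred< : l ∸ 1 < l
  pred< = ℕ.∸-monoʳ-< {l} {1} {0} (s≤s z≤n) 1≤l
  full-large : ¬ ∣ full l ∣ ≤ l ∸ 1
  full-large h = ℕ.<⇒≱ pred< (subst (_≤ l ∸ 1) (∣full∣ l) h)
  not-full : ∀ R → R ≢ full l → ∣ R ∣ ≤ l ∸ 1
  not-full R n = ℕ.m+n≤o⇒m≤o∸n ∣ R ∣ (subst (_≤ l) (ℕ.+-comm 1 ∣ R ∣) (ℕ.≤∧≢⇒< (FS.∣p∣≤n R) (λ e → n (FS.∣p∣≡n⇒p≡⊤ e))))
  minus-one : ∀ a b → (a +ℤ b) -ℤ a ≡ b
  minus-one = solve-∀
  F-full : F (full l) ≡ coeff k (pscale (sgn l) (xpow 1))
  F-full = trans (F-expand (full l)) (trans (cong₂ _*ℤ_ (cong sgn (∣full∣ l)) (trans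
      (cong (λ f → coeff k (pmul (padd pone (xpow 1)) (pmul f f)) -ℤ coeff k f) (FR-full p d))
      (trans (cong (_-ℤ coeff k pone) (trans (at (≈ₚ-trans (pmul-congʳ (padd pone (xpow 1)) (pmul-identityʳ pone)) (pmul-identityʳ (padd pone (xpow 1)))) k)
        (coeff-padd k pone (xpow 1)))) (minus-one (coeff k pone) (coeff k (xpow 1))))))
    (sym (coeff-pscale k (sgn l) (xpow 1))))

-- Connection sets fixed by a unit

module Connection (l : ℕ) (p : Fin l → ℕ) (pr : ∀ i → Prime (p i)) (odd : ∀ i → p i % 2 ≡ 1) (inj : Injective _≡_ _≡_ p)
  (m : ℕ) (n-def : suc m ≡ prodF (suc l) (Setting.q l p pr odd inj)) where

  open Counting l p pr odd inj m n-def public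

  Divides : Subset (suc m) → Fin (suc l) → Set
  Divides Ω i = ∀ x → lookup Ω x ≡ true → q i ∣ toℕ x

  divides? : ∀ Ω i → Dec (Divides Ω i)
  divides? Ω i = F.all? (λ x → (lookup Ω x B.≟ true) →-dec (q i ∣? toℕ x))

  -- A decidable form of `ConnectionSet`: generation, an inductive condition, is replaced by
  -- indivisibility by the prime factors of n.
  record Conn (Ω : Subset (suc m)) : Set where
    constructor conn
    field
      indivisible : ∀ i → ¬ Divides Ω i
      symmetric : pull (- + 1) Ω ≡ Ω
      zero∉ : lookup Ω Fin.zero ≡ false
  open Conn

  conn? : ∀ Ω → Dec (Conn Ω)
  conn? Ω = map′ (λ (a , b , c) → conn a b c) (λ c → indivisible c , symmetric c , zero∉ c)
    (F.all? (λ i → ¬? (divides? Ω i)) ×-dec ((pull (- + 1) Ω ≟ₛ Ω) ×-dec (lookup Ω Fin.zero B.≟ false)))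

  Gen-divides : ∀ {Ω} i → Divides Ω i → ∀ {y} → Gen Ω y → ⟦ y ⟧ ≅ + 0 [ q i ]
  Gen-divides i h (gen-zero x z) = ≅-reflexive (cong +_ z)
  Gen-divides i h (gen-mem x x∈) = 0-≅ℕ (h x (∈ₛ⇒lookup x∈))
  Gen-divides i h (gen-neg x g) = ≅-trans (≅-weaken (q∣n i) (⟦⊝⟧ x)) (≅-neg (Gen-divides i h g))
  Gen-divides i h (gen-add x y g g′) = ≅-trans (≅-weaken (q∣n i) (⟦⊕⟧ x y)) (≅-+ (Gen-divides i h g) (Gen-divides i h g′))

  1≇0 : ∀ i → ¬ + 1 ≅ + 0 [ q i ]
  1≇0 i = PrimeIndex.invertible-non-multiple (q i) (q-prime i) (+ 1 , ≅-refl)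

  lookup-neg : ∀ (Ω : Subset (suc m)) x → lookup (pull (- + 1) Ω) x ≡ lookup Ω (⊝ x)
  lookup-neg Ω x = trans (lookup-pull (- + 1) Ω x) (cong (lookup Ω) (neg-• x))

  ConnectionSet⇒Conn : ∀ {Ω} → ConnectionSet Ω → Conn Ω
  ConnectionSet⇒Conn {Ω} (gen , neg , zer) = conn
    -- A prime factor of n dividing all of Ω would divide everything generated, in particular 1.
    (λ i h → 1≇0 i (≅-trans (≅-sym (≅-weaken (q∣n i) (res-≅ (+ 1)))) (Gen-divides i h (gen (res (+ 1))))))
    (lookup-ext λ x → trans (lookup-neg Ω x) (bool-cong
      (λ h → subst (λ y → lookup Ω y ≡ true) (neg-neg x) (∈ₛ⇒lookup (neg (⊝ x) (lookup⇒∈ₛ h))))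
      (λ h → ∈ₛ⇒lookup (neg x (lookup⇒∈ₛ h)))))
    (B.¬-not (λ h → zer Fin.zero refl (lookup⇒∈ₛ h)))
    where
    neg-neg : ∀ (x : Fin (suc m)) → ⊝ (⊝ x) ≡ x
    neg-neg x = ⟦⟧-injective (≅-trans (⟦⊝⟧ (⊝ x)) (≅-trans (≅-neg (⟦⊝⟧ x)) (≅-reflexive (ℤ.neg-involutive ⟦ x ⟧))))

  non-multiple-coprime : ∀ i {a} → ¬ q i ∣ a → Coprime a (q i)
  non-multiple-coprime i {a} n {c} (c∣a , c∣q) = go (Pr.prime⇒irreducible (q-prime i) c∣q)
    where
    go : c ≡ 1 ⊎ c ≡ q i → c ≡ 1
    go (inj₁ e) = e
    go (inj₂ refl) = contradiction c∣a n

  -- Prime to every `q i`, g is prime to their product n; as it also divides n, it is 1.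
  prime-factor : ∀ {g} → g ∣ suc m → (∀ i → ¬ q i ∣ g) → g ≡ 1
  prime-factor {g} g∣n h = coprime-prodF (suc l) {g} q (λ i → non-multiple-coprime i (h i)) (Dv.∣-refl , subst (g ∣_) n-def g∣n)

  module _ (Ω : Subset (suc m)) where

    -- Generation is transferred to integers, where Bézout's identity can be applied directly.
    Reach : ℤ → Set
    Reach z = Gen Ω (res z)

    reach-0 : ∀ {z} → z ≅ + 0 [ suc m ] → Reach z
    reach-0 {z} h = gen-zero (res z) (≅-small (F.toℕ<n (res {m} z)) (s≤s z≤n) (≅-trans (res-≅ z) h))

    reach-+ : ∀ a b → Reach a → Reach b → Reach (a +ℤ b)
    reach-+ a b ga gb = subst (Gen Ω) (⟦⟧-injective (≅-trans (⟦⊕⟧ (res a) (res b)) (≅-trans (≅-+ (res-≅ a) (res-≅ b)) (≅-sym (res-≅ (a +ℤ b))))))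
      (gen-add (res a) (res b) ga gb)

    reach-neg : ∀ a → Reach a → Reach (- a)
    reach-neg a g = subst (Gen Ω) (⟦⟧-injective (≅-trans (⟦⊝⟧ (res a)) (≅-trans (≅-neg (res-≅ a)) (≅-sym (res-≅ (- a))))))
      (gen-neg (res a) g)

    reach-* : ∀ k a → Reach a → Reach (+ k *ℤ a)
    reach-* zero a g = reach-0 (≅-reflexive (ℤ.*-zeroˡ a))
    reach-* (suc k) a g = subst Reach (sym (trans (cong (_*ℤ a) (ℤ.pos-+ 1 k)) (trans (ℤ.*-distribʳ-+ a (+ 1) (+ k)) (cong (_+ℤ + k *ℤ a) (ℤ.*-identityˡ a)))))
      (reach-+ a (+ k *ℤ a) g (reach-* k a g))

    reach-≡ : ∀ {a b} → a ≡ b → Reach a → Reach b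
    reach-≡ = subst Reach

    -- Bézout: the reachable residues form a subgroup.
    reach-gcd : ∀ a b → Reach (+ a) → Reach (+ b) → Reach (+ gcd a b)
    reach-gcd a b ga gb = go (G.Bézout.identity (G.gcd-GCD a b))
      where
      recover : ∀ g y → g ≡ (g +ℤ y) +ℤ (- y)
      recover = solve-∀
      go : G.Bézout.Identity (gcd a b) a b → Reach (+ gcd a b)
      go (G.Bézout.+- x y eq) = reach-≡ (sym (trans (recover (+ gcd a b) (+ y *ℤ + b)) (cong (_+ℤ (- (+ y *ℤ + b)))
          (trans (cong (+ gcd a b +ℤ_) (sym (ℤ.pos-* y b))) (trans (cong +_ eq) (ℤ.pos-* x a))))))
        (reach-+ (+ x *ℤ + a) (- (+ y *ℤ + b)) (reach-* x (+ a) ga) (reach-neg (+ y *ℤ + b) (reach-* y (+ b) gb)))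
      go (G.Bézout.-+ x y eq) = reach-≡ (sym (trans (recover (+ gcd a b) (+ x *ℤ + a)) (cong (_+ℤ (- (+ x *ℤ + a)))
          (trans (cong (+ gcd a b +ℤ_) (sym (ℤ.pos-* x a))) (trans (cong +_ eq) (ℤ.pos-* y b))))))
        (reach-+ (+ y *ℤ + b) (- (+ x *ℤ + a)) (reach-* y (+ b) gb) (reach-neg (+ x *ℤ + a) (reach-* x (+ a) ga)))

    -- The gcd is accumulated along the list, starting from n, which is reachable because it
    -- represents 0. At the end g is a reachable divisor of n and of all elements of Ω.
    common-divisor : ∀ xs → ∃ λ g → Reach (+ g) × g ∣ suc m × (∀ {x} → x ∈ xs → lookup Ω x ≡ true → g ∣ toℕ x)
    common-divisor [] = suc m , reach-0 (0-≅ℕ Dv.∣-refl) , Dv.∣-refl , λ ()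
    common-divisor (x ∷ xs) = go (common-divisor xs) (lookup Ω x) refl
      where
      go : (∃ λ g → Reach (+ g) × g ∣ suc m × (∀ {x} → x ∈ xs → lookup Ω x ≡ true → g ∣ toℕ x)) → ∀ b → lookup Ω x ≡ b →
        ∃ λ g → Reach (+ g) × g ∣ suc m × (∀ {y} → y ∈ (x ∷ xs) → lookup Ω y ≡ true → g ∣ toℕ y)
      go (g , r , g∣n , h) false e = g , r , g∣n , λ where
        (here refl) h′ → contradiction (trans (sym e) h′) λ ()
        (there y∈) h′ → h y∈ h′
      go (g , r , g∣n , h) true e = gcd g (toℕ x)
        , reach-gcd g (toℕ x) r (subst (Gen Ω) (⟦⟧-injective {x = x} {y = res ⟦ x ⟧} (≅-sym (res-≅ ⟦ x ⟧))) (gen-mem x (lookup⇒∈ₛ e)))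
        , Dv.∣-trans (G.gcd[m,n]∣m g (toℕ x)) g∣n
        , λ where
            (here refl) h′ → G.gcd[m,n]∣n g (toℕ x)
            (there y∈) h′ → Dv.∣-trans (G.gcd[m,n]∣m g (toℕ x)) (h y∈ h′)

    -- No prime factor of n divides the reachable common divisor, so it is 1, and y is reached as y
    -- times 1.
    indivisible⇒Generates : (∀ i → ¬ Divides Ω i) → Generates Ω
    indivisible⇒Generates ind y = go (common-divisor (allFin (suc m)))
      where
      go : (∃ λ g → Reach (+ g) × g ∣ suc m × (∀ {x} → x ∈ allFin (suc m) → lookup Ω x ≡ true → g ∣ toℕ x)) → Gen Ω y
      go (g , r , g∣n , h) = subst (Gen Ω) (⟦⟧-injective (≅-trans (res-≅ (⟦ y ⟧ *ℤ + 1)) (≅-reflexive (ℤ.*-identityʳ ⟦ y ⟧))))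
        (reach-* (toℕ y) (+ 1) (subst (λ g → Reach (+ g)) (prime-factor g∣n (λ i d → ind i (λ x x∈ → Dv.∣-trans d (h (∈-allFin x) x∈)))) r))

  Conn⇒ConnectionSet : ∀ {Ω} → Conn Ω → ConnectionSet Ω
  Conn⇒ConnectionSet {Ω} c = indivisible⇒Generates Ω (indivisible c)
    , (λ x x∈ → lookup⇒∈ₛ (trans (sym (lookup-neg Ω x)) (trans (cong (λ B → lookup B x) (symmetric c)) (∈ₛ⇒lookup x∈))))
    , (λ x z x∈ → contradiction (trans (sym (zero∉ c)) (subst (λ y → lookup Ω y ≡ true) (F.toℕ-injective {j = Fin.zero} z) (∈ₛ⇒lookup x∈))) λ ())

  •-zero : ∀ u → u • Fin.zero ≡ Fin.zero {m}
  •-zero u = ⟦⟧-injective (≅-trans (⟦•⟧ u Fin.zero) (≅-reflexive (ℤ.*-zeroʳ u)))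

  Conn-pull : ∀ {Ω} u → Invertible u (suc m) → Conn Ω → Conn (pull u Ω)
  Conn-pull {Ω} u (v , uv) c = conn
    (λ i h → indivisible c i (λ x x∈ → ≅-0 {x = ⟦ x ⟧} (≅-trans (≅-weaken (q∣n i) (≅-trans (≅-reflexive (cong ⟦_⟧ (sym (back x)))) (⟦•⟧ u (v • x))))
      (≅-trans (≅-*ˡ u (0-≅ℕ (h (v • x) (trans (lookup-pull u Ω (v • x)) (trans (cong (lookup Ω) (back x)) x∈))))) (≅-reflexive (ℤ.*-zeroʳ u))))))
    (trans (pull-pull (- + 1) u Ω) (trans (cong (λ w → pull w Ω) (ℤ.*-comm u (- + 1))) (trans (sym (pull-pull u (- + 1) Ω)) (cong (pull u) (symmetric c)))))
    (trans (lookup-pull u Ω Fin.zero) (trans (cong (lookup Ω) (•-zero u)) (zero∉ c)))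
    where
    back : ∀ x → u • v • x ≡ x
    back x = trans (•-• u v x) (trans (•-cong x uv) (1-• x))

  sized? : ∀ k Ω → Dec (Conn Ω × ∣ Ω ∣ ≡ k)
  sized? k Ω = conn? Ω ×-dec (∣ Ω ∣ ℕ.≟ k)

  connectionSets : ℕ → List (Subset (suc m))
  connectionSets k = filter (sized? k) (allSubsets (suc m))

  connectionSets-unique : ∀ k → Unique (connectionSets k)
  connectionSets-unique k = U.filter⁺ (sized? k) (allSubsets-unique (suc m))

  ∈-connectionSets⁺ : ∀ {k Ω} → Conn Ω → ∣ Ω ∣ ≡ k → Ω ∈ connectionSets k
  ∈-connectionSets⁺ {k} {Ω} c s = ∈-filter⁺ (sized? k) (allSubsets-complete Ω) (c , s)

  ∈-connectionSets⁻ : ∀ {k Ω} → Ω ∈ connectionSets k → Conn Ω × ∣ Ω ∣ ≡ k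
  ∈-connectionSets⁻ {k} Ω∈ = proj₂ (∈-filter⁻ (sized? k) {xs = allSubsets (suc m)} Ω∈)

  -- As n is the product of the distinct primes `q i`, a residue divisible by all of them is 0.
  nonzero-type : ∀ x → toℕ {suc m} x ≢ 0 → Nonempty (type (toℕ x))
  nonzero-type x n = go (F.any? (λ i → lookup (type (toℕ x)) i B.≟ true))
    where
    go : Dec (Nonempty (type (toℕ x))) → Nonempty (type (toℕ x))
    go (yes h) = h
    go (no h) = contradiction (≅-small (F.toℕ<n x) (s≤s z≤n) (≅-n (λ i → 0-≅ℕ (type-false (toℕ x) i (B.¬-not (λ t → h (i , t))))))) n

  module FixedSets (u : ℤ) (u-inv : Invertible u (suc m)) (d : Fin l → ℕ) (u-index : ∀ i → PrimeIndex.Index (p i) (pr i) u (d i)) where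

    open Classes u u-inv d u-index

    -- The conditions on a fixed connection set other than generation, which is imposed separately
    -- by inclusion and exclusion. They describe the unions of classes that avoid 0.
    record Base (Ω : Subset (suc m)) : Set where
      constructor base
      field
        fixed : pull u Ω ≡ Ω
        negated : pull (- + 1) Ω ≡ Ω
        no-zero : lookup Ω Fin.zero ≡ false
    open Base

    base? : ∀ Ω → Dec (Base Ω)
    base? Ω = map′ (λ (a , b , c) → base a b c) (λ c → fixed c , negated c , no-zero c)
      ((pull u Ω ≟ₛ Ω) ×-dec ((pull (- + 1) Ω ≟ₛ Ω) ×-dec (lookup Ω Fin.zero B.≟ false)))

    DividesAll : Subset (suc l) → Subset (suc m) → Set
    DividesAll R Ω = ∀ i → lookup R i ≡ true → Divides Ω i

    dividesAll? : ∀ R Ω → Dec (DividesAll R Ω)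
    dividesAll? R Ω = F.all? (λ i → (lookup R i B.≟ true) →-dec divides? Ω i)

    baseDividing? : ∀ R Ω → Dec (Base Ω × DividesAll R Ω)
    baseDividing? R Ω = base? Ω ×-dec dividesAll? R Ω

    baseDividing : Subset (suc l) → List (Subset (suc m))
    baseDividing R = filter (baseDividing? R) (allSubsets (suc m))

    fixed-power : ∀ {Ω : Subset (suc m)} → pull u Ω ≡ Ω → ∀ j → pull (u ^ℤ j) Ω ≡ Ω
    fixed-power {Ω} h zero = pull-1 Ω
    fixed-power {Ω} h (suc j) = trans (sym (pull-pull (u ^ℤ j) u Ω)) (trans (cong (pull (u ^ℤ j)) h) (fixed-power h j))

    fixed-multiplier : ∀ {Ω} → Base Ω → ∀ s j → pull (multiplier s j) Ω ≡ Ω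
    fixed-multiplier {Ω} b s j = trans (sym (pull-pull (u ^ℤ j) (sign s) Ω)) (trans (cong (pull (u ^ℤ j)) (fixed-sign s)) (fixed-power (fixed b) j))
      where
      fixed-sign : ∀ s → pull (sign s) Ω ≡ Ω
      fixed-sign false = pull-1 Ω
      fixed-sign true = negated b

    Base⇒Closed : ∀ {Ω} → Base Ω → Closed Ω
    Base⇒Closed {Ω} b {x} r h with related-elim r
    ... | s , j , refl = trans (sym (lookup-pull (multiplier s j) Ω x)) (trans (cong (λ B → lookup B x) (fixed-multiplier b s j)) h)

    Closed⇒pull : ∀ {Ω} g → (∀ x → Related x (g • x)) → Closed Ω → pull g Ω ≡ Ω
    Closed⇒pull {Ω} g r cl = lookup-ext λ x → trans (lookup-pull g Ω x) (bool-cong (cl (related-sym (r x))) (cl (r x)))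

    Closed⇒Base : ∀ {Ω} → Closed Ω → lookup Ω Fin.zero ≡ false → Base Ω
    Closed⇒Base cl z = base
      (Closed⇒pull u (λ x → related-intro false 1 (cong (_• x) (trans (ℤ.*-identityˡ (u ^ℤ 1)) (ℤ.*-identityʳ u)))) cl)
      (Closed⇒pull (- + 1) (λ x → related-intro true 0 refl) cl) z

    -- Sets fixed by u and by -1 are unions of classes; the conditions imposed by R select the admissible types.
    count-baseDividing : ∀ R k → ∑ (baseDividing R) (λ Ω → ⟪ ∣ Ω ∣ ℕ.≟ k ⟫) ≡ coeff k (genfun p d R)
    count-baseDividing R k = trans
      (closed-genfun (ofTypes? (types R)) (λ r h → subst (_∈ types R) (related-type r) h) (baseDividing R)
        (U.filter⁺ (baseDividing? R) (allSubsets-unique (suc m))) (λ {B} → to {B}) from k)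
      (at (≈ₚ-trans (∏-types (types R) (types-unique R)) (∏-types-genfun p d R)) k)
      where
      to : ∀ {B} → B ∈ baseDividing R → Closed B × (∀ {x} → lookup B x ≡ true → τ x ∈ types R)
      to {B} B∈ with ∈-filter⁻ (baseDividing? R) {xs = allSubsets (suc m)} B∈
      ... | _ , b , dv = Base⇒Closed b , λ {x} h → ∈-types⁺ R (τ x)
        (nonzero-type x (λ z → contradiction (trans (sym (no-zero b)) (subst (λ y → lookup B y ≡ true) (F.toℕ-injective {j = Fin.zero} z) h)) λ ()))
        (avoiding (λ i ri → B.¬-not (λ t → type-true⁻ (toℕ x) i t (dv i ri x h))))
      from : ∀ {B} → Closed B → (∀ {x} → lookup B x ≡ true → τ x ∈ types R) → B ∈ baseDividing R
      from {B} cl ty = ∈-filter⁺ (baseDividing? R) (allSubsets-complete B)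
        (Closed⇒Base cl (zero-out (lookup B Fin.zero) refl) , λ i ri x h → type-false (toℕ x) i (avoid (proj₂ (∈-types⁻ R (ty h))) i ri))
        where
        zero-out : ∀ b → lookup B Fin.zero ≡ b → b ≡ false
        zero-out false _ = refl
        zero-out true h with proj₁ (∈-types⁻ R (ty h))
        ... | i , t = contradiction (trans (sym t) (lookup-type-0 i)) λ ()

    indicator-∏ : ∀ R Ω → ∏ (allFin (suc l)) (λ i → if lookup R i then ⟪ divides? Ω i ⟫ else + 1) ≡ ⟪ dividesAll? R Ω ⟫
    indicator-∏ R Ω = trans (∏-cong (allFin (suc l)) (λ {i} _ → implies (lookup R i) (divides? Ω i)))
      (∏-⟪⟫ (λ i → (lookup R i B.≟ true) →-dec divides? Ω i) (dividesAll? R Ω) id id)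
      where
      implies : ∀ b {P : Set} (P? : Dec P) → (if b then ⟪ P? ⟫ else + 1) ≡ ⟪ (b B.≟ true) →-dec P? ⟫
      implies true P? = ⟪⟫-cong P? ((true B.≟ true) →-dec P?) (λ x _ → x) (λ f → f refl)
      implies false P? = sym (⟪⟫-yes ((false B.≟ true) →-dec P?) λ ())

    indicator-indivisible : ∀ Ω → ⟪ F.all? (λ i → ¬? (divides? Ω i)) ⟫ ≡ ∑ (allSubsets (suc l)) (λ R → sgn ∣ R ∣ *ℤ ⟪ dividesAll? R Ω ⟫)
    indicator-indivisible Ω = begin
      ⟪ F.all? (λ i → ¬? (divides? Ω i)) ⟫ ≡⟨ sym (∏-⟪⟫ (λ i → ¬? (divides? Ω i)) (F.all? (λ i → ¬? (divides? Ω i))) id id) ⟩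
      ∏ (allFin (suc l)) (λ i → ⟪ ¬? (divides? Ω i) ⟫) ≡⟨ ∏-cong (allFin (suc l)) (λ {i} _ → complement (divides? Ω i)) ⟩
      ∏ (allFin (suc l)) (λ i → + 1 -ℤ ⟪ divides? Ω i ⟫) ≡⟨ sym (moebius (suc l) (λ i → ⟪ divides? Ω i ⟫)) ⟩
      ∑ (allSubsets (suc l)) (λ R → sgn ∣ R ∣ *ℤ ∏ (allFin (suc l)) (λ i → if lookup R i then ⟪ divides? Ω i ⟫ else + 1))
        ≡⟨ ∑-cong (allSubsets (suc l)) (λ {R} _ → cong (sgn ∣ R ∣ *ℤ_) (indicator-∏ R Ω)) ⟩
      ∑ (allSubsets (suc l)) (λ R → sgn ∣ R ∣ *ℤ ⟪ dividesAll? R Ω ⟫) ∎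
      where
      open ≡-Reasoning
      complement : {P : Set} (P? : Dec P) → ⟪ ¬? P? ⟫ ≡ + 1 -ℤ ⟪ P? ⟫
      complement (yes _) = refl
      complement (no _) = refl

    -- The indicator of a fixed connection set of size k splits into indivisibility, `Base` and the
    -- size. Expanding only the first by Möbius inversion leaves, for each R, a count of unions of
    -- classes.
    count-fixed : 1 ≤ l → ∀ k → ∑ (connectionSets k) (λ Ω → ⟪ pull u Ω ≟ₛ Ω ⟫) ≡ coeff k (bracket p d)
    count-fixed 1≤l k = begin
      ∑ (connectionSets k) (λ Ω → ⟪ pull u Ω ≟ₛ Ω ⟫) ≡⟨ ∑-⟪⟫-filter (sized? k) Ωs (λ Ω → ⟪ pull u Ω ≟ₛ Ω ⟫) ⟩
      ∑ Ωs (λ Ω → ⟪ sized? k Ω ⟫ *ℤ ⟪ pull u Ω ≟ₛ Ω ⟫) ≡⟨ ∑-cong Ωs (λ {Ω} _ → regroup Ω) ⟩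
      ∑ Ωs (λ Ω → ⟪ F.all? (λ i → ¬? (divides? Ω i)) ⟫ *ℤ (⟪ base? Ω ⟫ *ℤ ⟪ ∣ Ω ∣ ℕ.≟ k ⟫)) ≡⟨ ∑-cong Ωs (λ {Ω} _ → expand Ω) ⟩
      ∑ Ωs (λ Ω → ∑ Rs (λ R → sgn ∣ R ∣ *ℤ (⟪ baseDividing? R Ω ⟫ *ℤ ⟪ ∣ Ω ∣ ℕ.≟ k ⟫)))
        ≡⟨ ∑-swap Ωs Rs (λ Ω R → sgn ∣ R ∣ *ℤ (⟪ baseDividing? R Ω ⟫ *ℤ ⟪ ∣ Ω ∣ ℕ.≟ k ⟫)) ⟩
      ∑ Rs (λ R → ∑ Ωs (λ Ω → sgn ∣ R ∣ *ℤ (⟪ baseDividing? R Ω ⟫ *ℤ ⟪ ∣ Ω ∣ ℕ.≟ k ⟫)))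
        ≡⟨ ∑-cong Rs (λ {R} _ → trans (∑-*ˡ (sgn ∣ R ∣) Ωs (λ Ω → ⟪ baseDividing? R Ω ⟫ *ℤ ⟪ ∣ Ω ∣ ℕ.≟ k ⟫)) (cong (sgn ∣ R ∣ *ℤ_)
             (trans (sym (∑-⟪⟫-filter (baseDividing? R) Ωs (λ Ω → ⟪ ∣ Ω ∣ ℕ.≟ k ⟫))) (count-baseDividing R k)))) ⟩
      ∑ Rs (λ R → sgn ∣ R ∣ *ℤ coeff k (genfun p d R)) ≡⟨ sym (coeff-bracket p d 1≤l k) ⟩
      coeff k (bracket p d) ∎
      where
      open ≡-Reasoning
      Ωs = allSubsets (suc m)
      Rs = allSubsets (suc l)
      regroup : ∀ Ω → ⟪ sized? k Ω ⟫ *ℤ ⟪ pull u Ω ≟ₛ Ω ⟫ ≡ ⟪ F.all? (λ i → ¬? (divides? Ω i)) ⟫ *ℤ (⟪ base? Ω ⟫ *ℤ ⟪ ∣ Ω ∣ ℕ.≟ k ⟫)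
      regroup Ω = trans (sym (⟪⟫-× (sized? k Ω) (pull u Ω ≟ₛ Ω))) (trans
        (⟪⟫-cong (sized? k Ω ×-dec (pull u Ω ≟ₛ Ω)) (F.all? (λ i → ¬? (divides? Ω i)) ×-dec (base? Ω ×-dec (∣ Ω ∣ ℕ.≟ k)))
          (λ ((c , s) , f) → indivisible c , base f (symmetric c) (zero∉ c) , s)
          (λ (i , b , s) → (conn i (negated b) (no-zero b) , s) , fixed b))
        (trans (⟪⟫-× (F.all? (λ i → ¬? (divides? Ω i))) (base? Ω ×-dec (∣ Ω ∣ ℕ.≟ k)))
          (cong (⟪ F.all? (λ i → ¬? (divides? Ω i)) ⟫ *ℤ_) (⟪⟫-× (base? Ω) (∣ Ω ∣ ℕ.≟ k)))))
      reassoc : ∀ s a b c → (s *ℤ a) *ℤ (b *ℤ c) ≡ s *ℤ ((b *ℤ a) *ℤ c)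
      reassoc = solve-∀
      expand : ∀ Ω → ⟪ F.all? (λ i → ¬? (divides? Ω i)) ⟫ *ℤ (⟪ base? Ω ⟫ *ℤ ⟪ ∣ Ω ∣ ℕ.≟ k ⟫)
        ≡ ∑ Rs (λ R → sgn ∣ R ∣ *ℤ (⟪ baseDividing? R Ω ⟫ *ℤ ⟪ ∣ Ω ∣ ℕ.≟ k ⟫))
      expand Ω = trans (cong (_*ℤ (⟪ base? Ω ⟫ *ℤ ⟪ ∣ Ω ∣ ℕ.≟ k ⟫)) (indicator-indivisible Ω))
        (trans (sym (∑-*ʳ Rs (λ R → sgn ∣ R ∣ *ℤ ⟪ dividesAll? R Ω ⟫) (⟪ base? Ω ⟫ *ℤ ⟪ ∣ Ω ∣ ℕ.≟ k ⟫)))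
        (∑-cong Rs (λ {R} _ → trans (reassoc (sgn ∣ R ∣) ⟪ dividesAll? R Ω ⟫ ⟪ base? Ω ⟫ ⟪ ∣ Ω ∣ ℕ.≟ k ⟫)
          (cong (λ z → sgn ∣ R ∣ *ℤ (z *ℤ ⟪ ∣ Ω ∣ ℕ.≟ k ⟫)) (sym (⟪⟫-× (base? Ω) (dividesAll? R Ω)))))))

-- Summation over the units

module Assembly (l : ℕ) (1≤l : 1 ≤ l) (p : Fin l → ℕ) (pr : ∀ i → Prime (p i)) (odd : ∀ i → p i % 2 ≡ 1) (inj : Injective _≡_ _≡_ p)
  (m : ℕ) (n-def : suc m ≡ prodF (suc l) (Setting.q l p pr odd inj)) (k : ℕ) where

  open Connection l p pr odd inj m n-def

  X : List (Subset (suc m))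
  X = connectionSets k

  X-closed : ∀ {Ω} u → Invertible u (suc m) → Ω ∈ X → pull u Ω ∈ X
  X-closed {Ω} u ui Ω∈ = ∈-connectionSets⁺ (Conn-pull u ui (proj₁ (∈-connectionSets⁻ Ω∈))) (trans (∣pull∣ Ω ui) (proj₂ (∈-connectionSets⁻ Ω∈)))

  open Burnside X (connectionSets-unique k) (λ {Ω} → X-closed {Ω})

  index : Fin l → ℕ → ℕ
  index i = PrimeIndex.index (p i) (pr i)

  ds : List (Fin l → ℕ)
  ds = tuples l (λ i → divisors (p i ∸ 1))

  matches? : ∀ (d : Fin l → ℕ) u → Dec (∀ i → d i ≡ index i u)
  matches? d u = F.all? (λ i → d i ℕ.≟ index i u)

  match : (Fin l → ℕ) → ℕ → ℤ
  match d u = ∏ (allFin l) (λ i → ⟪ d i ℕ.≟ index i u ⟫)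

  matches-∏ : ∀ d u → match d u ≡ ⟪ matches? d u ⟫
  matches-∏ d u = ∏-⟪⟫ (λ i → d i ℕ.≟ index i u) (matches? d u) id id

  invertible-p : ∀ {u} → Invertible u (suc m) → ∀ i → Invertible u (p i)
  invertible-p ui i = invertible-q ui (Fin.suc i)

  index-correct : ∀ u → Invertible (+ u) (suc m) → ∀ i → PrimeIndex.Index (p i) (pr i) (+ u) (index i u)
  index-correct u ui i = PrimeIndex.index-correct (p i) (pr i) (invertible-p ui i)

  fixedCount : ℕ → ℤ
  fixedCount u = ∑ X (λ Ω → ⟪ pull (+ u) Ω ≟ₛ Ω ⟫)

  fixedCount-bracket : ∀ u → Invertible (+ u) (suc m) → ∀ d → (∀ i → d i ≡ index i u) → fixedCount u ≡ coeff k (bracket p d)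
  fixedCount-bracket u ui d e = FixedSets.count-fixed (+ u) ui d
    (λ i → subst (PrimeIndex.Index (p i) (pr i) (+ u)) (sym (e i)) (index-correct u ui i)) 1≤l k

  -- Summing over all tuples d, of which exactly one matches u, avoids comparing tuples as functions.
  fixedCount-∑ : ∀ u → Invertible (+ u) (suc m) →
    fixedCount u ≡ ∑ ds (λ d → match d u *ℤ coeff k (bracket p d))
  fixedCount-∑ u ui = sym (begin
    ∑ ds (λ d → match d u *ℤ coeff k (bracket p d))
      ≡⟨ ∑-cong ds (λ {d} _ → trans (cong (_*ℤ coeff k (bracket p d)) (matches-∏ d u))
           (trans (⟪⟫-*-cong (matches? d u) (λ e → sym (fixedCount-bracket u ui d e))) (cong (_*ℤ fixedCount u) (sym (matches-∏ d u))))) ⟩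
    ∑ ds (λ d → match d u *ℤ fixedCount u)
      ≡⟨ ∑-*ʳ ds (λ d → match d u) (fixedCount u) ⟩
    ∑ ds (λ d → match d u) *ℤ fixedCount u
      ≡⟨ cong (_*ℤ fixedCount u) (trans (∑-tuples l (λ i → divisors (p i ∸ 1)) (λ i a → ⟪ a ℕ.≟ index i u ⟫))
           (∏-1 (allFin l) (λ {i} _ → unique-match i))) ⟩
    + 1 *ℤ fixedCount u ≡⟨ ℤ.*-identityˡ (fixedCount u) ⟩
    fixedCount u ∎)
    where
    open ≡-Reasoning
    unique-match : ∀ i → ∑ (divisors (p i ∸ 1)) (λ a → ⟪ a ℕ.≟ index i u ⟫) ≡ + 1
    unique-match i = trans (∑-single {f = λ a → ⟪ a ℕ.≟ index i u ⟫} (divisors-unique (p i ∸ 1))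
      (PrimeIndex.Index-divisor (p i) (pr i) {+ u} (index-correct u ui i)) (λ {a} _ n → ⟪⟫-no (a ℕ.≟ index i u) n))
      (⟪⟫-yes (index i u ℕ.≟ index i u) refl)

  -- The local conditions whose product singles out the units with indices d: oddness at the prime
  -- 2, the prescribed index at each p_i.
  factor : (Fin l → ℕ) → Fin (suc l) → ℕ → ℤ
  factor d Fin.zero x = ⟪ lookup (type x) Fin.zero B.≟ true ⟫
  factor d (Fin.suc i) x = ⟪ d i ℕ.≟ index i x ⟫

  factor-periodic : ∀ d i → Periodic (q i) (factor d i)
  factor-periodic d Fin.zero x y c = cong (λ b → ⟪ b B.≟ true ⟫) (type-≅ x y Fin.zero c)
  factor-periodic d (Fin.suc i) x y c = cong (λ j → ⟪ d i ℕ.≟ j ⟫) (PrimeIndex.index-≅ (p i) (pr i) x y c)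

  -- A matching index is positive, so p_i does not divide x. Once all indices match, being prime to
  -- n thus amounts to being odd; all conditions are local and the sum over residues becomes a
  -- product.
  count-units : ∀ {d} → d ∈ ds → ∑ (units (suc m)) (match d)
    ≡ + prodF l (λ i → φ (div (p i ∸ 1) (d i)))
  count-units {d} d∈ = begin
    ∑ (units (suc m)) (match d) ≡⟨ cong (λ us → ∑ us (match d)) (units-def (suc m)) ⟩
    ∑ (filter (λ j → gcd j (suc m) ℕ.≟ 1) (upTo (suc m))) (match d) ≡⟨ ∑-⟪⟫-filter (λ j → gcd j (suc m) ℕ.≟ 1) (upTo (suc m)) (match d) ⟩
    ∑ (upTo (suc m)) (λ x → ⟪ gcd x (suc m) ℕ.≟ 1 ⟫ *ℤ match d x) ≡⟨ ∑-cong (upTo (suc m)) (λ {x} _ → trans (same x) (sym (∏-allFin (λ i → factor d i x)))) ⟩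
    ∑ (upTo (suc m)) (λ x → ∏ (allFin (suc l)) (λ i → factor d i x)) ≡⟨ cong (λ n → ∑ (upTo n) (λ x → ∏ (allFin (suc l)) (λ i → factor d i x))) n-def ⟩
    ∑ (upTo (prodF (suc l) q)) (λ x → ∏ (allFin (suc l)) (λ i → factor d i x)) ≡⟨ ∑-crt (suc l) q q-nonZero q-coprime (factor d) (factor-periodic d) ⟩
    ∏ (allFin (suc l)) (λ i → ∑ (upTo (q i)) (factor d i)) ≡⟨ ∏-allFin (λ i → ∑ (upTo (q i)) (factor d i)) ⟩
    ∑ (upTo 2) (factor d Fin.zero) *ℤ ∏ (allFin l) (λ i → ∑ (upTo (p i)) (λ x → ⟪ d i ℕ.≟ index i x ⟫))
      ≡⟨ cong₂ _*ℤ_ (residues-of-type Fin.zero true) (∏-cong (allFin l) (λ {i} _ → PrimeIndex.count-index (p i) (pr i) (∈-tuples l (λ i → divisors (p i ∸ 1)) d∈ i))) ⟩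
    + 1 *ℤ ∏ (allFin l) (λ i → + φ (div (p i ∸ 1) (d i))) ≡⟨ ℤ.*-identityˡ (∏ (allFin l) (λ i → + φ (div (p i ∸ 1) (d i)))) ⟩
    ∏ (allFin l) (λ i → + φ (div (p i ∸ 1) (d i))) ≡⟨ sym (∏-foldr (λ i → φ (div (p i ∸ 1) (d i))) (allFin l)) ⟩
    + prodF l (λ i → φ (div (p i ∸ 1) (d i))) ∎
    where
    open ≡-Reasoning
    odd? : ∀ x → Dec (lookup (type x) Fin.zero ≡ true)
    odd? x = lookup (type x) Fin.zero B.≟ true
    coprime-n : ∀ x → (∀ i → d i ≡ index i x) → lookup (type x) Fin.zero ≡ true → gcd x (suc m) ≡ 1
    coprime-n x e t = C.coprime⇒gcd≡1 (subst (Coprime x) (sym n-def) (coprime-prodF (suc l) q local))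
      where
      local : ∀ i → Coprime x (q i)
      local Fin.zero = non-multiple-coprime Fin.zero (type-true⁻ x Fin.zero t)
      local (Fin.suc i) = non-multiple-coprime (Fin.suc i) (λ dv → ℕ.<⇒≢ (proj₂ (∈-divisors⁻ {p i ∸ 1} (∈-tuples l (λ i → divisors (p i ∸ 1)) d∈ i)))
        (sym (trans (e i) (PrimeIndex.index-multiple (p i) (pr i) dv))))
    same : ∀ x → ⟪ gcd x (suc m) ℕ.≟ 1 ⟫ *ℤ match d x ≡ ⟪ odd? x ⟫ *ℤ match d x
    same x = trans (ℤ.*-comm ⟪ gcd x (suc m) ℕ.≟ 1 ⟫ (match d x)) (trans (cong (_*ℤ ⟪ gcd x (suc m) ℕ.≟ 1 ⟫) (matches-∏ d x))
      (trans (⟪⟫-*-cong (matches? d x) (λ e → ⟪⟫-cong (gcd x (suc m) ℕ.≟ 1) (odd? x)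
        (λ g → type-true⁺ x Fin.zero (λ dv → 1≇0 Fin.zero (even-absurd x g dv)))
        (coprime-n x e)))
      (trans (cong (_*ℤ ⟪ odd? x ⟫) (sym (matches-∏ d x))) (ℤ.*-comm (match d x) ⟪ odd? x ⟫))))
      where
      even-absurd : ∀ x → gcd x (suc m) ≡ 1 → 2 ∣ x → + 1 ≅ + 0 [ 2 ]
      even-absurd x g dv = 0-≅ℕ (subst (2 ∣_) g (G.gcd-greatest dv (q∣n Fin.zero)))

  total : + φ (suc m) *ℤ + length reps ≡ coeff k (RHSnum l p)
  total = begin
    + φ (suc m) *ℤ + length reps ≡⟨ cong (λ j → + j *ℤ + length reps) (φ-units (suc m)) ⟩
    + length us *ℤ + length reps ≡⟨ burnside ⟩
    ∑ us fixedCount ≡⟨ ∑-cong us (λ {u} u∈ → fixedCount-∑ u (proj₂ (∈-units⁻ u∈))) ⟩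
    ∑ us (λ u → ∑ ds (λ d → match d u *ℤ coeff k (bracket p d)))
      ≡⟨ ∑-swap us ds (λ u d → match d u *ℤ coeff k (bracket p d)) ⟩
    ∑ ds (λ d → ∑ us (λ u → match d u *ℤ coeff k (bracket p d)))
      ≡⟨ ∑-cong ds (λ {d} d∈ → trans (∑-*ʳ us (match d) (coeff k (bracket p d)))
           (trans (cong (_*ℤ coeff k (bracket p d)) (count-units d∈)) (sym (coeff-pscale k (weight d) (bracket p d))))) ⟩
    ∑ ds (λ d → coeff k (pscale (weight d) (bracket p d))) ≡⟨ sym (coeff-psum k (λ d → pscale (weight d) (bracket p d)) ds) ⟩
    coeff k (RHSnum l p) ∎
    where
    open ≡-Reasoning
    us = units (suc m)
    weight : (Fin l → ℕ) → ℤ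
    weight d = + prodF l (λ i → φ (div (p i ∸ 1) (d i)))

  classCount : ClassCount (suc m) k (length reps)
  classCount = reps , refl
    , All.tabulate (λ Ω∈ → let (c , s) = ∈-connectionSets⁻ (deduplicate-⊆ _∼?_ X Ω∈) in Conn⇒ConnectionSet c , s)
    , AllPairs.map (λ n w → n (WE⇒∼ w)) (deduplicate-≁ _∼?_ X)
    , λ Ω c s → Any.map ∼⇒WE (rep-exists (∈-connectionSets⁺ (ConnectionSet⇒Conn c) s))

  no-reps : (∀ {Ω} → ¬ Ω ∈ X) → length reps ≡ 0
  no-reps n = go reps (λ Ω∈ → n (deduplicate-⊆ _∼?_ X Ω∈))
    where
    go : ∀ Ωs → (∀ {Ω} → ¬ Ω ∈ Ωs) → length Ωs ≡ 0
    go [] _ = refl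
    go (Ω ∷ Ωs) h = contradiction (here refl) h

  -- Every prime divides all elements of the empty set, which therefore fails to be indivisible.
  X-nonempty-set : ∀ {Ω} → Ω ∈ X → k ≢ 0
  X-nonempty-set {Ω} Ω∈ k0 = Conn.indivisible (proj₁ (∈-connectionSets⁻ Ω∈)) Fin.zero
    λ x x∈ → contradiction (∣∣-positive⁺ Ω (x , x∈)) (ℕ.<⇒≱ (s≤s (ℕ.≤-reflexive (trans (proj₂ (∈-connectionSets⁻ {k} Ω∈)) k0))))

  -- A subset with at least n elements is everything and contains 0.
  X-proper-set : ∀ {Ω} → Ω ∈ X → ¬ suc m ≤ k
  X-proper-set {Ω} Ω∈ h = contradiction (trans (sym (Conn.zero∉ (proj₁ (∈-connectionSets⁻ {k} Ω∈))))
    (cong (λ B → lookup B Fin.zero) (FS.∣p∣≡n⇒p≡⊤ {p = Ω} (ℕ.≤-antisym (FS.∣p∣≤n Ω) (subst (suc m ≤_) (sym (proj₂ (∈-connectionSets⁻ {k} Ω∈))) h))))) λ ()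

  psiCoeff : PsiCoeff (suc m) k (length reps)
  psiCoeff = go (k ℕ.≟ 0) (suc m ℕ.≤? k)
    where
    go : Dec (k ≡ 0) → Dec (suc m ≤ k) → PsiCoeff (suc m) k (length reps)
    go (yes e) _ = inj₂ (inj₁ e , no-reps (λ Ω∈ → X-nonempty-set Ω∈ e))
    go (no _) (yes h) = inj₂ (inj₂ h , no-reps (λ Ω∈ → X-proper-set Ω∈ h))
    go (no k≢0) (no n≰k) = inj₁ (ℕ.n≢0⇒n>0 k≢0 , ℕ.≰⇒> n≰k , classCount)

theorem4p7 : (ℓ : ℕ) → 1 ≤ ℓ →
    (p : Fin ℓ → ℕ) → (∀ i → Prime (p i)) → (∀ i → p i % 2 ≡ 1) →
    Injective _≡_ _≡_ p →
    (n : ℕ) → n ≡ 2 * prodF ℓ p →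
    ∀ k → ∃[ m ] (PsiCoeff n k m × (+ φ n) *ℤ (+ m) ≡ coeff k (RHSnum ℓ p))
theorem4p7 ℓ 1≤ℓ p pr odd inj zero e k = contradiction (sym e)
  (ℕ.≢-nonZero⁻¹ (2 * prodF ℓ p) {{ℕ.m*n≢0 2 (prodF ℓ p) {{_}} {{prodF-nonZero ℓ p (λ i → Pr.prime⇒nonZero (pr i))}}}})
theorem4p7 ℓ 1≤ℓ p pr odd inj (suc m) e k = _ , psiCoeff , total
  where open Assembly ℓ 1≤ℓ p pr odd inj m (trans e (sym (prodF-suc ℓ (Setting.q ℓ p pr odd inj)))) k using (psiCoeff; total)
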